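{- Let $p$ be an odd prime and let $k\ge 2$ be an even integer dividing $p-1$; write $p=km+1$. Let $0<\alpha_1<\alpha_2<\cdots<\alpha_m<p$ be all the $k$-th power residues modulo $p$ in the interval $(0,p)$, and let $$W_p(k)=\left[\left(\frac{\alpha_i+\alpha_j}{p}\right)\right]_{1\le i,j\le m},$$ where $\left(\frac{\cdot}{p}\right)$ is the Legendre symbol. Define integers $a_p(k)$ and $b_p(k)$ by $$p+1-a_p(k)=\#\{(x,y)\in\mathbb{F}_p\times\mathbb{F}_p:\ y^2=x^k+1\}+1,\qquad p+1-b_p(k)=\#\{(x,y)\in\mathbb{F}_p\times\mathbb{F}_p:\ y^2=x(x^k+1)\}+1.$$ Then: (i) If $m$ is odd, then $\det W_p(k)=-(a_p(k)+1)u_p(k)^2/k$ for some $u_p(k)\in\mathbb{Z}$. (ii) If $m$ is even, then $\det W_p(k)=(a_p(k)+1)b_p(k)v_p(k)^2/k^2$ for some $v_p(k)\in\mathbb{Z}$.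
   Context: $\mathbb{F}_p$ denotes the finite field with $p$ elements. An integer $\alpha$ with $p\nmid\alpha$ is a $k$-th power residue modulo $p$ if $\alpha\equiv x^k\pmod p$ for some integer $x$. The "+1" in the definitions of $a_p(k)$, $b_p(k)$ accounts for a single point at infinity added to the affine points. -}

module Defs where

open import Data.Bool using (Bool; true; false; if_then_else_; _∨_)
open import Data.Nat as ℕ using (ℕ; zero; suc; _≡ᵇ_; NonZero)
open import Data.Nat.DivMod using (_%_)
open import Data.Fin using (Fin; toℕ; punchIn) renaming (zero to fzero; suc to fsuc)
open import Data.Integer as ℤ using (ℤ; +_; -_)
open import Data.Nat.ListAction using (sum)
open import Data.List using (List; []; _∷_; map; upTo; filterᵇ; length; lookup)

anyBelow : ℕ → (ℕ → Bool) → Bool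
anyBelow zero    f = false
anyBelow (suc n) f = f n ∨ anyBelow n f

isPowRes : (p : ℕ) → .{{_ : NonZero p}} → (k : ℕ) → ℕ → Bool
isPowRes p k a = anyBelow p (λ x → (x ℕ.^ k) % p ≡ᵇ a % p)

legendre : (p : ℕ) → .{{NonZero p}} → ℕ → ℤ
legendre p a =
  if a % p ≡ᵇ 0 then + 0
  else if isPowRes p 2 a then + 1 else - (+ 1)

kthResidues : (p : ℕ) → .{{_ : NonZero p}} → (k : ℕ) → List ℕ
kthResidues p k = filterᵇ (isPowRes p k) (map suc (upTo (p ℕ.∸ 1)))

sumFin : (n : ℕ) → (Fin n → ℤ) → ℤ
sumFin zero    f = + 0
sumFin (suc n) f = f fzero ℤ.+ sumFin n (λ j → f (fsuc j))

det : (n : ℕ) → (Fin n → Fin n → ℤ) → ℤ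
det zero    M = + 1
det (suc n) M =
  sumFin (suc n) (λ j → ((- (+ 1)) ℤ.^ toℕ j) ℤ.* M fzero j
                          ℤ.* det n (λ r c → M (fsuc r) (punchIn j c)))

W : (p : ℕ) → .{{_ : NonZero p}} → (k : ℕ) →
    Fin (length (kthResidues p k)) → Fin (length (kthResidues p k)) → ℤ
W p k i j = legendre p (lookup (kthResidues p k) i ℕ.+ lookup (kthResidues p k) j)

countPts : (p : ℕ) → .{{NonZero p}} → (ℕ → ℕ) → ℕ
countPts p f =
  sum (map (λ x → sum (map (λ y → if (y ℕ.* y) % p ≡ᵇ f x % p then 1 else 0) (upTo p))) (upTo p))

-- p + 1 - a_p(k) = #{y² = x^k + 1} + 1
aP : (p : ℕ) → .{{_ : NonZero p}} → (k : ℕ) → ℤ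
aP p k = + p ℤ.- + countPts p (λ x → x ℕ.^ k ℕ.+ 1)

-- p + 1 - b_p(k) = #{y² = x(x^k + 1)} + 1
bP : (p : ℕ) → .{{_ : NonZero p}} → (k : ℕ) → ℤ
bP p k = + p ℤ.- + countPts p (λ x → x ℕ.* (x ℕ.^ k ℕ.+ 1))

{-# OPTIONS --safe #-}

-- The k-th power residues form a cyclic group generated by some G of order m, and they are squares
-- since k is even. So W_p(k) is, up to a simultaneous permutation of rows and columns, the circulant
-- c (i - j) of the even function c (i) = ((G^i + 1) / p) on ℤ/m. Over ℚ, the functions on ℤ/m are the
-- direct sum of the characters of order at most 2 (the trivial one and, for even m, parity) and two
-- copies of the odd functions; convolution with c acts on both copies by the same integer matrix B.
-- Hence det W_p(k) is (det B)² times the one or two corresponding character sums of c, and counting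
-- points with the quadratic character shows that k times these sums are -(a_p(k) + 1) and -b_p(k).

module Submission where

open import Defs
open import Data.Nat using (ℕ; _+_; _*_; _≤_; NonZero)
open import Data.Nat.Divisibility using (_∣_)
open import Data.Nat.Primality using (Prime)
open import Data.Integer using (ℤ; +_; -_) renaming (_*_ to _*ℤ_; _+_ to _+ℤ_)
open import Data.List using (length)
open import Data.Product using (Σ; _×_)
open import Relation.Binary.PropositionalEquality using (_≡_; _≢_)
open import Relation.Nullary using (¬_)
open import Data.Nat using (_%_; _/_; _<_; _^_; _∸_; _≟_; _≡ᵇ_; _≤?_; _⊔_; suc; s≤s; s≤s⁻¹; z<s; zero; z≤n)
open import Data.Integer using (-[1+_]; _%ℕ_; _/ℕ_; ∣_∣) renaming (_-_ to _-ℤ_; _^_ to _^ℤ_)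
import Data.Integer.Properties as ℤ
open import Data.Integer.Tactic.RingSolver using (solve-∀)
open import Data.Fin using (Fin; _↑ʳ_; _↑ˡ_; fromℕ<; inject₁; punchIn; punchOut; toℕ) renaming (suc to fsuc; zero to fzero)
import Data.Fin.Properties as Fin
open import Data.Fin.Induction using (<-weakInduction)
open import Data.Fin.Permutation using (Permutation; _⟨$⟩ʳ_; _⟨$⟩ˡ_; inverseˡ; permutation; ↔⇒≡)
open import Data.Vec.Functional using (Vector; _++_; insertAt; tail; updateAt) renaming (_∷_ to _◂_)
open import Data.Vec.Functional.Properties using (insertAt-lookup; insertAt-punchIn; lookup-++ʳ; lookup-++ˡ)
open import Algebra.Properties.Semiring.Sum ℤ.+-*-semiring using (*-distribˡ-sum; sum-permute; ∑-distrib-+) renaming (sum to ∑)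
open import Function using (Equivalence; _∘_; const; mk⇔)
open import Data.Product using (_,_; proj₁; proj₂; ∃)
open import Data.Sum using ([_,_]′; _⊎_; inj₁; inj₂)
open import Relation.Binary.PropositionalEquality using (cong; cong₂; module ≡-Reasoning; refl; subst; sym; trans)
open import Relation.Nullary using (Dec; T?; _×-dec_; contradiction; does; no; yes; ¬?)
import Data.Nat.Properties as ℕ
import Data.Nat.Divisibility as ℕ∣
import Data.Integer.Base as ℤB
open import Data.Integer.Divisibility.Signed using (*-cancelˡ-∣; *-monoʳ-∣; divides; ∣-refl; ∣-trans; ∣m+n∣n⇒∣m; ∣m⇒∣-m; ∣m⇒∣m*n; ∣m∣n⇒∣m+n; ∣m∣n⇒∣m-n; ∣n⇒∣m*n; ∣ᵤ⇒∣; ∣⇒∣ᵤ) renaming (_∣?_ to _∣ℤ?_; _∣_ to _∣ℤ_)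
open import Data.Bool using (_∨_; false; if_then_else_; true)
open import Relation.Nullary.Decidable using (dec-false; dec-true; decidable-stable; does-⇔)
open import Data.Integer.DivMod using (a≡a%ℕn+[a/ℕn]*n; n%ℕd<d)
import Data.Nat as ℕB
import Data.Nat.DivMod as ℕ÷
open import Data.Nat.GCD using (gcd; gcd[m,n]∣m; gcd[m,n]∣n; gcd[m,n]≢0)
open import Data.Nat.Coprimality using (Coprime; coprime-/gcd; coprime-divisor)
import Data.Nat.Coprimality as Coprime
open import Data.Nat.Primality using (euclidsLemma; prime⇒irreducible; prime⇒nonTrivial; prime⇒nonZero; ¬prime[1])
open import Data.Nat.Primality.Factorisation using (factorise)
open import Data.Nat.Induction using (<-rec)
open import Data.List using (List; []; _∷_; applyUpTo; lookup; map; upTo)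
open import Data.List.Relation.Unary.All using (_∷_)
open import Data.Vec using (Vec; []; _∷_; replicate)
import Relation.Nullary.Decidable as Dec
open import Data.Bool.Properties using (T-≡; ¬-not; ∨-zeroʳ)
open import Data.Nat.ListAction using (sum)
open import Data.List.Membership.Propositional using (_∈_)
open import Data.List.Membership.Propositional.Properties using (∈-filter⁺; ∈-filter⁻; ∈-lookup; ∈-map⁺; ∈-map⁻; ∈-upTo⁺; ∈-upTo⁻)
import Data.List.Relation.Unary.All as All
open import Data.List.Relation.Unary.AllPairs using (_∷_)
import Data.List.Relation.Unary.Any as Any
open import Data.List.Relation.Unary.Any.Properties using (lookup-index)
open import Data.List.Relation.Unary.Unique.Propositional using (Unique)
import Data.List.Relation.Unary.Unique.Propositional.Properties as Unique

-- The eigenvalues of the circulant are the sums of χ(u) c(u) over ℤ/m, one for each character χ,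
-- and those of χ and its inverse agree because `c` is even. So a square is visible at once over the
-- cyclotomic field; what needs an argument is that its root is an integer. The matrix
-- `oddBlock c n` gives this without roots of unity. The obstacle is the even functions: in the
-- obvious basis of sums of deltas at y and -y, convolution with `c` has entries like c (i - j) + c
-- (i + j), a different matrix from the one on odd functions. Convolution with an odd pair of deltas
-- at w and -w exchanges even and odd functions and commutes with convolution with `c`, so it
-- carries the matrix over. It kills exactly the characters with χ(w)² = 1; to make these the
-- characters of order at most 2, take w = (m + 1) / 2 for odd m and w = 1 for even m. The resulting
-- base change `P` is integral but not unimodular. An integral `Q` with `Q ⊗ P` equal to 2 h times
-- the identity, where h is m or 2 m, shows that `det P` is not 0, so that it can be cancelled
-- within ℤ.

open ≡-Reasoning

-- Finite sums

sumFin≡∑ : ∀ n (f : Fin n → ℤ) → sumFin n f ≡ ∑ f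
sumFin≡∑ zero    f = refl
sumFin≡∑ (suc n) f = cong (f fzero +ℤ_) (sumFin≡∑ n (f ∘ fsuc))

sumFin-cong : ∀ {n} {f g : Fin n → ℤ} → (∀ i → f i ≡ g i) → sumFin n f ≡ sumFin n g
sumFin-cong {zero}  eq = refl
sumFin-cong {suc n} eq = cong₂ _+ℤ_ (eq fzero) (sumFin-cong (eq ∘ fsuc))

sumFin-zero : ∀ n → sumFin n (const (+ 0)) ≡ + 0
sumFin-zero zero    = refl
sumFin-zero (suc n) = trans (ℤ.+-identityˡ _) (sumFin-zero n)

sumFin-+ : ∀ {n} (f g : Fin n → ℤ) → sumFin n (λ i → f i +ℤ g i) ≡ sumFin n f +ℤ sumFin n g
sumFin-+ {n} f g = begin
  sumFin n (λ i → f i +ℤ g i) ≡⟨ sumFin≡∑ n _ ⟩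
  ∑ (λ i → f i +ℤ g i)        ≡⟨ ∑-distrib-+ f g ⟩
  ∑ f +ℤ ∑ g                  ≡⟨ cong₂ _+ℤ_ (sumFin≡∑ n f) (sumFin≡∑ n g) ⟨
  sumFin n f +ℤ sumFin n g    ∎

*-sumFin : ∀ {n} a (f : Fin n → ℤ) → a *ℤ sumFin n f ≡ sumFin n (λ i → a *ℤ f i)
*-sumFin {n} a f = begin
  a *ℤ sumFin n f           ≡⟨ cong (a *ℤ_) (sumFin≡∑ n f) ⟩
  a *ℤ ∑ f                  ≡⟨ *-distribˡ-sum a f ⟩
  ∑ (λ i → a *ℤ f i)        ≡⟨ sumFin≡∑ n _ ⟨
  sumFin n (λ i → a *ℤ f i) ∎

sumFin-* : ∀ {n} (f : Fin n → ℤ) a → sumFin n f *ℤ a ≡ sumFin n (λ i → f i *ℤ a)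
sumFin-* f a = begin
  sumFin _ f *ℤ a           ≡⟨ ℤ.*-comm _ a ⟩
  a *ℤ sumFin _ f           ≡⟨ *-sumFin a f ⟩
  sumFin _ (λ i → a *ℤ f i) ≡⟨ sumFin-cong (λ i → ℤ.*-comm a (f i)) ⟩
  sumFin _ (λ i → f i *ℤ a) ∎

sumFin-neg : ∀ {n} (f : Fin n → ℤ) → sumFin n (λ i → - f i) ≡ - sumFin n f
sumFin-neg {n} f = begin
  sumFin n (λ i → - f i)          ≡⟨ sumFin-cong (λ i → sym (ℤ.-1*i≡-i (f i))) ⟩
  sumFin n (λ i → - + 1 *ℤ f i)   ≡⟨ *-sumFin (- + 1) f ⟨
  - + 1 *ℤ sumFin n f             ≡⟨ ℤ.-1*i≡-i _ ⟩
  - sumFin n f                    ∎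

sumFin-permute : ∀ {m n} (f : Fin n → ℤ) (π : Permutation m n) →
  sumFin m (λ i → f (π ⟨$⟩ʳ i)) ≡ sumFin n f
sumFin-permute {m} {n} f π = begin
  sumFin m (λ i → f (π ⟨$⟩ʳ i)) ≡⟨ sumFin≡∑ m (λ i → f (π ⟨$⟩ʳ i)) ⟩
  ∑ (λ i → f (π ⟨$⟩ʳ i))        ≡⟨ sum-permute f π ⟨
  ∑ f                           ≡⟨ sumFin≡∑ n f ⟨
  sumFin n f                    ∎

sumFin-split : ∀ a {b} (f : Fin (a + b) → ℤ) →
  sumFin (a + b) f ≡ sumFin a (λ i → f (i ↑ˡ b)) +ℤ sumFin b (λ j → f (a ↑ʳ j))
sumFin-split zero    f = sym (ℤ.+-identityˡ _)
sumFin-split (suc a) f = trans (cong (f fzero +ℤ_) (sumFin-split a (f ∘ fsuc))) (sym (ℤ.+-assoc (f fzero) _ _))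

-- Determinants

Rows : ℕ → ℕ → Set
Rows n w = Fin n → Fin w → ℤ

infix 4 _≗₂_
_≗₂_ : ∀ {n w} → Rows n w → Rows n w → Set
M ≗₂ N = ∀ i j → M i j ≡ N i j

sg : ∀ {n} → Fin n → ℤ
sg j = (- (+ 1)) ^ℤ toℕ j

minor : ∀ {n w} → Fin (suc w) → Rows (suc n) (suc w) → Rows n w
minor j M r c = M (fsuc r) (punchIn j c)

det-cong : ∀ {n} {M N : Rows n n} → M ≗₂ N → det n M ≡ det n N
det-cong {zero}  eq = refl
det-cong {suc n} eq = sumFin-cong λ j →
  cong₂ (λ x y → sg j *ℤ x *ℤ y) (eq fzero j) (det-cong (λ r c → eq (fsuc r) (punchIn j c)))

-- Linearity is asked of the first row only; `D-swap`, which exchanges the first row with any other,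
-- transports it to the rest. The width `w` is independent of the number of rows, so that `fixRow`
-- stays within this notion.
record Alternating {n w} (D : Rows (suc n) w → ℤ) : Set where
  field
    D-cong : ∀ {M N} → M ≗₂ N → D M ≡ D N
    D-+    : ∀ u v R → D ((λ k → u k +ℤ v k) ◂ R) ≡ D (u ◂ R) +ℤ D (v ◂ R)
    D-*    : ∀ a u R → D ((λ k → a *ℤ u k) ◂ R) ≡ a *ℤ D (u ◂ R)
    D-swap : ∀ u R r → D (u ◂ R) ≡ - D (R r ◂ updateAt R r (const u))

∷-cong : ∀ {n w} {u v : Vector ℤ w} {R S : Rows n w} →
  (∀ k → u k ≡ v k) → R ≗₂ S → (u ◂ R) ≗₂ (v ◂ S)
∷-cong eq eqs fzero    = eq
∷-cong eq eqs (fsuc i) = eqs i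

i≡-i⇒i≡0 : ∀ {x} → x ≡ - x → x ≡ + 0
i≡-i⇒i≡0 {+ zero}  eq = refl
i≡-i⇒i≡0 {+ suc n} ()
i≡-i⇒i≡0 { -[1+ n ]} ()

module _ {n w} {D : Rows (suc n) w → ℤ} (alt : Alternating D) where
  open Alternating alt

  D-zero : ∀ R → D (const (+ 0) ◂ R) ≡ + 0
  D-zero R = D-* (+ 0) (const (+ 0)) R

  D-sum : ∀ k (a : Fin k → ℤ) (v : Rows k w) R →
    D ((λ c → sumFin k (λ j → a j *ℤ v j c)) ◂ R) ≡ sumFin k (λ j → a j *ℤ D (v j ◂ R))
  D-sum zero    a v R = D-zero R
  D-sum (suc k) a v R = trans (D-+ _ _ R)
    (cong₂ _+ℤ_ (D-* (a fzero) (v fzero) R) (D-sum k (a ∘ fsuc) (v ∘ fsuc) R))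

  -- Serves two linear maps on rows: insertion of a zero entry (`insertZero-alternating`) and
  -- multiplication by a matrix from the right (`det-⊗`).
  D-rowMap : ∀ {w′} (L : Vector ℤ w′ → Vector ℤ w) →
    (∀ {u v} → (∀ k → u k ≡ v k) → ∀ k → L u k ≡ L v k) →
    (∀ u v k → L (λ c → u c +ℤ v c) k ≡ L u k +ℤ L v k) →
    (∀ a u k → L (λ c → a *ℤ u c) k ≡ a *ℤ L u k) →
    Alternating (λ N → D (λ r → L (N r)))
  D-rowMap L L-cong L-+ L-* = record
    { D-cong = λ eq → D-cong (λ i → L-cong (eq i))
    ; D-+ = λ u v R → trans (D-cong (split (L-+ u v))) (trans (D-+ (L u) (L v) (L ∘ R))
        (cong₂ _+ℤ_ (D-cong (unsplit u R)) (D-cong (unsplit v R))))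
    ; D-* = λ a u R → trans (D-cong (split (L-* a u))) (trans (D-* a (L u) (L ∘ R))
        (cong (a *ℤ_) (D-cong (unsplit u R))))
    ; D-swap = λ u R r → trans (D-cong (split (λ _ → refl))) (trans (D-swap (L u) (L ∘ R) r)
        (cong -_ (D-cong (λ { fzero k → refl ; (fsuc i) k → upd u R r i k }))))
    }
    where
    split : ∀ {u R x} → (∀ k → L u k ≡ x k) → (λ r → L ((u ◂ R) r)) ≗₂ (x ◂ (L ∘ R))
    split eq fzero    = eq
    split eq (fsuc i) = λ _ → refl
    unsplit : ∀ u R → (L u ◂ (L ∘ R)) ≗₂ (λ r → L ((u ◂ R) r))
    unsplit u R fzero    k = refl
    unsplit u R (fsuc i) k = refl
    upd : ∀ {m} u (R : Rows m _) r i k →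
      updateAt (L ∘ R) r (const (L u)) i k ≡ L (updateAt R r (const u) i) k
    upd u R fzero    fzero    k = refl
    upd u R fzero    (fsuc i) k = refl
    upd u R (fsuc r) fzero    k = refl
    upd u R (fsuc r) (fsuc i) k = upd u (R ∘ fsuc) r i k

module _ {n w} {D : Rows (suc (suc n)) w → ℤ} (alt : Alternating D) where
  open Alternating alt

  D-swap₀₁ : ∀ u v R → D (u ◂ v ◂ R) ≡ - D (v ◂ u ◂ R)
  D-swap₀₁ u v R = trans (D-swap u (v ◂ R) fzero) (cong -_ (D-cong eq))
    where
    eq : (v ◂ updateAt (v ◂ R) fzero (const u)) ≗₂ (v ◂ u ◂ R)
    eq fzero           k = refl
    eq (fsuc fzero)    k = refl
    eq (fsuc (fsuc i)) k = refl

  -- What is known of the first row is transferred to the second by `D-swap₀₁`. For `D-swap` this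
  -- takes three sign changes, which leave one.
  fixRow : ∀ v → Alternating (λ R → D (v ◂ R))
  fixRow v = record
    { D-cong = λ eq → D-cong (∷-cong (λ _ → refl) eq)
    ; D-+ = λ u u′ R → begin
        D (v ◂ (λ k → u k +ℤ u′ k) ◂ R)             ≡⟨ D-swap₀₁ v _ R ⟩
        - D ((λ k → u k +ℤ u′ k) ◂ v ◂ R)           ≡⟨ cong -_ (D-+ u u′ (v ◂ R)) ⟩
        - (D (u ◂ v ◂ R) +ℤ D (u′ ◂ v ◂ R))         ≡⟨ ℤ.neg-distrib-+ (D (u ◂ v ◂ R)) _ ⟩
        - D (u ◂ v ◂ R) +ℤ - D (u′ ◂ v ◂ R)         ≡⟨ cong₂ _+ℤ_ (D-swap₀₁ v u R) (D-swap₀₁ v u′ R) ⟨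
        D (v ◂ u ◂ R) +ℤ D (v ◂ u′ ◂ R)             ∎
    ; D-* = λ a u R → begin
        D (v ◂ (λ k → a *ℤ u k) ◂ R)                ≡⟨ D-swap₀₁ v _ R ⟩
        - D ((λ k → a *ℤ u k) ◂ v ◂ R)              ≡⟨ cong -_ (D-* a u (v ◂ R)) ⟩
        - (a *ℤ D (u ◂ v ◂ R))                      ≡⟨ ℤ.neg-distribʳ-* a _ ⟩
        a *ℤ - D (u ◂ v ◂ R)                        ≡⟨ cong (a *ℤ_) (D-swap₀₁ v u R) ⟨
        a *ℤ D (v ◂ u ◂ R)                          ∎
    ; D-swap = λ u R r → begin
        D (v ◂ u ◂ R)                               ≡⟨ D-swap₀₁ v u R ⟩
        - D (u ◂ v ◂ R)                             ≡⟨ cong -_ (D-swap u (v ◂ R) (fsuc r)) ⟩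
        - - D (R r ◂ updateAt (v ◂ R) (fsuc r) (const u))
                                                    ≡⟨ cong (-_ ∘ -_) (D-cong (eq u R r)) ⟩
        - - D (R r ◂ v ◂ updateAt R r (const u))    ≡⟨ cong -_ (D-swap₀₁ v (R r) _) ⟨
        - D (v ◂ R r ◂ updateAt R r (const u))      ∎
    }
    where
    eq : ∀ u R r → (R r ◂ updateAt (v ◂ R) (fsuc r) (const u)) ≗₂ (R r ◂ v ◂ updateAt R r (const u))
    eq u R r fzero           k = refl
    eq u R r (fsuc fzero)    k = refl
    eq u R r (fsuc (fsuc i)) k = refl

  D-equalRows : ∀ v R → D (v ◂ v ◂ R) ≡ + 0
  D-equalRows v R = i≡-i⇒i≡0 (D-swap₀₁ v v R)

-- Induction on the number of rows below `v`: the first of them is swapped to the top and held fixed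
-- while the hypothesis clears the others. Its own multiple of `v` then produces a matrix with two
-- equal rows.
D-addMultiples : ∀ {n w} {D : Rows (suc n) w → ℤ} → Alternating D → ∀ v (a : Fin n → ℤ) R →
  D (v ◂ λ r k → R r k +ℤ a r *ℤ v k) ≡ D (v ◂ R)
D-addMultiples {zero}  alt v a R = Alternating.D-cong alt (∷-cong (λ _ → refl) (λ ()))
D-addMultiples {suc n} {D = D} alt v a R = begin
  D (v ◂ R′)                                 ≡⟨ D-cong (∷-cong (λ _ → refl) (λ { fzero k → refl ; (fsuc i) k → refl })) ⟩
  D (v ◂ R′ fzero ◂ tail R′)                 ≡⟨ D-swap₀₁ alt v _ _ ⟩
  - D (R′ fzero ◂ v ◂ tail R′)               ≡⟨ cong -_ (D-addMultiples (fixRow alt (R′ fzero)) v (a ∘ fsuc) (tail R)) ⟩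
  - D (R′ fzero ◂ v ◂ tail R)                ≡⟨ cong -_ (trans (D-+ (R fzero) (λ k → a fzero *ℤ v k) _) (cong (D (R fzero ◂ v ◂ tail R) +ℤ_) (D-* (a fzero) v _))) ⟩
  - (D (R fzero ◂ v ◂ tail R) +ℤ a fzero *ℤ D (v ◂ v ◂ tail R))
                                             ≡⟨ cong (λ x → - (D (R fzero ◂ v ◂ tail R) +ℤ a fzero *ℤ x)) (D-equalRows alt v (tail R)) ⟩
  - (D (R fzero ◂ v ◂ tail R) +ℤ a fzero *ℤ + 0)
                                             ≡⟨ cong -_ (trans (cong (D (R fzero ◂ v ◂ tail R) +ℤ_) (ℤ.*-zeroʳ (a fzero))) (ℤ.+-identityʳ _)) ⟩
  - D (R fzero ◂ v ◂ tail R)                 ≡⟨ D-swap₀₁ alt v (R fzero) (tail R) ⟨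
  D (v ◂ R fzero ◂ tail R)                   ≡⟨ D-cong (∷-cong (λ _ → refl) (λ { fzero k → refl ; (fsuc i) k → refl })) ⟩
  D (v ◂ R)                                  ∎
  where
  open Alternating alt
  R′ : Rows (suc n) _
  R′ r k = R r k +ℤ a r *ℤ v k

-- Uniqueness of the determinant among alternating functions

I : ∀ {n} → Rows n n
I fzero    fzero    = + 1
I fzero    (fsuc j) = + 0
I (fsuc i) fzero    = + 0
I (fsuc i) (fsuc j) = I i j

I-refl : ∀ {n} (i : Fin n) → I i i ≡ + 1
I-refl fzero    = refl
I-refl (fsuc i) = I-refl i

I-punchIn-ʳ : ∀ {n} (j : Fin (suc n)) c → I j (punchIn j c) ≡ + 0
I-punchIn-ʳ fzero    c        = refl
I-punchIn-ʳ (fsuc j) fzero    = refl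
I-punchIn-ʳ (fsuc j) (fsuc c) = I-punchIn-ʳ j c

I-punchIn-ˡ : ∀ {n} (j : Fin (suc n)) c → I (punchIn j c) j ≡ + 0
I-punchIn-ˡ fzero    c        = refl
I-punchIn-ˡ (fsuc j) fzero    = refl
I-punchIn-ˡ (fsuc j) (fsuc c) = I-punchIn-ˡ j c

I-punchIn : ∀ {n} (j : Fin (suc n)) r c → I (punchIn j r) (punchIn j c) ≡ I r c
I-punchIn fzero    r        c        = refl
I-punchIn (fsuc j) fzero    fzero    = refl
I-punchIn (fsuc j) fzero    (fsuc c) = refl
I-punchIn (fsuc j) (fsuc r) fzero    = refl
I-punchIn (fsuc j) (fsuc r) (fsuc c) = I-punchIn j r c

sum-I : ∀ {n} (a : Fin n → ℤ) k → sumFin n (λ j → a j *ℤ I j k) ≡ a k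
sum-I {suc n} a fzero = begin
  a fzero *ℤ + 1 +ℤ sumFin n (λ j → a (fsuc j) *ℤ + 0) ≡⟨ cong₂ _+ℤ_ (ℤ.*-identityʳ (a fzero)) (trans (sumFin-cong (λ j → ℤ.*-zeroʳ (a (fsuc j)))) (sumFin-zero n)) ⟩
  a fzero +ℤ + 0                                       ≡⟨ ℤ.+-identityʳ _ ⟩
  a fzero                                              ∎
sum-I {suc n} a (fsuc k) = trans (cong₂ _+ℤ_ (ℤ.*-zeroʳ (a fzero)) (sum-I (a ∘ fsuc) k)) (ℤ.+-identityˡ _)

I-sum : ∀ {n} (a : Fin n → ℤ) k → sumFin n (λ j → I k j *ℤ a j) ≡ a k
I-sum {suc n} a fzero = begin
  + 1 *ℤ a fzero +ℤ sumFin n (λ j → + 0) ≡⟨ cong₂ _+ℤ_ (ℤ.*-identityˡ (a fzero)) (sumFin-zero n) ⟩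
  a fzero +ℤ + 0                         ≡⟨ ℤ.+-identityʳ _ ⟩
  a fzero                                ∎
I-sum {suc n} a (fsuc k) = trans (ℤ.+-identityˡ _) (I-sum (a ∘ fsuc) k)

insertZero : ∀ {n} → Fin (suc n) → Vector ℤ n → Vector ℤ (suc n)
insertZero j v = insertAt v j (+ 0)

insertZero-pointwise : ∀ {n} (j : Fin (suc n)) (v : Vector ℤ n) (f : Vector ℤ (suc n)) →
  f j ≡ + 0 → (∀ k → f (punchIn j k) ≡ v k) → ∀ k → insertZero j v k ≡ f k
insertZero-pointwise fzero    v f z e fzero    = sym z
insertZero-pointwise fzero    v f z e (fsuc k) = sym (e k)
insertZero-pointwise {suc n} (fsuc j) v f z e fzero    = sym (e fzero)
insertZero-pointwise {suc n} (fsuc j) v f z e (fsuc k) = insertZero-pointwise j (tail v) (tail f) z (e ∘ fsuc) k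

-- With entry `i` left out, place `i` holds entry `i + 1`; overwriting it with entry `i` leaves out
-- entry `i + 1` instead. This is the transposition in the step of `D-cycle`.
updateAt-punchIn : ∀ {n} (i : Fin n) (X : Set) (f : Fin (suc n) → X) r →
  updateAt (f ∘ punchIn (inject₁ i)) i (const (f (inject₁ i))) r ≡ f (punchIn (fsuc i) r)
updateAt-punchIn fzero    X f fzero    = refl
updateAt-punchIn fzero    X f (fsuc r) = refl
updateAt-punchIn (fsuc i) X f fzero    = refl
updateAt-punchIn (fsuc i) X f (fsuc r) = updateAt-punchIn i X (f ∘ fsuc) r

punchIn-inject₁ : ∀ {n} (i : Fin n) → punchIn (inject₁ i) i ≡ fsuc i
punchIn-inject₁ fzero    = refl
punchIn-inject₁ (fsuc i) = cong fsuc (punchIn-inject₁ i)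

module _ {n} {D : Rows (suc n) (suc n) → ℤ} (alt : Alternating D) where
  open Alternating alt

  -- Bringing row `j` of the identity to the top takes `j` transpositions, one for each step of the
  -- induction. This is where the signs of the Laplace expansion come from.
  D-cycle : ∀ j → D (I j ◂ (I ∘ punchIn j)) ≡ sg j *ℤ D I
  D-cycle = <-weakInduction (λ j → D (I j ◂ (I ∘ punchIn j)) ≡ sg j *ℤ D I) base step
    where
    base : D (I fzero ◂ (I ∘ punchIn fzero)) ≡ + 1 *ℤ D I
    base = trans (D-cong (λ { fzero k → refl ; (fsuc i) k → refl })) (sym (ℤ.*-identityˡ _))
    step : ∀ i → D (I (inject₁ i) ◂ (I ∘ punchIn (inject₁ i))) ≡ sg (inject₁ i) *ℤ D I →
      D (I (fsuc i) ◂ (I ∘ punchIn (fsuc i))) ≡ sg (fsuc i) *ℤ D I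
    step i ih = begin
      D (I (fsuc i) ◂ (I ∘ punchIn (fsuc i)))  ≡⟨ D-cong (∷-cong (λ k → cong (λ x → I x k) (punchIn-inject₁ i)) (λ r k → cong (λ x → x k) (updateAt-punchIn i (Vector ℤ (suc n)) I r))) ⟨
      D (R i ◂ updateAt R i (const (I (inject₁ i))))     ≡⟨ ℤ.neg-involutive _ ⟨
      - - D (R i ◂ updateAt R i (const (I (inject₁ i)))) ≡⟨ cong -_ (D-swap (I (inject₁ i)) R i) ⟨
      - D (I (inject₁ i) ◂ R)                  ≡⟨ cong -_ ih ⟩
      - (sg (inject₁ i) *ℤ D I)                ≡⟨ cong (λ x → - ((- (+ 1)) ^ℤ x *ℤ D I)) (Fin.toℕ-inject₁ i) ⟩
      - (sg i *ℤ D I)                          ≡⟨ neg-* (sg i) (D I) ⟩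
      sg (fsuc i) *ℤ D I                       ∎
      where
      R = I ∘ punchIn (inject₁ i)
      neg-* : ∀ x y → - (x *ℤ y) ≡ (- + 1) *ℤ x *ℤ y
      neg-* = solve-∀

  -- The first row is written in unit vectors. Once it is the unit vector `I j`, subtracting its
  -- multiples clears column `j` in all other rows, which leaves a minor with a zero column
  -- inserted.
  D-expand : ∀ M → D M ≡ sumFin (suc n) (λ j → M fzero j *ℤ D (I j ◂ (insertZero j ∘ minor j M)))
  D-expand M = begin
    D M                                                              ≡⟨ D-cong (λ { fzero k → sym (sum-I (M fzero) k) ; (fsuc i) k → refl }) ⟩
    D ((λ k → sumFin (suc n) (λ j → M fzero j *ℤ I j k)) ◂ tail M)   ≡⟨ D-sum alt (suc n) (M fzero) I (tail M) ⟩
    sumFin (suc n) (λ j → M fzero j *ℤ D (I j ◂ tail M))             ≡⟨ sumFin-cong (λ j → cong (M fzero j *ℤ_) (clear j)) ⟩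
    sumFin (suc n) (λ j → M fzero j *ℤ D (I j ◂ (insertZero j ∘ minor j M))) ∎
    where
    clear : ∀ j → D (I j ◂ tail M) ≡ D (I j ◂ (insertZero j ∘ minor j M))
    clear j = begin
      D (I j ◂ tail M) ≡⟨ D-addMultiples alt (I j) (λ r → - M (fsuc r) j) (tail M) ⟨
      D (I j ◂ λ r k → M (fsuc r) k +ℤ - M (fsuc r) j *ℤ I j k)
        ≡⟨ D-cong (∷-cong (λ _ → refl) (λ r k → sym (insertZero-pointwise j (minor j M r) (λ k → M (fsuc r) k +ℤ - M (fsuc r) j *ℤ I j k)
             (trans (cong (λ x → M (fsuc r) j +ℤ - M (fsuc r) j *ℤ x) (I-refl j)) (x-x*1 (M (fsuc r) j)))
             (λ k → trans (cong (λ x → M (fsuc r) (punchIn j k) +ℤ - M (fsuc r) j *ℤ x) (I-punchIn-ʳ j k)) (x-y*0 (M (fsuc r) (punchIn j k)) (M (fsuc r) j))) k))) ⟩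
      D (I j ◂ (insertZero j ∘ minor j M)) ∎
      where
      x-x*1 : ∀ x → x +ℤ - x *ℤ + 1 ≡ + 0
      x-x*1 = solve-∀
      x-y*0 : ∀ x y → x +ℤ - y *ℤ + 0 ≡ x
      x-y*0 = solve-∀

  insertZero-I : ∀ j → D (I j ◂ (insertZero j ∘ I)) ≡ sg j *ℤ D I
  insertZero-I j = trans
    (D-cong (∷-cong (λ _ → refl) (λ r → insertZero-pointwise j (I r) (I (punchIn j r)) (I-punchIn-ˡ j r) (I-punchIn j r))))
    (D-cycle j)

insertZero-alternating : ∀ {n} {D : Rows (suc (suc n)) (suc (suc n)) → ℤ} → Alternating D → ∀ j →
  Alternating (λ N → D (I j ◂ (insertZero j ∘ N)))
insertZero-alternating alt j = D-rowMap (fixRow alt (I j)) (insertZero j)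
  (λ {u} {v} eq k → insertZero-pointwise j u (insertZero j v) (insertAt-lookup v j (+ 0)) (λ k → trans (insertAt-punchIn v j (+ 0) k) (sym (eq k))) k)
  (λ u v k → insertZero-pointwise j _ (λ k → insertZero j u k +ℤ insertZero j v k)
     (cong₂ _+ℤ_ (insertAt-lookup u j (+ 0)) (insertAt-lookup v j (+ 0)))
     (λ k → cong₂ _+ℤ_ (insertAt-punchIn u j (+ 0) k) (insertAt-punchIn v j (+ 0) k)) k)
  (λ a u k → insertZero-pointwise j _ (λ k → a *ℤ insertZero j u k)
     (trans (cong (a *ℤ_) (insertAt-lookup u j (+ 0))) (ℤ.*-zeroʳ a))
     (λ k → cong (a *ℤ_) (insertAt-punchIn u j (+ 0) k)) k)

-- `D-expand` reduces `D` to functions of `N` of the form `D (I j ◂ (insertZero j ∘ N))`, which are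
-- alternating with one row less. By recursion each is `det n N` times its value at `I`, and this
-- value is `sg j *ℤ D I`. What remains is the recursive definition of `det`.
alternating-unique : ∀ {n} {D : Rows (suc n) (suc n) → ℤ} → Alternating D → ∀ M → D M ≡ det (suc n) M *ℤ D I
alternating-unique {n} {D} alt M = begin
  D M ≡⟨ D-expand alt M ⟩
  sumFin (suc n) (λ j → M fzero j *ℤ D (I j ◂ (insertZero j ∘ minor j M)))
    ≡⟨ sumFin-cong (λ j → trans (cong (M fzero j *ℤ_) (trans (minors alt j) (cong (det n (minor j M) *ℤ_) (insertZero-I alt j)))) (rearr (M fzero j) (det n (minor j M)) (sg j) (D I))) ⟩
  sumFin (suc n) (λ j → sg j *ℤ M fzero j *ℤ det n (minor j M) *ℤ D I)
    ≡⟨ sumFin-* (λ j → sg j *ℤ M fzero j *ℤ det n (minor j M)) (D I) ⟨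
  det (suc n) M *ℤ D I ∎
  where
  rearr : ∀ a d s x → a *ℤ (d *ℤ (s *ℤ x)) ≡ s *ℤ a *ℤ d *ℤ x
  rearr = solve-∀
  minors : ∀ {n} {D : Rows (suc n) (suc n) → ℤ} → Alternating D → ∀ j {N} →
    D (I j ◂ (insertZero j ∘ N)) ≡ det n N *ℤ D (I j ◂ (insertZero j ∘ I))
  minors {zero}  alt j = trans (Alternating.D-cong alt (∷-cong (λ _ → refl) (λ ()))) (sym (ℤ.*-identityˡ _))
  minors {suc n} alt j {N} = alternating-unique (insertZero-alternating alt j) N

-- The double Laplace expansion along the rows u and v, with an arbitrary function H of the
-- remaining columns in place of the complementary minor.
laplace₂ : ∀ n → (u v : Vector ℤ (suc (suc n))) → ((Fin n → Fin (suc (suc n))) → ℤ) → ℤ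
laplace₂ n u v H = sumFin (suc (suc n)) λ j → sg j *ℤ u j *ℤ
  sumFin (suc n) (λ l → sg l *ℤ v (punchIn j l) *ℤ H (λ c → punchIn j (punchIn l c)))

-- Sort the pairs of columns by column 0: it is taken by `u` in `X u v`, by `v` in `- X v u`, and by
-- neither in `Z`. The first two parts change places, up to sign, when `u` and `v` do. `Z` is a
-- smaller double expansion in which column 0 always remains and is absorbed into `H`; this is why
-- the induction has to run over all `H`.
laplace₂-antisym : ∀ n u v H → (∀ φ ψ → (∀ c → φ c ≡ ψ c) → H φ ≡ H ψ) →
  laplace₂ n u v H ≡ - laplace₂ n v u H
laplace₂-antisym n u v H H-cong = begin
  laplace₂ n u v H                    ≡⟨ split u v ⟩
  X u v +ℤ (- X v u +ℤ Z n u v H)     ≡⟨ cong (λ z → X u v +ℤ (- X v u +ℤ z)) (Z-antisym n u v H H-cong) ⟩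
  X u v +ℤ (- X v u +ℤ - Z n v u H)   ≡⟨ regroup (X u v) (X v u) (Z n v u H) ⟩
  - (X v u +ℤ (- X u v +ℤ Z n v u H)) ≡⟨ cong -_ (split v u) ⟨
  - laplace₂ n v u H                  ∎
  where
  regroup : ∀ x y z → x +ℤ (- y +ℤ - z) ≡ - (y +ℤ (- x +ℤ z))
  regroup = solve-∀
  X : (u v : Vector ℤ (suc (suc n))) → ℤ
  X u v = u fzero *ℤ sumFin (suc n) (λ l → sg l *ℤ v (fsuc l) *ℤ H (fsuc ∘ punchIn l))
  Z : ∀ n (u v : Vector ℤ (suc (suc n))) → ((Fin n → Fin (suc (suc n))) → ℤ) → ℤ
  Z n u v H = sumFin (suc n) λ j → sg j *ℤ u (fsuc j) *ℤ
    sumFin n (λ l → sg l *ℤ v (fsuc (punchIn j l)) *ℤ H (λ c → punchIn (fsuc j) (punchIn (fsuc l) c)))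
  split : ∀ u v → laplace₂ n u v H ≡ X u v +ℤ (- X v u +ℤ Z n u v H)
  split u v = cong₂ _+ℤ_ (cong (_*ℤ sumFin (suc n) (λ l → sg l *ℤ v (fsuc l) *ℤ H (fsuc ∘ punchIn l))) (ℤ.*-identityˡ (u fzero))) (begin
    sumFin (suc n) (λ j → sg (fsuc j) *ℤ u (fsuc j) *ℤ (sg (fzero {n}) *ℤ v fzero *ℤ h j +ℤ r j))
      ≡⟨ sumFin-cong (λ j → trans (cong (λ s → sg (fsuc j) *ℤ u (fsuc j) *ℤ (sg (fzero {n}) *ℤ v fzero *ℤ h j +ℤ s)) (neg-sum j)) (term (sg j) (u (fsuc j)) (v fzero) (h j) (r′ j))) ⟩
    sumFin (suc n) (λ j → - (v fzero) *ℤ (sg j *ℤ u (fsuc j) *ℤ h j) +ℤ sg j *ℤ u (fsuc j) *ℤ r′ j)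
      ≡⟨ sumFin-+ (λ j → - (v fzero) *ℤ (sg j *ℤ u (fsuc j) *ℤ h j)) (λ j → sg j *ℤ u (fsuc j) *ℤ r′ j) ⟩
    sumFin (suc n) (λ j → - (v fzero) *ℤ (sg j *ℤ u (fsuc j) *ℤ h j)) +ℤ Z n u v H
      ≡⟨ cong (_+ℤ Z n u v H) (trans (sym (*-sumFin (- (v fzero)) (λ j → sg j *ℤ u (fsuc j) *ℤ h j))) (sym (ℤ.neg-distribˡ-* (v fzero) (sumFin (suc n) (λ j → sg j *ℤ u (fsuc j) *ℤ h j))))) ⟩
    - X v u +ℤ Z n u v H ∎)
    where
    h r r′ : Fin (suc n) → ℤ
    h j = H (fsuc ∘ punchIn j)
    r j = sumFin n (λ l → sg (fsuc l) *ℤ v (fsuc (punchIn j l)) *ℤ H (λ c → punchIn (fsuc j) (punchIn (fsuc l) c)))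
    r′ j = sumFin n (λ l → sg l *ℤ v (fsuc (punchIn j l)) *ℤ H (λ c → punchIn (fsuc j) (punchIn (fsuc l) c)))
    neg-sum : ∀ j → r j ≡ - r′ j
    neg-sum j = trans (sumFin-cong (λ l → neg (sg l) (v (fsuc (punchIn j l))) (H (λ c → punchIn (fsuc j) (punchIn (fsuc l) c)))))
      (sumFin-neg (λ l → sg l *ℤ v (fsuc (punchIn j l)) *ℤ H (λ c → punchIn (fsuc j) (punchIn (fsuc l) c))))
      where
      neg : ∀ s a b → - + 1 *ℤ s *ℤ a *ℤ b ≡ - (s *ℤ a *ℤ b)
      neg = solve-∀
    term : ∀ s a b c d → - + 1 *ℤ s *ℤ a *ℤ (+ 1 *ℤ b *ℤ c +ℤ - d) ≡ - b *ℤ (s *ℤ a *ℤ c) +ℤ s *ℤ a *ℤ d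
    term = solve-∀
  Z-antisym : ∀ n (u v : Vector ℤ (suc (suc n))) H → (∀ φ ψ → (∀ c → φ c ≡ ψ c) → H φ ≡ H ψ) →
    Z n u v H ≡ - Z n v u H
  Z-antisym zero    u v H H-cong = trans (empty (u (fsuc fzero))) (cong -_ (sym (empty (v (fsuc fzero)))))
    where
    empty : ∀ x → + 1 *ℤ x *ℤ + 0 +ℤ + 0 ≡ + 0
    empty = solve-∀
  Z-antisym (suc n) u v H H-cong = begin
    Z (suc n) u v H                                ≡⟨ lift-Z u v ⟩
    laplace₂ n (tail u) (tail v) (H ∘ lift₁)       ≡⟨ laplace₂-antisym n (tail u) (tail v) (H ∘ lift₁) (λ φ ψ eq → H-cong (lift₁ φ) (lift₁ ψ) (λ { fzero → refl ; (fsuc c) → cong fsuc (eq c) })) ⟩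
    - laplace₂ n (tail v) (tail u) (H ∘ lift₁)     ≡⟨ cong -_ (lift-Z v u) ⟨
    - Z (suc n) v u H                              ∎
    where
    lift₁ : ∀ {a b} → (Fin a → Fin b) → Fin (suc a) → Fin (suc b)
    lift₁ φ fzero    = fzero
    lift₁ φ (fsuc c) = fsuc (φ c)
    lift-Z : ∀ u v → Z (suc n) u v H ≡ laplace₂ n (tail u) (tail v) (H ∘ lift₁)
    lift-Z u v = sumFin-cong λ j → cong (sg j *ℤ u (fsuc j) *ℤ_) (sumFin-cong λ l →
      cong (sg l *ℤ v (fsuc (punchIn j l)) *ℤ_) (H-cong (λ c → punchIn (fsuc j) (punchIn (fsuc l) c)) (lift₁ (λ c → punchIn j (punchIn l c))) λ { fzero → refl ; (fsuc c) → refl }))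

head∷head∷tail : ∀ {n w} (M : Rows (suc (suc n)) w) → M ≗₂ (M fzero ◂ M (fsuc fzero) ◂ (λ i → M (fsuc (fsuc i))))
head∷head∷tail M fzero           k = refl
head∷head∷tail M (fsuc fzero)    k = refl
head∷head∷tail M (fsuc (fsuc i)) k = refl

det-neg-minors : ∀ {n} (b : Vector ℤ (suc n)) (R S : Rows n (suc n)) →
  (∀ j → det n (λ r c → R r (punchIn j c)) ≡ - det n (λ r c → S r (punchIn j c))) →
  det (suc n) (b ◂ R) ≡ - det (suc n) (b ◂ S)
det-neg-minors {n} b R S eq = begin
  det (suc n) (b ◂ R)
    ≡⟨ sumFin-cong (λ j → trans (cong (sg j *ℤ b j *ℤ_) (eq j)) (sym (ℤ.neg-distribʳ-* (sg j *ℤ b j) (det n (λ r c → S r (punchIn j c)))))) ⟩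
  sumFin (suc n) (λ j → - (sg j *ℤ b j *ℤ det n (λ r c → S r (punchIn j c))))
    ≡⟨ sumFin-neg (λ j → sg j *ℤ b j *ℤ det n (λ r c → S r (punchIn j c))) ⟩
  - det (suc n) (b ◂ S) ∎

det-swap₀₁ : ∀ {n} u v R → det (suc (suc n)) (u ◂ v ◂ R) ≡ - det (suc (suc n)) (v ◂ u ◂ R)
det-swap₀₁ {n} u v R = laplace₂-antisym n u v (λ φ → det n (λ r c → R r (φ c)))
  (λ φ ψ eq → det-cong {n} {λ r c → R r (φ c)} {λ r c → R r (ψ c)} (λ r c → cong (R r) (eq c)))

-- For a row further down, `u` first changes places with the second row `b`. In the expansion along
-- `b` the minors have `u` as their first row, so the induction hypothesis applies to them; a last
-- exchange removes `b` from the top.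
det-swap : ∀ {n} u (R : Rows n (suc n)) r → det (suc n) (u ◂ R) ≡ - det (suc n) (R r ◂ updateAt R r (const u))
det-swap {suc n} u R fzero = begin
  det (suc (suc n)) (u ◂ R)                     ≡⟨ det-cong {M = u ◂ R} {u ◂ R fzero ◂ tail R} (head∷head∷tail (u ◂ R)) ⟩
  det (suc (suc n)) (u ◂ R fzero ◂ tail R)      ≡⟨ det-swap₀₁ u (R fzero) (tail R) ⟩
  - det (suc (suc n)) (R fzero ◂ u ◂ tail R)    ≡⟨ cong -_ (det-cong {M = U} {R fzero ◂ u ◂ tail R} (head∷head∷tail U)) ⟨
  - det (suc (suc n)) U ∎
  where U = R fzero ◂ updateAt R fzero (const u)
det-swap {suc n} u R (fsuc r) = begin
  det (suc (suc n)) (u ◂ R)                     ≡⟨ det-cong {M = u ◂ R} {u ◂ R fzero ◂ tail R} (head∷head∷tail (u ◂ R)) ⟩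
  det (suc (suc n)) (u ◂ b ◂ tail R)            ≡⟨ det-swap₀₁ u b (tail R) ⟩
  - det (suc (suc n)) (b ◂ u ◂ tail R)          ≡⟨ cong -_ (det-neg-minors b (u ◂ tail R) (R (fsuc r) ◂ updateAt (tail R) r (const u)) minors) ⟩
  - - det (suc (suc n)) (b ◂ R (fsuc r) ◂ updateAt (tail R) r (const u))
                                                ≡⟨ cong -_ (det-swap₀₁ (R (fsuc r)) b (updateAt (tail R) r (const u))) ⟨
  - det (suc (suc n)) (R (fsuc r) ◂ b ◂ updateAt (tail R) r (const u))
                                                ≡⟨ cong -_ (det-cong {M = U} {R (fsuc r) ◂ b ◂ updateAt (tail R) r (const u)} (head∷head∷tail U)) ⟨
  - det (suc (suc n)) U ∎
  where
  U = R (fsuc r) ◂ updateAt R (fsuc r) (const u)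
  b = R fzero
  updateAt-∘ : ∀ {m} (S : Rows m (suc (suc n))) r j i c →
    updateAt (λ i c → S i (punchIn j c)) r (const (u ∘ punchIn j)) i c ≡ updateAt S r (const u) i (punchIn j c)
  updateAt-∘ S fzero    j fzero    c = refl
  updateAt-∘ S fzero    j (fsuc i) c = refl
  updateAt-∘ S (fsuc r) j fzero    c = refl
  updateAt-∘ S (fsuc r) j (fsuc i) c = updateAt-∘ (S ∘ fsuc) r j i c
  minors : ∀ j → det (suc n) (λ i c → (u ◂ tail R) i (punchIn j c)) ≡
    - det (suc n) (λ i c → (R (fsuc r) ◂ updateAt (tail R) r (const u)) i (punchIn j c))
  minors j = begin
    det (suc n) (λ i c → (u ◂ tail R) i (punchIn j c))
      ≡⟨ det-cong {M = λ i c → (u ◂ tail R) i (punchIn j c)} {(u ∘ punchIn j) ◂ R′} (λ { fzero c → refl ; (fsuc i) c → refl }) ⟩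
    det (suc n) ((u ∘ punchIn j) ◂ R′)
      ≡⟨ det-swap (u ∘ punchIn j) R′ r ⟩
    - det (suc n) (R′ r ◂ updateAt R′ r (const (u ∘ punchIn j)))
      ≡⟨ cong -_ (det-cong {M = R′ r ◂ updateAt R′ r (const (u ∘ punchIn j))} {λ i c → (R (fsuc r) ◂ updateAt (tail R) r (const u)) i (punchIn j c)} (λ { fzero c → refl ; (fsuc i) c → updateAt-∘ (tail R) r j i c })) ⟩
    - det (suc n) (λ i c → (R (fsuc r) ◂ updateAt (tail R) r (const u)) i (punchIn j c)) ∎
    where
    R′ : Rows n (suc n)
    R′ i c = R (fsuc i) (punchIn j c)

det-alternating : ∀ {n} → Alternating (det (suc n))
det-alternating {n} = record
  { D-cong = det-cong
  ; D-+ = λ u v R → trans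
      (sumFin-cong (λ j → distrib (sg j) (u j) (v j) (det n (λ r c → R r (punchIn j c)))))
      (sumFin-+ (λ j → sg j *ℤ u j *ℤ det n (λ r c → R r (punchIn j c))) (λ j → sg j *ℤ v j *ℤ det n (λ r c → R r (punchIn j c))))
  ; D-* = λ a u R → trans
      (sumFin-cong (λ j → pull a (sg j) (u j) (det n (λ r c → R r (punchIn j c)))))
      (sym (*-sumFin a (λ j → sg j *ℤ u j *ℤ det n (λ r c → R r (punchIn j c)))))
  ; D-swap = det-swap
  }
  where
  distrib : ∀ s x y d → s *ℤ (x +ℤ y) *ℤ d ≡ s *ℤ x *ℤ d +ℤ s *ℤ y *ℤ d
  distrib = solve-∀
  pull : ∀ a s x d → s *ℤ (a *ℤ x) *ℤ d ≡ a *ℤ (s *ℤ x *ℤ d)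
  pull = solve-∀

-- Products, block matrices and similarity

infixl 7 _⊗_
_⊗_ : ∀ {a b c} → Rows a b → Rows b c → Rows a c
_⊗_ {b = b} M N i k = sumFin b (λ j → M i j *ℤ N j k)

-- As a function of `M` the left side is alternating, and at the identity its value is `det N`; so
-- `alternating-unique` applies.
det-⊗ : ∀ n (M N : Rows n n) → det n (M ⊗ N) ≡ det n M *ℤ det n N
det-⊗ zero    M N = refl
det-⊗ (suc n) M N = trans
  (alternating-unique (D-rowMap det-alternating (λ u k → sumFin (suc n) (λ j → u j *ℤ N j k))
    (λ eq k → sumFin-cong (λ j → cong (_*ℤ N j k) (eq j)))
    (λ u v k → trans (sumFin-cong (λ j → ℤ.*-distribʳ-+ (N j k) (u j) (v j))) (sumFin-+ (λ j → u j *ℤ N j k) (λ j → v j *ℤ N j k)))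
    (λ a u k → trans (sumFin-cong (λ j → ℤ.*-assoc a (u j) (N j k))) (sym (*-sumFin a (λ j → u j *ℤ N j k))))) M)
  (cong (det (suc n) M *ℤ_) (det-cong (λ i k → I-sum (λ j → N j k) i)))

det-scalar : ∀ n a → det n (λ i j → a *ℤ I i j) ≡ a ^ℤ n
det-scalar zero    a = refl
det-scalar (suc n) a = begin
  + 1 *ℤ (a *ℤ + 1) *ℤ det n (λ i j → a *ℤ I i j) +ℤ sumFin n (λ j → sg (fsuc j) *ℤ (a *ℤ + 0) *ℤ minors j)
    ≡⟨ cong₂ _+ℤ_ (cong₂ _*ℤ_ (one a) (det-scalar n a)) (trans (sumFin-cong (λ j → zeros (sg (fsuc j)) a (minors j))) (sumFin-zero n)) ⟩
  a *ℤ a ^ℤ n +ℤ + 0 ≡⟨ ℤ.+-identityʳ _ ⟩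
  a *ℤ a ^ℤ n ∎
  where
  minors : Fin n → ℤ
  minors j = det n (minor (fsuc j) (λ i j → a *ℤ I i j))
  one : ∀ a → + 1 *ℤ (a *ℤ + 1) ≡ a
  one = solve-∀
  zeros : ∀ s a d → s *ℤ (a *ℤ + 0) *ℤ d ≡ + 0
  zeros = solve-∀

punchIn-↑ˡ-↑ˡ : ∀ {a} b (j : Fin (suc a)) (c : Fin a) → punchIn (j ↑ˡ b) (c ↑ˡ b) ≡ punchIn j c ↑ˡ b
punchIn-↑ˡ-↑ˡ b fzero    c        = refl
punchIn-↑ˡ-↑ˡ b (fsuc j) fzero    = refl
punchIn-↑ˡ-↑ˡ b (fsuc j) (fsuc c) = cong fsuc (punchIn-↑ˡ-↑ˡ b j c)

punchIn-↑ˡ-↑ʳ : ∀ a {b} (j : Fin (suc a)) (c : Fin b) → punchIn (j ↑ˡ b) (a ↑ʳ c) ≡ suc a ↑ʳ c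
punchIn-↑ˡ-↑ʳ a       fzero    c = refl
punchIn-↑ˡ-↑ʳ (suc a) (fsuc j) c = cong fsuc (punchIn-↑ˡ-↑ʳ a j c)

-- In the expansion along the first row the columns of the right block drop out, and the minors of
-- the other columns are block triangular with the same lower block.
det-blockTriangular : ∀ a {b} (M : Rows (a + b) (a + b)) → (∀ i j → M (i ↑ˡ b) (a ↑ʳ j) ≡ + 0) →
  det (a + b) M ≡ det a (λ i j → M (i ↑ˡ b) (j ↑ˡ b)) *ℤ det b (λ i j → M (a ↑ʳ i) (a ↑ʳ j))
det-blockTriangular zero    M zeros = sym (ℤ.*-identityˡ _)
det-blockTriangular (suc a) {b} M zeros = begin
  det (suc a + b) M
    ≡⟨ sumFin-split (suc a) t ⟩
  sumFin (suc a) (λ j → t (j ↑ˡ b)) +ℤ sumFin b (λ j → t (suc a ↑ʳ j))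
    ≡⟨ cong₂ _+ℤ_ (sumFin-cong left) (trans (sumFin-cong right) (sumFin-zero b)) ⟩
  sumFin (suc a) (λ j → sg j *ℤ A fzero j *ℤ det a (minor j A) *ℤ det b B) +ℤ + 0
    ≡⟨ ℤ.+-identityʳ _ ⟩
  sumFin (suc a) (λ j → sg j *ℤ A fzero j *ℤ det a (minor j A) *ℤ det b B)
    ≡⟨ sumFin-* (λ j → sg j *ℤ A fzero j *ℤ det a (minor j A)) (det b B) ⟨
  det (suc a) A *ℤ det b B ∎
  where
  A : Rows (suc a) (suc a)
  A i j = M (i ↑ˡ b) (j ↑ˡ b)
  B : Rows b b
  B i j = M (suc a ↑ʳ i) (suc a ↑ʳ j)
  t : Fin (suc a + b) → ℤ
  t j = sg j *ℤ M fzero j *ℤ det (a + b) (minor j M)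
  right : ∀ j → t (suc a ↑ʳ j) ≡ + 0
  right j = trans (cong (λ x → sg (suc a ↑ʳ j) *ℤ x *ℤ minor′) (zeros fzero j)) (zero-factor (sg (suc a ↑ʳ j)) minor′)
    where
    minor′ = det (a + b) (minor (suc a ↑ʳ j) M)
    zero-factor : ∀ x y → x *ℤ + 0 *ℤ y ≡ + 0
    zero-factor = solve-∀
  left : ∀ j → t (j ↑ˡ b) ≡ sg j *ℤ A fzero j *ℤ det a (minor j A) *ℤ det b B
  left j = begin
    sg (j ↑ˡ b) *ℤ A fzero j *ℤ det (a + b) (minor (j ↑ˡ b) M)
      ≡⟨ cong₂ (λ x y → (- + 1) ^ℤ x *ℤ A fzero j *ℤ y) (Fin.toℕ-↑ˡ j b)
           (det-blockTriangular a (minor (j ↑ˡ b) M) (λ i c → trans (cong (M (fsuc i ↑ˡ b)) (punchIn-↑ˡ-↑ʳ a j c)) (zeros (fsuc i) c))) ⟩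
    sg j *ℤ A fzero j *ℤ (det a (λ i c → M (fsuc i ↑ˡ b) (punchIn (j ↑ˡ b) (c ↑ˡ b))) *ℤ det b (λ i c → M (suc a ↑ʳ i) (punchIn (j ↑ˡ b) (a ↑ʳ c))))
      ≡⟨ cong₂ (λ x y → sg j *ℤ A fzero j *ℤ (x *ℤ y)) (det-cong (λ i c → cong (M (fsuc i ↑ˡ b)) (punchIn-↑ˡ-↑ˡ b j c))) (det-cong (λ i c → cong (M (suc a ↑ʳ i)) (punchIn-↑ˡ-↑ʳ a j c))) ⟩
    sg j *ℤ A fzero j *ℤ (det a (minor j A) *ℤ det b B)
      ≡⟨ ℤ.*-assoc (sg j *ℤ A fzero j) _ _ ⟨
    sg j *ℤ A fzero j *ℤ det a (minor j A) *ℤ det b B ∎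

-- Similarity over ℚ without fractions: `P` may fail to be invertible over ℤ, but `det P` divides
-- the nonzero number `a ^ℤ n` and can therefore be cancelled.
det-intertwine : ∀ n (P Q C D : Rows n n) a → a ≢ + 0 →
  Q ⊗ P ≗₂ (λ i j → a *ℤ I i j) → P ⊗ C ≗₂ D ⊗ P → det n C ≡ det n D
det-intertwine n P Q C D a a≢0 QP≡a PC≡DP =
  ℤ.*-cancelˡ-≡ (det n P) _ _ {{ℤB.≢-nonZero P≢0}} (begin
    det n P *ℤ det n C ≡⟨ det-⊗ n P C ⟨
    det n (P ⊗ C)      ≡⟨ det-cong PC≡DP ⟩
    det n (D ⊗ P)      ≡⟨ det-⊗ n D P ⟩
    det n D *ℤ det n P ≡⟨ ℤ.*-comm (det n D) (det n P) ⟩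
    det n P *ℤ det n D ∎)
  where
  P≢0 : det n P ≢ + 0
  P≢0 P≡0 = a≢0 (ℤ.i^n≡0⇒i≡0 a n (begin
    a ^ℤ n                    ≡⟨ det-scalar n a ⟨
    det n (λ i j → a *ℤ I i j) ≡⟨ det-cong QP≡a ⟨
    det n (Q ⊗ P)             ≡⟨ det-⊗ n Q P ⟩
    det n Q *ℤ det n P        ≡⟨ cong (det n Q *ℤ_) P≡0 ⟩
    det n Q *ℤ + 0            ≡⟨ ℤ.*-zeroʳ (det n Q) ⟩
    + 0                       ∎))

++-elim : ∀ {a b} (P : Fin (a + b) → Set) → (∀ i → P (i ↑ˡ b)) → (∀ j → P (a ↑ʳ j)) → ∀ k → P k
++-elim {zero}  P l r k        = r k
++-elim {suc a} P l r fzero    = l fzero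
++-elim {suc a} P l r (fsuc k) = ++-elim {a} (P ∘ fsuc) (l ∘ fsuc) r k

sumFin-++ : ∀ {a b} (u u′ : Vector ℤ a) (v v′ : Vector ℤ b) →
  sumFin (a + b) (λ k → (u ++ v) k *ℤ (u′ ++ v′) k) ≡
  sumFin a (λ i → u i *ℤ u′ i) +ℤ sumFin b (λ j → v j *ℤ v′ j)
sumFin-++ {a} u u′ v v′ = trans (sumFin-split a _) (cong₂ _+ℤ_
  (sumFin-cong (λ i → cong₂ _*ℤ_ (lookup-++ˡ u v i) (lookup-++ˡ u′ v′ i)))
  (sumFin-cong (λ j → cong₂ _*ℤ_ (lookup-++ʳ u v j) (lookup-++ʳ u′ v′ j))))

infixr 5 _⊕_
_⊕_ : ∀ {a b} → Rows a a → Rows b b → Rows (a + b) (a + b)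
M ⊕ N = (λ i → M i ++ const (+ 0)) ++ (λ j → const (+ 0) ++ N j)

module _ {a b} (M : Rows a a) (N : Rows b b) where

  ⊕-ˡ : ∀ i k → (M ⊕ N) (i ↑ˡ b) k ≡ (M i ++ const (+ 0)) k
  ⊕-ˡ i k = cong (λ r → r k) (lookup-++ˡ (λ i → M i ++ const (+ 0)) (λ j → const (+ 0) ++ N j) i)

  ⊕-ʳ : ∀ j k → (M ⊕ N) (a ↑ʳ j) k ≡ (const (+ 0) ++ N j) k
  ⊕-ʳ j k = cong (λ r → r k) (lookup-++ʳ (λ i → M i ++ const (+ 0)) (λ j → const (+ 0) ++ N j) j)

  det-⊕ : det (a + b) (M ⊕ N) ≡ det a M *ℤ det b N
  det-⊕ = trans
    (det-blockTriangular a (M ⊕ N) (λ i j → trans (⊕-ˡ i (a ↑ʳ j)) (lookup-++ʳ (M i) (const (+ 0)) j)))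
    (cong₂ _*ℤ_
      (det-cong {M = λ i j → (M ⊕ N) (i ↑ˡ b) (j ↑ˡ b)} {M} (λ i j → trans (⊕-ˡ i (j ↑ˡ b)) (lookup-++ˡ (M i) (const (+ 0)) j)))
      (det-cong {M = λ i j → (M ⊕ N) (a ↑ʳ i) (a ↑ʳ j)} {N} (λ i j → trans (⊕-ʳ i (a ↑ʳ j)) (lookup-++ʳ {m = a} (const (+ 0)) (N i) j))))

  ⊕-apply : ∀ (u : Vector ℤ a) (v : Vector ℤ b) k →
    sumFin (a + b) (λ l → (M ⊕ N) k l *ℤ (u ++ v) l) ≡
    ((λ i → sumFin a (λ l → M i l *ℤ u l)) ++ (λ j → sumFin b (λ l → N j l *ℤ v l))) k
  ⊕-apply u v = ++-elim _
    (λ i → begin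
      sumFin (a + b) (λ l → (M ⊕ N) (i ↑ˡ b) l *ℤ (u ++ v) l)    ≡⟨ sumFin-cong (λ l → cong (_*ℤ (u ++ v) l) (⊕-ˡ i l)) ⟩
      sumFin (a + b) (λ l → (M i ++ const (+ 0)) l *ℤ (u ++ v) l) ≡⟨ sumFin-++ (M i) u (const (+ 0)) v ⟩
      Mu i +ℤ sumFin b (const (+ 0))                              ≡⟨ cong (Mu i +ℤ_) (sumFin-zero b) ⟩
      Mu i +ℤ + 0                                                 ≡⟨ ℤ.+-identityʳ (Mu i) ⟩
      Mu i                                                        ≡⟨ lookup-++ˡ Mu Nv i ⟨
      (Mu ++ Nv) (i ↑ˡ b)                                         ∎)
    (λ j → begin
      sumFin (a + b) (λ l → (M ⊕ N) (a ↑ʳ j) l *ℤ (u ++ v) l)    ≡⟨ sumFin-cong (λ l → cong (_*ℤ (u ++ v) l) (⊕-ʳ j l)) ⟩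
      sumFin (a + b) (λ l → (const (+ 0) ++ N j) l *ℤ (u ++ v) l) ≡⟨ sumFin-++ (const (+ 0)) u (N j) v ⟩
      sumFin a (const (+ 0)) +ℤ Nv j                              ≡⟨ cong (_+ℤ Nv j) (sumFin-zero a) ⟩
      + 0 +ℤ Nv j                                                 ≡⟨ ℤ.+-identityˡ (Nv j) ⟩
      Nv j                                                        ≡⟨ lookup-++ʳ Mu Nv j ⟨
      (Mu ++ Nv) (a ↑ʳ j)                                         ∎)
    where
    Mu = λ i → sumFin a (λ l → M i l *ℤ u l)
    Nv = λ j → sumFin b (λ l → N j l *ℤ v l)

-- Sums over ℤ/m

Periodic : ℕ → (ℤ → ℤ) → Set
Periodic m F = ∀ u → F (u +ℤ + m) ≡ F u

-- Functions on ℤ/m are encoded as periodic functions on ℤ, so that identities between their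
-- arguments are plain ring identities.
cycSum : ℕ → (ℤ → ℤ) → ℤ
cycSum m F = sumFin m (λ i → F (+ toℕ i))

cycSum-cong : ∀ m {F G : ℤ → ℤ} → (∀ u → F u ≡ G u) → cycSum m F ≡ cycSum m G
cycSum-cong m eq = sumFin-cong {m} (λ i → eq (+ toℕ i))

sumFin-last : ∀ n (f : ℕ → ℤ) → sumFin (suc n) (λ i → f (toℕ i)) ≡ sumFin n (λ i → f (toℕ i)) +ℤ f n
sumFin-last zero    f = ℤ.+-comm (f 0) (+ 0)
sumFin-last (suc n) f = trans (cong (f 0 +ℤ_) (sumFin-last n (f ∘ suc))) (sym (ℤ.+-assoc (f 0) _ _))

periodic-∘- : ∀ {m F} → Periodic m F → ∀ a → Periodic m (λ u → F (a -ℤ u))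
periodic-∘- {m} {F} per a u = trans (sym (per (a -ℤ (u +ℤ + m)))) (cong F (lem a u (+ m)))
  where
  lem : ∀ a u m → a -ℤ (u +ℤ m) +ℤ m ≡ a -ℤ u
  lem = solve-∀

periodic-∘+ : ∀ {m F} → Periodic m F → ∀ a → Periodic m (λ u → F (u +ℤ a))
periodic-∘+ {m} {F} per a u = trans (cong F (lem u a (+ m))) (per (u +ℤ a))
  where
  lem : ∀ u a m → u +ℤ m +ℤ a ≡ u +ℤ a +ℤ m
  lem = solve-∀

periodic-* : ∀ {m F G} → Periodic m F → Periodic m G → Periodic m (λ u → F u *ℤ G u)
periodic-* perF perG u = cong₂ _*ℤ_ (perF u) (perG u)

cycSum-suc : ∀ m {F} → Periodic m F → cycSum m (λ u → F (u +ℤ + 1)) ≡ cycSum m F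
cycSum-suc zero    per = refl
cycSum-suc (suc n) {F} per = begin
  cycSum (suc n) (λ u → F (u +ℤ + 1))                            ≡⟨ sumFin-last n (λ i → F (+ (i + 1))) ⟩
  sumFin n (λ i → F (+ (toℕ i + 1))) +ℤ F (+ (n + 1))            ≡⟨ cong₂ _+ℤ_ (sumFin-cong {n} (λ i → cong (F ∘ +_) (ℕ.+-comm (toℕ i) 1))) (trans (cong (F ∘ +_) (ℕ.+-comm n 1)) (per (+ 0))) ⟩
  sumFin n (λ i → F (+ suc (toℕ i))) +ℤ F (+ 0)                  ≡⟨ ℤ.+-comm _ (F (+ 0)) ⟩
  cycSum (suc n) F                                               ∎

cycSum-shift : ∀ m {F} → Periodic m F → ∀ y → cycSum m (λ u → F (u +ℤ y)) ≡ cycSum m F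
cycSum-shift m {F} per (+ zero)  = cycSum-cong m (λ u → cong F (ℤ.+-identityʳ u))
cycSum-shift m {F} per (+ suc n) = begin
  cycSum m (λ u → F (u +ℤ + suc n))           ≡⟨ cycSum-cong m (λ u → cong F (sym (ℤ.+-assoc u (+ 1) (+ n)))) ⟩
  cycSum m (λ u → F (u +ℤ + 1 +ℤ + n))        ≡⟨ cycSum-suc m (periodic-∘+ per (+ n)) ⟩
  cycSum m (λ u → F (u +ℤ + n))               ≡⟨ cycSum-shift m per (+ n) ⟩
  cycSum m F                                  ∎
cycSum-shift m {F} per -[1+ n ] = begin
  cycSum m (λ u → F (u +ℤ -[1+ n ]))          ≡⟨ cycSum-suc m (periodic-∘+ per -[1+ n ]) ⟨
  cycSum m (λ u → F (u +ℤ + 1 +ℤ -[1+ n ]))   ≡⟨ cycSum-cong m (λ u → cong F (lem u (+ n))) ⟩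
  cycSum m (λ u → F (u +ℤ - + n))             ≡⟨ shift-neg n ⟩
  cycSum m F                                  ∎
  where
  lem : ∀ u n → u +ℤ + 1 +ℤ - (+ 1 +ℤ n) ≡ u +ℤ - n
  lem = solve-∀
  shift-neg : ∀ n → cycSum m (λ u → F (u +ℤ - + n)) ≡ cycSum m F
  shift-neg zero    = cycSum-shift m per (+ 0)
  shift-neg (suc n) = cycSum-shift m per -[1+ n ]

-- Delta functions on ℤ/m

δ : ℕ → ℤ → ℤ
δ m u = if does (+ m ∣ℤ? u) then + 1 else + 0

δ-yes : ∀ {m u} → + m ∣ℤ u → δ m u ≡ + 1
δ-yes {m} {u} d = cong (if_then + 1 else + 0) (dec-true (+ m ∣ℤ? u) d)

δ-no : ∀ {m u} → ¬ (+ m ∣ℤ u) → δ m u ≡ + 0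
δ-no {m} {u} ¬d = cong (if_then + 1 else + 0) (dec-false (+ m ∣ℤ? u) ¬d)

δ-cong : ∀ {m n u v} → (+ m ∣ℤ u → + n ∣ℤ v) → (+ n ∣ℤ v → + m ∣ℤ u) → δ m u ≡ δ n v
δ-cong {m} {n} {u} {v} f g = cong (if_then + 1 else + 0) (does-⇔ (mk⇔ f g) (+ m ∣ℤ? u) (+ n ∣ℤ? v))

δ-periodic : ∀ m → Periodic m (δ m)
δ-periodic m u = δ-cong {m} {m} {u +ℤ + m} {u} (λ d → ∣m+n∣n⇒∣m {m = u} d ∣-refl) (λ d → ∣m∣n⇒∣m+n d ∣-refl)

δ-even : ∀ m u → δ m (- u) ≡ δ m u
δ-even m u = δ-cong (λ d → subst (+ m ∣ℤ_) (ℤ.neg-involutive u) (∣m⇒∣-m d)) ∣m⇒∣-m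

δ-flip : ∀ m u v → δ m (u -ℤ v) ≡ δ m (v -ℤ u)
δ-flip m u v = trans (cong (δ m) (lem u v)) (δ-even m (v -ℤ u))
  where
  lem : ∀ u v → u -ℤ v ≡ - (v -ℤ u)
  lem = solve-∀

cycSum-δ₀ : ∀ m .{{_ : NonZero m}} (F : ℤ → ℤ) → cycSum m (λ u → F u *ℤ δ m u) ≡ F (+ 0)
cycSum-δ₀ (suc n) F = begin
  F (+ 0) *ℤ δ (suc n) (+ 0) +ℤ sumFin n (λ i → F (+ suc (toℕ i)) *ℤ δ (suc n) (+ suc (toℕ i)))
    ≡⟨ cong₂ _+ℤ_ (trans (cong (F (+ 0) *ℤ_) (δ-yes {suc n} {+ 0} (∣ᵤ⇒∣ (suc n ℕ∣.∣0)))) (ℤ.*-identityʳ (F (+ 0))))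
         (trans (sumFin-cong {n} (λ i → trans (cong (F (+ suc (toℕ i)) *ℤ_) (δ-no {suc n} {+ suc (toℕ i)} (λ d → ℕ∣.>⇒∤ (s≤s (Fin.toℕ<n i)) (∣⇒∣ᵤ d)))) (ℤ.*-zeroʳ (F (+ suc (toℕ i)))))) (sumFin-zero n)) ⟩
  F (+ 0) +ℤ + 0 ≡⟨ ℤ.+-identityʳ (F (+ 0)) ⟩
  F (+ 0) ∎

cycSum-δ : ∀ m .{{_ : NonZero m}} {F} → Periodic m F → ∀ a → cycSum m (λ u → F u *ℤ δ m (u -ℤ a)) ≡ F a
cycSum-δ m {F} per a = begin
  cycSum m (λ u → F u *ℤ δ m (u -ℤ a))                       ≡⟨ cycSum-shift m (periodic-* per (periodic-∘+ (δ-periodic m) (- a))) a ⟨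
  cycSum m (λ u → F (u +ℤ a) *ℤ δ m (u +ℤ a -ℤ a))           ≡⟨ cycSum-cong m (λ u → cong (λ x → F (u +ℤ a) *ℤ δ m x) (lem u a)) ⟩
  cycSum m (λ u → F (u +ℤ a) *ℤ δ m u)                       ≡⟨ cycSum-δ₀ m (λ u → F (u +ℤ a)) ⟩
  F (+ 0 +ℤ a)                                               ≡⟨ cong F (ℤ.+-identityˡ a) ⟩
  F a                                                        ∎
  where
  lem : ∀ u a → u +ℤ a -ℤ a ≡ u
  lem = solve-∀

cycSum-δ² : ∀ m .{{_ : NonZero m}} {F} → Periodic m F → ∀ a b →
  cycSum m (λ u → F u *ℤ (δ m (u -ℤ a) -ℤ δ m (u -ℤ b))) ≡ F a -ℤ F b
cycSum-δ² m {F} per a b = begin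
  cycSum m (λ u → F u *ℤ (δ m (u -ℤ a) -ℤ δ m (u -ℤ b)))
    ≡⟨ cycSum-cong m (λ u → distr (F u) (δ m (u -ℤ a)) (δ m (u -ℤ b))) ⟩
  cycSum m (λ u → F u *ℤ δ m (u -ℤ a) +ℤ - (F u *ℤ δ m (u -ℤ b)))
    ≡⟨ sumFin-+ {m} (λ i → F (+ toℕ i) *ℤ δ m (+ toℕ i -ℤ a)) (λ i → - (F (+ toℕ i) *ℤ δ m (+ toℕ i -ℤ b))) ⟩
  cycSum m (λ u → F u *ℤ δ m (u -ℤ a)) +ℤ cycSum m (λ u → - (F u *ℤ δ m (u -ℤ b)))
    ≡⟨ cong₂ _+ℤ_ (cycSum-δ m per a) (trans (sumFin-neg {m} (λ i → F (+ toℕ i) *ℤ δ m (+ toℕ i -ℤ b))) (cong -_ (cycSum-δ m per b))) ⟩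
  F a -ℤ F b ∎
  where
  distr : ∀ f x y → f *ℤ (x -ℤ y) ≡ f *ℤ x +ℤ - (f *ℤ y)
  distr = solve-∀

cycSum-δ⁴ : ∀ m .{{_ : NonZero m}} {F} → Periodic m F → ∀ a b c d →
  cycSum m (λ u → F u *ℤ ((δ m (u -ℤ a) -ℤ δ m (u -ℤ b)) +ℤ (δ m (u -ℤ c) -ℤ δ m (u -ℤ d)))) ≡ (F a -ℤ F b) +ℤ (F c -ℤ F d)
cycSum-δ⁴ m {F} per a b c d = begin
  cycSum m (λ u → F u *ℤ ((δ m (u -ℤ a) -ℤ δ m (u -ℤ b)) +ℤ (δ m (u -ℤ c) -ℤ δ m (u -ℤ d))))
    ≡⟨ cycSum-cong m (λ u → ℤ.*-distribˡ-+ (F u) (δ m (u -ℤ a) -ℤ δ m (u -ℤ b)) (δ m (u -ℤ c) -ℤ δ m (u -ℤ d))) ⟩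
  cycSum m (λ u → F u *ℤ (δ m (u -ℤ a) -ℤ δ m (u -ℤ b)) +ℤ F u *ℤ (δ m (u -ℤ c) -ℤ δ m (u -ℤ d)))
    ≡⟨ sumFin-+ {m} (λ i → F (+ toℕ i) *ℤ (δ m (+ toℕ i -ℤ a) -ℤ δ m (+ toℕ i -ℤ b))) (λ i → F (+ toℕ i) *ℤ (δ m (+ toℕ i -ℤ c) -ℤ δ m (+ toℕ i -ℤ d))) ⟩
  cycSum m (λ u → F u *ℤ (δ m (u -ℤ a) -ℤ δ m (u -ℤ b))) +ℤ cycSum m (λ u → F u *ℤ (δ m (u -ℤ c) -ℤ δ m (u -ℤ d)))
    ≡⟨ cong₂ _+ℤ_ (cycSum-δ² m per a b) (cycSum-δ² m per c d) ⟩
  (F a -ℤ F b) +ℤ (F c -ℤ F d) ∎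

-- Pairing u with - u

sumFin-fold : ∀ n (F : ℤ → ℤ) → sumFin (suc (n + n)) (λ i → F (+ toℕ i +ℤ - + n)) ≡
  F (+ 0) +ℤ sumFin n (λ i → F (+ suc (toℕ i)) +ℤ F (- + suc (toℕ i)))
sumFin-fold zero    F = refl
sumFin-fold (suc n) F = begin
  sumFin (suc (suc n + suc n)) (λ i → f (toℕ i))                     ≡⟨ cong (λ k → sumFin (suc (suc k)) (λ i → f (toℕ i))) (ℕ.+-suc n n) ⟩
  sumFin (suc (suc (suc (n + n)))) (λ i → f (toℕ i))                 ≡⟨ cong (f 0 +ℤ_) (sumFin-last (suc (n + n)) (f ∘ suc)) ⟩
  f 0 +ℤ (sumFin (suc (n + n)) (λ i → f (suc (toℕ i))) +ℤ f (suc (suc (n + n))))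
    ≡⟨ cong₂ (λ x y → f 0 +ℤ (x +ℤ y))
         (trans (sumFin-cong {suc (n + n)} (λ i → cong F (shift (+ toℕ i) (+ n)))) (sumFin-fold n F))
         (cong F (last (+ n))) ⟩
  f 0 +ℤ (F (+ 0) +ℤ pairs n +ℤ F (+ suc n))                         ≡⟨ regroup (f 0) (F (+ 0)) (pairs n) (F (+ suc n)) ⟩
  F (+ 0) +ℤ (pairs n +ℤ (F (+ suc n) +ℤ F (- + suc n)))             ≡⟨ cong (F (+ 0) +ℤ_) (sumFin-last n (λ i → F (+ suc i) +ℤ F (- + suc i))) ⟨
  F (+ 0) +ℤ pairs (suc n)                                           ∎
  where
  f : ℕ → ℤ
  f i = F (+ i +ℤ - + suc n)
  pairs : ℕ → ℤ
  pairs n = sumFin n (λ i → F (+ suc (toℕ i)) +ℤ F (- + suc (toℕ i)))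
  shift : ∀ i n → (+ 1 +ℤ i) +ℤ - (+ 1 +ℤ n) ≡ i +ℤ - n
  shift = solve-∀
  last : ∀ n → + 2 +ℤ (n +ℤ n) +ℤ - (+ 1 +ℤ n) ≡ + 1 +ℤ n
  last = solve-∀
  regroup : ∀ a b c d → a +ℤ (b +ℤ c +ℤ d) ≡ b +ℤ (c +ℤ (d +ℤ a))
  regroup = solve-∀

Odd : (ℤ → ℤ) → Set
Odd F = ∀ u → F (- u) ≡ - F u

pos : ∀ {n} → Fin n → ℤ
pos i = + suc (toℕ i)

-- Pairing u with - u in a sum over ℤ/m; n is the number of pairs {u, - u} with u ≢ - u.
Foldable : ℕ → ℕ → Set
Foldable m n = ∀ {X Y} → Periodic m X → Periodic m Y → Odd Y →
  cycSum m (λ u → X u *ℤ Y u) ≡ sumFin n (λ i → (X (pos i) -ℤ X (- pos i)) *ℤ Y (pos i))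

odd⇒0 : ∀ {Y : ℤ → ℤ} → Odd Y → Y (+ 0) ≡ + 0
odd⇒0 odd = i≡-i⇒i≡0 (odd (+ 0))

sumFin-fold-odd : ∀ n (X : ℤ → ℤ) {Y : ℤ → ℤ} → Odd Y →
  sumFin (suc (n + n)) (λ i → X (+ toℕ i +ℤ - + n) *ℤ Y (+ toℕ i +ℤ - + n)) ≡
  sumFin n (λ i → (X (pos i) -ℤ X (- pos i)) *ℤ Y (pos i))
sumFin-fold-odd n X {Y} odd = begin
  sumFin (suc (n + n)) (λ i → X (+ toℕ i +ℤ - + n) *ℤ Y (+ toℕ i +ℤ - + n))
    ≡⟨ sumFin-fold n (λ u → X u *ℤ Y u) ⟩
  X (+ 0) *ℤ Y (+ 0) +ℤ sumFin n (λ i → X (pos i) *ℤ Y (pos i) +ℤ X (- pos i) *ℤ Y (- pos i))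
    ≡⟨ cong₂ _+ℤ_ (trans (cong (X (+ 0) *ℤ_) (odd⇒0 odd)) (ℤ.*-zeroʳ (X (+ 0))))
         (sumFin-cong {n} (λ i → trans (cong (λ y → X (pos i) *ℤ Y (pos i) +ℤ X (- pos i) *ℤ y) (odd (pos i))) (factor (X (pos i)) (Y (pos i)) (X (- pos i))))) ⟩
  + 0 +ℤ sumFin n (λ i → (X (pos i) -ℤ X (- pos i)) *ℤ Y (pos i))
    ≡⟨ ℤ.+-identityˡ _ ⟩
  sumFin n (λ i → (X (pos i) -ℤ X (- pos i)) *ℤ Y (pos i)) ∎
  where
  factor : ∀ x y x′ → x *ℤ y +ℤ x′ *ℤ - y ≡ (x -ℤ x′) *ℤ y
  factor = solve-∀

foldable-odd : ∀ n → Foldable (1 + (n + n)) n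
foldable-odd n {X} {Y} perX perY odd = trans
  (sym (cycSum-shift (1 + (n + n)) (periodic-* {F = X} {Y} perX perY) (- + n)))
  (sumFin-fold-odd n X odd)

foldable-even : ∀ n → Foldable (2 + (n + n)) n
foldable-even n {X} {Y} perX perY odd = begin
  cycSum (2 + (n + n)) (λ u → X u *ℤ Y u)
    ≡⟨ cycSum-shift (2 + (n + n)) (periodic-* {F = X} {Y} perX perY) (- + n) ⟨
  cycSum (2 + (n + n)) (λ u → X (u +ℤ - + n) *ℤ Y (u +ℤ - + n))
    ≡⟨ sumFin-last (suc (n + n)) (λ i → X (+ i +ℤ - + n) *ℤ Y (+ i +ℤ - + n)) ⟩
  sumFin (suc (n + n)) (λ i → X (+ toℕ i +ℤ - + n) *ℤ Y (+ toℕ i +ℤ - + n)) +ℤ X half *ℤ Y half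
    ≡⟨ cong₂ _+ℤ_ (sumFin-fold-odd n X odd) (trans (cong (X half *ℤ_) Y-half) (ℤ.*-zeroʳ (X half))) ⟩
  sumFin n (λ i → (X (pos i) -ℤ X (- pos i)) *ℤ Y (pos i)) +ℤ + 0
    ≡⟨ ℤ.+-identityʳ _ ⟩
  sumFin n (λ i → (X (pos i) -ℤ X (- pos i)) *ℤ Y (pos i)) ∎
  where
  -- This is `n + 1 = m / 2`, the last point of the window from `- n` to `n + 1`. It is its own
  -- negative modulo `m`, so an odd periodic function vanishes there.
  half = + suc (n + n) +ℤ - + n
  lem : ∀ n → - (+ 1 +ℤ (n +ℤ n) +ℤ - n) +ℤ (+ 2 +ℤ (n +ℤ n)) ≡ + 1 +ℤ (n +ℤ n) +ℤ - n
  lem = solve-∀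
  Y-half : Y half ≡ + 0
  Y-half = i≡-i⇒i≡0 {Y half} (trans (sym (trans (sym (perY (- half))) (cong Y (lem (+ n))))) (odd half))

-- Functions on ℤ/m split over ℚ into the characters E r of order at most 2 and two copies of the odd functions. The
-- first copy is F (u) - F (- u); for the second, the even part of F is turned into an odd function by
-- convolving it with an odd function supported on ± w. Up to the factor h, convolution with κ undoes
-- the latter, except for the term ν, which lies in the span of the E r.
record Splitting (m e n : ℕ) (E : Fin e → ℤ → ℤ) : Set where
  field
    foldable   : Foldable m n
    E-periodic : ∀ r → Periodic m (E r)
    E′         : Fin e → ℤ → ℤ
    κ ν        : ℤ → ℤ
    w h        : ℤ
    h≢0        : h ≢ + 0
    κ-periodic : Periodic m κ
    κ-diff     : ∀ u → κ (u -ℤ w) -ℤ κ (u +ℤ w) ≡ h *ℤ δ m u -ℤ ν u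
    -- In the product `Q ⊗ P` the characters contribute this sum, which restores the terms that
    -- `κ-diff` loses at `u - v` and at `u + v`.
    E-ν        : ∀ u v → sumFin e (λ r → E′ r u *ℤ E r v) ≡ ν (u -ℤ v) +ℤ ν (u +ℤ v)

-- Convolution with `c` on the odd functions, in the basis of the differences of deltas at `pos i`
-- and `- pos i`: the matrix whose determinant gets squared.
oddBlock : (c : ℤ → ℤ) (n : ℕ) → Rows n n
oddBlock c n i j = c (pos i -ℤ pos j) -ℤ c (pos i +ℤ pos j)

module _ {m e n : ℕ} .{{_ : NonZero m}} {E : Fin e → ℤ → ℤ} (S : Splitting m e n E)
  {c : ℤ → ℤ} (c-periodic : Periodic m c) (c-even : ∀ u → c (- u) ≡ c u)
  (eigenvalue : Fin e → ℤ)
  (E-eigen : ∀ r v → cycSum m (λ u → E r u *ℤ c (u -ℤ v)) ≡ eigenvalue r *ℤ E r v)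
  (x : Fin (e + (n + n)) → ℤ)
  (sum-x : ∀ F → Periodic m F → sumFin (e + (n + n)) (λ i → F (x i)) ≡ cycSum m F)
  (δ-x : ∀ i j → δ m (x i -ℤ x j) ≡ I i j)
  where
  open Splitting S

  private
    -- `A y` is the odd basis function at `y` and `- y`. `B y` is its convolution with the delta at
    -- `- w` minus the delta at `w`, hence even. `K y` is dual to `B y` up to the factor `h` and the
    -- terms in `ν`.
    A B K : ℤ → ℤ → ℤ
    A y u = δ m (u -ℤ y) -ℤ δ m (u +ℤ y)
    B y u = (δ m (u -ℤ (y -ℤ w)) -ℤ δ m (u -ℤ (y +ℤ w))) +ℤ (δ m (u +ℤ (y -ℤ w)) -ℤ δ m (u +ℤ (y +ℤ w)))
    K y u = κ (u -ℤ y) -ℤ κ (u +ℤ y)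

    pE qE : ℤ → Fin e → ℤ
    pE u r = E r u
    qE u r = E′ r u

    pA pB qA qB : ℤ → Fin n → ℤ
    pA u i = A (pos i) u
    pB u i = B (pos i) u
    qA u i = h *ℤ A (pos i) u
    qB u i = K (pos i) u

    -- The values at one point of the basis functions and of their duals.
    p q : ℤ → Fin (e + (n + n)) → ℤ
    p u = pE u ++ (pA u ++ pB u)
    q u = qE u ++ (qA u ++ qB u)

    P Q C D : Rows (e + (n + n)) (e + (n + n))
    P k j = p (x j) k
    Q j k = q (x j) k
    C i j = c (x i -ℤ x j)
    D = (λ r s → eigenvalue r *ℤ I r s) ⊕ (oddBlock c n ⊕ oddBlock c n)

    u-[-v] : ∀ u v → u -ℤ - v ≡ u +ℤ v
    u-[-v] = solve-∀

    A-δ : ∀ y u → A y u ≡ δ m (u -ℤ y) -ℤ δ m (u -ℤ - y)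
    A-δ y u = cong (λ v → δ m (u -ℤ y) -ℤ δ m v) (sym (u-[-v] u y))

    A-sym : ∀ y u → A y u ≡ A u y
    A-sym y u = cong₂ _-ℤ_ (δ-flip m u y) (cong (δ m) (ℤ.+-comm u y))

    A-periodic : ∀ y → Periodic m (A y)
    A-periodic y u = cong₂ _-ℤ_ (periodic-∘+ (δ-periodic m) (- y) u) (periodic-∘+ (δ-periodic m) y u)

    A-odd : ∀ y → Odd (A y)
    A-odd y u = trans (cong₂ _-ℤ_ (flip-δ (e₁ u y)) (flip-δ (e₂ u y))) (neg (δ m (u +ℤ y)) (δ m (u -ℤ y)))
      where
      flip-δ : ∀ {u v} → u ≡ - v → δ m u ≡ δ m v
      flip-δ {v = v} eq = trans (cong (δ m) eq) (δ-even m v)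
      e₁ : ∀ u y → - u -ℤ y ≡ - (u +ℤ y)
      e₁ = solve-∀
      e₂ : ∀ u y → - u +ℤ y ≡ - (u -ℤ y)
      e₂ = solve-∀
      neg : ∀ a b → a -ℤ b ≡ - (b -ℤ a)
      neg = solve-∀

    B-A : ∀ y u → B y u ≡ A (u +ℤ w) y -ℤ A (u -ℤ w) y
    B-A y u = trans
      (cong₂ _+ℤ_ (cong₂ _-ℤ_ (trans (δ-flip m u (y -ℤ w)) (cong (δ m) (e₁ u y w))) (trans (δ-flip m u (y +ℤ w)) (cong (δ m) (e₂ u y w))))
                  (cong₂ _-ℤ_ (cong (δ m) (e₃ u y w)) (cong (δ m) (e₄ u y w))))
      (regroup (δ m (y -ℤ (u +ℤ w))) (δ m (y -ℤ (u -ℤ w))) (δ m (y +ℤ (u -ℤ w))) (δ m (y +ℤ (u +ℤ w))))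
      where
      e₁ : ∀ u y w → y -ℤ w -ℤ u ≡ y -ℤ (u +ℤ w)
      e₁ = solve-∀
      e₂ : ∀ u y w → y +ℤ w -ℤ u ≡ y -ℤ (u -ℤ w)
      e₂ = solve-∀
      e₃ : ∀ u y w → u +ℤ (y -ℤ w) ≡ y +ℤ (u -ℤ w)
      e₃ = solve-∀
      e₄ : ∀ u y w → u +ℤ (y +ℤ w) ≡ y +ℤ (u +ℤ w)
      e₄ = solve-∀
      regroup : ∀ a b c d → (a -ℤ b) +ℤ (c -ℤ d) ≡ (a -ℤ d) -ℤ (b -ℤ c)
      regroup = solve-∀

    A-A-periodic : ∀ u → Periodic m (λ y → A (u +ℤ w) y -ℤ A (u -ℤ w) y)
    A-A-periodic u y = cong₂ _-ℤ_ (A-periodic (u +ℤ w) y) (A-periodic (u -ℤ w) y)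

    A-A-odd : ∀ u → Odd (λ y → A (u +ℤ w) y -ℤ A (u -ℤ w) y)
    A-A-odd u y = trans (cong₂ _-ℤ_ (A-odd (u +ℤ w) y) (A-odd (u -ℤ w) y)) (neg (A (u +ℤ w) y) (A (u -ℤ w) y))
      where
      neg : ∀ a b → - a -ℤ - b ≡ - (a -ℤ b)
      neg = solve-∀

    B-periodic : ∀ y → Periodic m (B y)
    B-periodic y u = cong₂ _+ℤ_ (cong₂ _-ℤ_ (per (- (y -ℤ w)) u) (per (- (y +ℤ w)) u)) (cong₂ _-ℤ_ (per (y -ℤ w) u) (per (y +ℤ w) u))
      where
      per = periodic-∘+ (δ-periodic m)

    sum-A : ∀ {F} → Periodic m F → ∀ y → cycSum m (λ u → F u *ℤ A y u) ≡ F y -ℤ F (- y)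
    sum-A {F} per y = trans (cycSum-cong m (λ u → cong (F u *ℤ_) (A-δ y u))) (cycSum-δ² m per y (- y))

    sum-B : ∀ {F} → Periodic m F → ∀ y →
      cycSum m (λ u → F u *ℤ B y u) ≡ (F (y -ℤ w) -ℤ F (y +ℤ w)) +ℤ (F (- (y -ℤ w)) -ℤ F (- (y +ℤ w)))
    sum-B {F} per y = trans
      (cycSum-cong m (λ u → cong₂ (λ s t → F u *ℤ ((δ m (u -ℤ (y -ℤ w)) -ℤ δ m (u -ℤ (y +ℤ w))) +ℤ (δ m s -ℤ δ m t)))
        (sym (u-[-v] u (y -ℤ w))) (sym (u-[-v] u (y +ℤ w)))))
      (cycSum-δ⁴ m per (y -ℤ w) (y +ℤ w) (- (y -ℤ w)) (- (y +ℤ w)))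

    -- By symmetry of `A` the sum is one over the pairs of the odd function `A u`. `foldable` opens
    -- it to a sum over all of ℤ/m, where the deltas in `A u` pick out two values of `X`.
    fold-A : ∀ {X} → Periodic m X → ∀ u →
      sumFin n (λ i → (X (pos i) -ℤ X (- pos i)) *ℤ A (pos i) u) ≡ X u -ℤ X (- u)
    fold-A {X} per u = begin
      sumFin n (λ i → (X (pos i) -ℤ X (- pos i)) *ℤ A (pos i) u) ≡⟨ sumFin-cong {n} (λ i → cong ((X (pos i) -ℤ X (- pos i)) *ℤ_) (A-sym (pos i) u)) ⟩
      sumFin n (λ i → (X (pos i) -ℤ X (- pos i)) *ℤ A u (pos i)) ≡⟨ foldable per (A-periodic u) (A-odd u) ⟨
      cycSum m (λ y → X y *ℤ A u y)                              ≡⟨ sum-A per u ⟩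
      X u -ℤ X (- u)                                             ∎

    fold-B : ∀ {X} → Periodic m X → ∀ u →
      sumFin n (λ i → (X (pos i) -ℤ X (- pos i)) *ℤ B (pos i) u) ≡
      (X (u +ℤ w) -ℤ X (- (u +ℤ w))) -ℤ (X (u -ℤ w) -ℤ X (- (u -ℤ w)))
    fold-B {X} per u = begin
      sumFin n (λ i → (X (pos i) -ℤ X (- pos i)) *ℤ B (pos i) u)
        ≡⟨ sumFin-cong {n} (λ i → cong ((X (pos i) -ℤ X (- pos i)) *ℤ_) (B-A (pos i) u)) ⟩
      sumFin n (λ i → (X (pos i) -ℤ X (- pos i)) *ℤ (A (u +ℤ w) (pos i) -ℤ A (u -ℤ w) (pos i)))
        ≡⟨ foldable per (A-A-periodic u) (A-A-odd u) ⟨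
      cycSum m (λ y → X y *ℤ (A (u +ℤ w) y -ℤ A (u -ℤ w) y))
        ≡⟨ cycSum-cong m (λ y → distr (X y) (A (u +ℤ w) y) (A (u -ℤ w) y)) ⟩
      cycSum m (λ y → X y *ℤ A (u +ℤ w) y +ℤ - (X y *ℤ A (u -ℤ w) y))
        ≡⟨ sumFin-+ {m} (λ i → X (+ toℕ i) *ℤ A (u +ℤ w) (+ toℕ i)) (λ i → - (X (+ toℕ i) *ℤ A (u -ℤ w) (+ toℕ i))) ⟩
      cycSum m (λ y → X y *ℤ A (u +ℤ w) y) +ℤ cycSum m (λ y → - (X y *ℤ A (u -ℤ w) y))
        ≡⟨ cong₂ _+ℤ_ (sum-A per (u +ℤ w)) (trans (sumFin-neg {m} (λ i → X (+ toℕ i) *ℤ A (u -ℤ w) (+ toℕ i))) (cong -_ (sum-A per (u -ℤ w)))) ⟩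
      (X (u +ℤ w) -ℤ X (- (u +ℤ w))) -ℤ (X (u -ℤ w) -ℤ X (- (u -ℤ w))) ∎
      where
      distr : ∀ f x y → f *ℤ (x -ℤ y) ≡ f *ℤ x +ℤ - (f *ℤ y)
      distr = solve-∀

    -- The decomposition of a delta into odd and even part: the rows `A` give `h` times δ (u - v)
    -- minus δ (u + v), the rows `B` give `h` times the sum of the two, less the terms in `ν`, and
    -- the characters replace those. The deltas at `u + v` cancel and those at `u - v` double.
    QP≡2h : Q ⊗ P ≗₂ (λ i j → (+ 2 *ℤ h) *ℤ I i j)
    QP≡2h i j = begin
      sumFin (e + (n + n)) (λ k → q u k *ℤ p v k)
        ≡⟨ sumFin-++ (qE u) (pE v) (qA u ++ qB u) (pA v ++ pB v) ⟩
      sumFin e (λ r → E′ r u *ℤ E r v) +ℤ sumFin (n + n) (λ k → (qA u ++ qB u) k *ℤ (pA v ++ pB v) k)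
        ≡⟨ cong₂ _+ℤ_ (E-ν u v) (sumFin-++ (qA u) (pA v) (qB u) (pB v)) ⟩
      (ν (u -ℤ v) +ℤ ν (u +ℤ v)) +ℤ (sumFin n (λ i → h *ℤ A (pos i) u *ℤ A (pos i) v) +ℤ sumFin n (λ i → K (pos i) u *ℤ B (pos i) v))
        ≡⟨ cong₂ (λ s t → (ν (u -ℤ v) +ℤ ν (u +ℤ v)) +ℤ (s +ℤ t)) hAA KB ⟩
      (ν (u -ℤ v) +ℤ ν (u +ℤ v)) +ℤ ((h *ℤ δ m (u -ℤ v) -ℤ h *ℤ δ m (u +ℤ v)) +ℤ ((h *ℤ δ m (u -ℤ v) -ℤ ν (u -ℤ v)) +ℤ (h *ℤ δ m (u +ℤ v) -ℤ ν (u +ℤ v))))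
        ≡⟨ collect (ν (u -ℤ v)) (ν (u +ℤ v)) h (δ m (u -ℤ v)) (δ m (u +ℤ v)) ⟩
      + 2 *ℤ h *ℤ δ m (u -ℤ v)
        ≡⟨ cong (+ 2 *ℤ h *ℤ_) (δ-x i j) ⟩
      + 2 *ℤ h *ℤ I i j ∎
      where
      u = x i
      v = x j
      collect : ∀ a b h s t → (a +ℤ b) +ℤ ((h *ℤ s -ℤ h *ℤ t) +ℤ ((h *ℤ s -ℤ a) +ℤ (h *ℤ t -ℤ b))) ≡ + 2 *ℤ h *ℤ s
      collect = solve-∀
      hAA : sumFin n (λ i → h *ℤ A (pos i) u *ℤ A (pos i) v) ≡ h *ℤ δ m (u -ℤ v) -ℤ h *ℤ δ m (u +ℤ v)
      hAA = begin
        sumFin n (λ i → h *ℤ A (pos i) u *ℤ A (pos i) v)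
          ≡⟨ sumFin-cong {n} (λ i → cong (_*ℤ A (pos i) v) (distr h (δ m (u -ℤ pos i)) (δ m (u +ℤ pos i)))) ⟩
        sumFin n (λ i → (h *ℤ δ m (u -ℤ pos i) -ℤ h *ℤ δ m (u +ℤ pos i)) *ℤ A (pos i) v)
          ≡⟨ fold-A {λ y → h *ℤ δ m (u -ℤ y)} (λ y → cong (h *ℤ_) (periodic-∘- (δ-periodic m) u y)) v ⟩
        h *ℤ δ m (u -ℤ v) -ℤ h *ℤ δ m (u -ℤ - v)
          ≡⟨ cong (λ t → h *ℤ δ m (u -ℤ v) -ℤ h *ℤ δ m t) (u-[-v] u v) ⟩
        h *ℤ δ m (u -ℤ v) -ℤ h *ℤ δ m (u +ℤ v) ∎
        where
        distr : ∀ h a b → h *ℤ (a -ℤ b) ≡ h *ℤ a -ℤ h *ℤ b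
        distr = solve-∀
      KB : sumFin n (λ i → K (pos i) u *ℤ B (pos i) v) ≡ (h *ℤ δ m (u -ℤ v) -ℤ ν (u -ℤ v)) +ℤ (h *ℤ δ m (u +ℤ v) -ℤ ν (u +ℤ v))
      KB = begin
        sumFin n (λ i → K (pos i) u *ℤ B (pos i) v)
          ≡⟨ sumFin-cong {n} (λ i → cong (λ t → (κ (u -ℤ pos i) -ℤ κ t) *ℤ B (pos i) v) (sym (u-[-v] u (pos i)))) ⟩
        sumFin n (λ i → (κ (u -ℤ pos i) -ℤ κ (u -ℤ - pos i)) *ℤ B (pos i) v)
          ≡⟨ fold-B {λ y → κ (u -ℤ y)} (periodic-∘- κ-periodic u) v ⟩
        (κ (u -ℤ (v +ℤ w)) -ℤ κ (u -ℤ - (v +ℤ w))) -ℤ (κ (u -ℤ (v -ℤ w)) -ℤ κ (u -ℤ - (v -ℤ w)))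
          ≡⟨ cong₂ _-ℤ_ (cong₂ (λ s t → κ s -ℤ κ t) (e₁ u v w) (e₂ u v w)) (cong₂ (λ s t → κ s -ℤ κ t) (e₃ u v w) (e₄ u v w)) ⟩
        (κ (u -ℤ v -ℤ w) -ℤ κ (u +ℤ v +ℤ w)) -ℤ (κ (u -ℤ v +ℤ w) -ℤ κ (u +ℤ v -ℤ w))
          ≡⟨ regroup (κ (u -ℤ v -ℤ w)) (κ (u +ℤ v +ℤ w)) (κ (u -ℤ v +ℤ w)) (κ (u +ℤ v -ℤ w)) ⟩
        (κ (u -ℤ v -ℤ w) -ℤ κ (u -ℤ v +ℤ w)) +ℤ (κ (u +ℤ v -ℤ w) -ℤ κ (u +ℤ v +ℤ w))
          ≡⟨ cong₂ _+ℤ_ (κ-diff (u -ℤ v)) (κ-diff (u +ℤ v)) ⟩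
        (h *ℤ δ m (u -ℤ v) -ℤ ν (u -ℤ v)) +ℤ (h *ℤ δ m (u +ℤ v) -ℤ ν (u +ℤ v)) ∎
        where
        e₁ : ∀ u v w → u -ℤ (v +ℤ w) ≡ u -ℤ v -ℤ w
        e₁ = solve-∀
        e₂ : ∀ u v w → u -ℤ - (v +ℤ w) ≡ u +ℤ v +ℤ w
        e₂ = solve-∀
        e₃ : ∀ u v w → u -ℤ (v -ℤ w) ≡ u -ℤ v +ℤ w
        e₃ = solve-∀
        e₄ : ∀ u v w → u -ℤ - (v -ℤ w) ≡ u +ℤ v -ℤ w
        e₄ = solve-∀
        regroup : ∀ a b c d → (a -ℤ b) -ℤ (c -ℤ d) ≡ (a -ℤ c) +ℤ (d -ℤ b)
        regroup = solve-∀

    p-E : ∀ u r → p u (r ↑ˡ (n + n)) ≡ E r u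
    p-E u r = lookup-++ˡ (pE u) (pA u ++ pB u) r

    p-A : ∀ u i → p u (e ↑ʳ (i ↑ˡ n)) ≡ A (pos i) u
    p-A u i = trans (lookup-++ʳ (pE u) (pA u ++ pB u) (i ↑ˡ n))
      (lookup-++ˡ (pA u) (pB u) i)

    p-B : ∀ u i → p u (e ↑ʳ (n ↑ʳ i)) ≡ B (pos i) u
    p-B u i = trans (lookup-++ʳ (pE u) (pA u ++ pB u) (n ↑ʳ i))
      (lookup-++ʳ (pA u) (pB u) i)

    p-periodic : ∀ k → Periodic m (λ u → p u k)
    p-periodic = ++-elim {e} (λ k → Periodic m (λ u → p u k))
      (λ r u → along (λ u → p-E u r) (E-periodic r) u)
      (++-elim {n} (λ k → Periodic m (λ u → p u (e ↑ʳ k)))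
        (λ i u → along (λ u → p-A u i) (A-periodic (pos i)) u)
        (λ i u → along (λ u → p-B u i) (B-periodic (pos i)) u))
      where
      along : ∀ {F G : ℤ → ℤ} → (∀ u → F u ≡ G u) → Periodic m G → Periodic m F
      along eq per u = trans (eq (u +ℤ + m)) (trans (per u) (sym (eq u)))

    c∘-periodic : ∀ v → Periodic m (λ u → c (u -ℤ v))
    c∘-periodic v = periodic-∘+ c-periodic (- v)

    c-flip : ∀ {u v} → u ≡ - v → c u ≡ c v
    c-flip {v = v} eq = trans (cong c eq) (c-even v)

    D-E : ∀ v r → sumFin e (λ s → eigenvalue r *ℤ I r s *ℤ E s v) ≡ cycSum m (λ u → E r u *ℤ c (u -ℤ v))
    D-E v r = begin
      sumFin e (λ s → eigenvalue r *ℤ I r s *ℤ E s v)    ≡⟨ sumFin-cong {e} (λ s → ℤ.*-assoc (eigenvalue r) (I r s) (E s v)) ⟩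
      sumFin e (λ s → eigenvalue r *ℤ (I r s *ℤ E s v))  ≡⟨ *-sumFin {e} (eigenvalue r) (λ s → I r s *ℤ E s v) ⟨
      eigenvalue r *ℤ sumFin e (λ s → I r s *ℤ E s v)    ≡⟨ cong (eigenvalue r *ℤ_) (I-sum (λ s → E s v) r) ⟩
      eigenvalue r *ℤ E r v                              ≡⟨ E-eigen r v ⟨
      cycSum m (λ u → E r u *ℤ c (u -ℤ v))               ∎

    oddBlock-X : ∀ i j → oddBlock c n i j ≡ c (pos i -ℤ pos j) -ℤ c (pos i -ℤ - pos j)
    oddBlock-X i j = cong (λ t → c (pos i -ℤ pos j) -ℤ c t) (sym (u-[-v] (pos i) (pos j)))

    -- By `fold-A` the combination evaluates to `c (y - v) - c (y + v)`. Evenness of `c` turns the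
    -- second term into `c (- y - v)`, and the difference is the convolution of `A y` with `c`.
    D-A : ∀ v i → sumFin n (λ j → oddBlock c n i j *ℤ A (pos j) v) ≡ cycSum m (λ u → A (pos i) u *ℤ c (u -ℤ v))
    D-A v i = begin
      sumFin n (λ j → oddBlock c n i j *ℤ A (pos j) v)
        ≡⟨ sumFin-cong {n} (λ j → cong (_*ℤ A (pos j) v) (oddBlock-X i j)) ⟩
      sumFin n (λ j → (c (y -ℤ pos j) -ℤ c (y -ℤ - pos j)) *ℤ A (pos j) v)
        ≡⟨ fold-A {λ u → c (y -ℤ u)} (periodic-∘- c-periodic y) v ⟩
      c (y -ℤ v) -ℤ c (y -ℤ - v)
        ≡⟨ cong (λ t → c (y -ℤ v) -ℤ t) (c-flip (e₁ y v)) ⟩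
      c (y -ℤ v) -ℤ c (- y -ℤ v)
        ≡⟨ sum-A (c∘-periodic v) y ⟨
      cycSum m (λ u → c (u -ℤ v) *ℤ A y u)
        ≡⟨ cycSum-cong m (λ u → ℤ.*-comm (c (u -ℤ v)) (A y u)) ⟩
      cycSum m (λ u → A y u *ℤ c (u -ℤ v)) ∎
      where
      y = pos i
      e₁ : ∀ y v → y -ℤ - v ≡ - (- y -ℤ v)
      e₁ = solve-∀

    -- The same matrix acts as in `D-A`, because `B` arises from `A` by a convolution and
    -- convolutions commute.
    D-B : ∀ v i → sumFin n (λ j → oddBlock c n i j *ℤ B (pos j) v) ≡ cycSum m (λ u → B (pos i) u *ℤ c (u -ℤ v))
    D-B v i = begin
      sumFin n (λ j → oddBlock c n i j *ℤ B (pos j) v)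
        ≡⟨ sumFin-cong {n} (λ j → cong (_*ℤ B (pos j) v) (oddBlock-X i j)) ⟩
      sumFin n (λ j → (c (y -ℤ pos j) -ℤ c (y -ℤ - pos j)) *ℤ B (pos j) v)
        ≡⟨ fold-B {λ u → c (y -ℤ u)} (periodic-∘- c-periodic y) v ⟩
      (c (y -ℤ (v +ℤ w)) -ℤ c (y -ℤ - (v +ℤ w))) -ℤ (c (y -ℤ (v -ℤ w)) -ℤ c (y -ℤ - (v -ℤ w)))
        ≡⟨ cong₂ _-ℤ_ (cong₂ _-ℤ_ (cong c (e₁ y v w)) (c-flip (e₂ y v w))) (cong₂ _-ℤ_ (cong c (e₃ y v w)) (c-flip (e₄ y v w))) ⟩
      (c (y -ℤ w -ℤ v) -ℤ c (- (y +ℤ w) -ℤ v)) -ℤ (c (y +ℤ w -ℤ v) -ℤ c (- (y -ℤ w) -ℤ v))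
        ≡⟨ regroup (c (y -ℤ w -ℤ v)) (c (- (y +ℤ w) -ℤ v)) (c (y +ℤ w -ℤ v)) (c (- (y -ℤ w) -ℤ v)) ⟩
      (c (y -ℤ w -ℤ v) -ℤ c (y +ℤ w -ℤ v)) +ℤ (c (- (y -ℤ w) -ℤ v) -ℤ c (- (y +ℤ w) -ℤ v))
        ≡⟨ sum-B (c∘-periodic v) y ⟨
      cycSum m (λ u → c (u -ℤ v) *ℤ B y u)
        ≡⟨ cycSum-cong m (λ u → ℤ.*-comm (c (u -ℤ v)) (B y u)) ⟩
      cycSum m (λ u → B y u *ℤ c (u -ℤ v)) ∎
      where
      y = pos i
      e₁ : ∀ y v w → y -ℤ (v +ℤ w) ≡ y -ℤ w -ℤ v
      e₁ = solve-∀
      e₂ : ∀ y v w → y -ℤ - (v +ℤ w) ≡ - (- (y +ℤ w) -ℤ v)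
      e₂ = solve-∀
      e₃ : ∀ y v w → y -ℤ (v -ℤ w) ≡ y +ℤ w -ℤ v
      e₃ = solve-∀
      e₄ : ∀ y v w → y -ℤ - (v -ℤ w) ≡ - (- (y -ℤ w) -ℤ v)
      e₄ = solve-∀
      regroup : ∀ a b c d → (a -ℤ b) -ℤ (c -ℤ d) ≡ (a -ℤ c) +ℤ (d -ℤ b)
      regroup = solve-∀

    -- Row `k` of `P` lists a function on ℤ/m along `x`. Multiplication by `C` convolves it with
    -- `c`, and `sum-x` makes the order of the `x i` irrelevant.
    PC≡DP : P ⊗ C ≗₂ D ⊗ P
    PC≡DP k j = begin
      sumFin (e + (n + n)) (λ i → p (x i) k *ℤ c (x i -ℤ v))
        ≡⟨ sum-x (λ u → p u k *ℤ c (u -ℤ v)) (periodic-* {F = λ u → p u k} {λ u → c (u -ℤ v)} (p-periodic k) (c∘-periodic v)) ⟩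
      cycSum m (λ u → p u k *ℤ c (u -ℤ v))
        ≡⟨ blocks k ⟩
      (DE ++ D′) k
        ≡⟨ ⊕-apply (λ r s → eigenvalue r *ℤ I r s) (oddBlock c n ⊕ oddBlock c n) (pE v) pO k ⟨
      sumFin (e + (n + n)) (λ l → D k l *ℤ p v l) ∎
      where
      v = x j
      pO = pA v ++ pB v
      DE : Fin e → ℤ
      DE = λ r → sumFin e (λ s → eigenvalue r *ℤ I r s *ℤ E s v)
      D′ : Fin (n + n) → ℤ
      D′ = λ k → sumFin (n + n) (λ l → (oddBlock c n ⊕ oddBlock c n) k l *ℤ pO l)
      DA DB : Fin n → ℤ
      DA = λ i → sumFin n (λ l → oddBlock c n i l *ℤ A (pos l) v)
      DB = λ i → sumFin n (λ l → oddBlock c n i l *ℤ B (pos l) v)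
      blocks : ∀ k → cycSum m (λ u → p u k *ℤ c (u -ℤ v)) ≡ (DE ++ D′) k
      blocks = ++-elim {e} (λ k → cycSum m (λ u → p u k *ℤ c (u -ℤ v)) ≡ (DE ++ D′) k)
        (λ r → begin
          cycSum m (λ u → p u (r ↑ˡ (n + n)) *ℤ c (u -ℤ v)) ≡⟨ cycSum-cong m (λ u → cong (_*ℤ c (u -ℤ v)) (p-E u r)) ⟩
          cycSum m (λ u → E r u *ℤ c (u -ℤ v))              ≡⟨ D-E v r ⟨
          DE r                                              ≡⟨ lookup-++ˡ DE D′ r ⟨
          (DE ++ D′) (r ↑ˡ (n + n))                         ∎)
        (λ k → begin
          cycSum m (λ u → p u (e ↑ʳ k) *ℤ c (u -ℤ v))       ≡⟨ oddBlocks k ⟩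
          (DA ++ DB) k                                      ≡⟨ ⊕-apply (oddBlock c n) (oddBlock c n) (pA v) (pB v) k ⟨
          D′ k                                              ≡⟨ lookup-++ʳ DE D′ k ⟨
          (DE ++ D′) (e ↑ʳ k)                               ∎)
        where
        oddBlocks : ∀ k → cycSum m (λ u → p u (e ↑ʳ k) *ℤ c (u -ℤ v)) ≡ (DA ++ DB) k
        oddBlocks = ++-elim {n} (λ k → cycSum m (λ u → p u (e ↑ʳ k) *ℤ c (u -ℤ v)) ≡ (DA ++ DB) k)
          (λ i → begin
            cycSum m (λ u → p u (e ↑ʳ (i ↑ˡ n)) *ℤ c (u -ℤ v)) ≡⟨ cycSum-cong m (λ u → cong (_*ℤ c (u -ℤ v)) (p-A u i)) ⟩
            cycSum m (λ u → A (pos i) u *ℤ c (u -ℤ v))         ≡⟨ D-A v i ⟨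
            DA i                                               ≡⟨ lookup-++ˡ DA DB i ⟨
            (DA ++ DB) (i ↑ˡ n)                                ∎)
          (λ i → begin
            cycSum m (λ u → p u (e ↑ʳ (n ↑ʳ i)) *ℤ c (u -ℤ v)) ≡⟨ cycSum-cong m (λ u → cong (_*ℤ c (u -ℤ v)) (p-B u i)) ⟩
            cycSum m (λ u → B (pos i) u *ℤ c (u -ℤ v))         ≡⟨ D-B v i ⟨
            DB i                                               ≡⟨ lookup-++ʳ DA DB i ⟨
            (DA ++ DB) (n ↑ʳ i)                                ∎)

  det-evenCirculant : det (e + (n + n)) (λ i j → c (x i -ℤ x j)) ≡
    det e (λ r s → eigenvalue r *ℤ I r s) *ℤ (det n (oddBlock c n) *ℤ det n (oddBlock c n))
  det-evenCirculant = begin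
    det (e + (n + n)) C
      ≡⟨ det-intertwine (e + (n + n)) P Q C D (+ 2 *ℤ h) 2h≢0 QP≡2h PC≡DP ⟩
    det (e + (n + n)) D
      ≡⟨ det-⊕ (λ r s → eigenvalue r *ℤ I r s) (oddBlock c n ⊕ oddBlock c n) ⟩
    det e (λ r s → eigenvalue r *ℤ I r s) *ℤ det (n + n) (oddBlock c n ⊕ oddBlock c n)
      ≡⟨ cong (det e (λ r s → eigenvalue r *ℤ I r s) *ℤ_) (det-⊕ (oddBlock c n) (oddBlock c n)) ⟩
    det e (λ r s → eigenvalue r *ℤ I r s) *ℤ (det n (oddBlock c n) *ℤ det n (oddBlock c n)) ∎
    where
    2h≢0 : + 2 *ℤ h ≢ + 0
    2h≢0 eq = h≢0 (ℤ.*-cancelˡ-≡ (+ 2) h (+ 0) eq)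

-- Residues

∣-resp : ∀ {m u v} → u ≡ v → + m ∣ℤ u → + m ∣ℤ v
∣-resp refl d = d

<⇒residue-unique : ∀ {m} a b → a < m → b < m → + m ∣ℤ + a -ℤ + b → a ≡ b
<⇒residue-unique {m} a b a<m b<m d with ∣ + a -ℤ + b ∣ in eq | ∣⇒∣ᵤ d
... | zero  | _  = ℤ.+-injective (ℤ.i-j≡0⇒i≡j (+ a) (+ b) (ℤ.∣i∣≡0⇒i≡0 eq))
... | suc k | d′ with () ← ℕ∣.>⇒∤ (ℕ.≤-<-trans
  (subst (_≤ a ⊔ b) (trans (cong ∣_∣ (sym (ℤ.m-n≡m⊖n a b))) eq) (ℤ.∣m⊝n∣≤m⊔n a b)) (ℕ.⊔-pres-<m a<m b<m)) d′

∣-residue : ∀ m .{{_ : NonZero m}} u → + m ∣ℤ u -ℤ + (u %ℕ m)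
∣-residue m u = divides (u /ℕ m) (trans (cong (_-ℤ + (u %ℕ m)) (a≡a%ℕn+[a/ℕn]*n u m)) (cancel (+ (u %ℕ m)) (u /ℕ m *ℤ + m)))
  where
  cancel : ∀ r q → r +ℤ q -ℤ r ≡ q
  cancel = solve-∀

residue-unique : ∀ {m} .{{_ : NonZero m}} u r → r < m → + m ∣ℤ u -ℤ + r → u %ℕ m ≡ r
residue-unique {m} u r r<m d = <⇒residue-unique (u %ℕ m) r (n%ℕd<d u m) r<m
  (∣-resp (telescope u (+ r) (+ (u %ℕ m))) (∣m∣n⇒∣m-n d (∣-residue m u)))
  where
  telescope : ∀ u r s → u -ℤ r -ℤ (u -ℤ s) ≡ s -ℤ r
  telescope = solve-∀

residue-cong : ∀ {m} .{{_ : NonZero m}} u v → + m ∣ℤ u -ℤ v → u %ℕ m ≡ v %ℕ m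
residue-cong {m} u v d = residue-unique u (v %ℕ m) (n%ℕd<d v m)
  (∣-resp (telescope u v (+ (v %ℕ m))) (∣m∣n⇒∣m+n d (∣-residue m v)))
  where
  telescope : ∀ u v s → u -ℤ v +ℤ (v -ℤ s) ≡ u -ℤ s
  telescope = solve-∀

ρ : (m : ℕ) .{{_ : NonZero m}} → ℤ → ℤ
ρ m u = + (u %ℕ m)

ρ-periodic : ∀ m .{{_ : NonZero m}} → Periodic m (ρ m)
ρ-periodic m u = cong +_ (residue-cong (u +ℤ + m) u (∣-resp (cancel u (+ m)) ∣-refl))
  where
  cancel : ∀ u m → m ≡ u +ℤ m -ℤ u
  cancel = solve-∀

-- The sawtooth `ρ` rises by 1 at each step and falls by `m - 1` on reaching a multiple of `m`. Up
-- to a constant it is a discrete antiderivative of `δ m`, which is what both choices of `κ` are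
-- made of.
ρ-step : ∀ m .{{_ : NonZero m}} u → ρ m (u -ℤ + 1) -ℤ ρ m u ≡ + m *ℤ δ m u -ℤ + 1
ρ-step m@(suc n) u with u %ℕ m in eq
... | zero = begin
  ρ m (u -ℤ + 1) -ℤ + 0 ≡⟨ cong (λ r → + r -ℤ + 0) (residue-unique (u -ℤ + 1) n (ℕ.n<1+n n) (∣-resp (shift u (+ n)) (∣m∣n⇒∣m-n m∣u ∣-refl))) ⟩
  + n -ℤ + 0            ≡⟨ lem (+ n) ⟩
  + m *ℤ + 1 -ℤ + 1     ≡⟨ cong (λ x → + m *ℤ x -ℤ + 1) (δ-yes m∣u) ⟨
  + m *ℤ δ m u -ℤ + 1   ∎
  where
  m∣u : + m ∣ℤ u
  m∣u = ∣-resp (ℤ.+-identityʳ u) (subst (λ r → + m ∣ℤ u -ℤ + r) eq (∣-residue m u))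
  shift : ∀ u n → u -ℤ (+ 1 +ℤ n) ≡ u -ℤ + 1 -ℤ n
  shift = solve-∀
  lem : ∀ n → n -ℤ + 0 ≡ (+ 1 +ℤ n) *ℤ + 1 -ℤ + 1
  lem = solve-∀
... | suc r = begin
  ρ m (u -ℤ + 1) -ℤ + suc r ≡⟨ cong (λ s → + s -ℤ + suc r) (residue-unique (u -ℤ + 1) r (ℕ.<-trans (ℕ.n<1+n r) 1+r<m) (∣-resp (shift u (+ r)) m∣u-r)) ⟩
  + r -ℤ + suc r            ≡⟨ lem (+ r) (+ m) ⟩
  + m *ℤ + 0 -ℤ + 1         ≡⟨ cong (λ x → + m *ℤ x -ℤ + 1) (δ-no m∤u) ⟨
  + m *ℤ δ m u -ℤ + 1       ∎
  where
  1+r<m : suc r < m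
  1+r<m = subst (_< m) eq (n%ℕd<d u m)
  m∣u-r : + m ∣ℤ u -ℤ + suc r
  m∣u-r = subst (λ r → + m ∣ℤ u -ℤ + r) eq (∣-residue m u)
  m∤u : ¬ (+ m ∣ℤ u)
  m∤u d with () ← trans (sym eq) (residue-unique u 0 (s≤s z≤n) (∣-resp (sym (ℤ.+-identityʳ u)) d))
  shift : ∀ u r → u -ℤ (+ 1 +ℤ r) ≡ u -ℤ + 1 -ℤ r
  shift = solve-∀
  lem : ∀ r m → r -ℤ (+ 1 +ℤ r) ≡ m *ℤ + 0 -ℤ + 1
  lem = solve-∀

-- The parity character

σ : ℤ → ℤ
σ u = + 2 *ℤ δ 2 u -ℤ + 1

-- One of two consecutive integers is even: this is `cycSum-δ` modulo 2 for the constant function 1.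
δ₂-suc : ∀ u → δ 2 (u +ℤ + 1) ≡ + 1 -ℤ δ 2 u
δ₂-suc u = trans (isolate (δ 2 u) (δ 2 (u +ℤ + 1))) (cong (_-ℤ δ 2 u) (trans
  (cong₂ (λ s t → + 1 *ℤ δ 2 s +ℤ (+ 1 *ℤ δ 2 t +ℤ + 0)) (e₀ u) (e₁ u))
  (cycSum-δ 2 {const (+ 1)} (λ _ → refl) (- u))))
  where
  isolate : ∀ a b → b ≡ (+ 1 *ℤ a +ℤ (+ 1 *ℤ b +ℤ + 0)) -ℤ a
  isolate = solve-∀
  e₀ : ∀ u → u ≡ + 0 -ℤ - u
  e₀ = solve-∀
  e₁ : ∀ u → u +ℤ + 1 ≡ + 1 -ℤ - u
  e₁ = solve-∀

σ-suc : ∀ u → σ (u +ℤ + 1) ≡ - σ u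
σ-suc u = trans (cong (λ x → + 2 *ℤ x -ℤ + 1) (δ₂-suc u)) (lem (δ 2 u))
  where
  lem : ∀ d → + 2 *ℤ (+ 1 -ℤ d) -ℤ + 1 ≡ - (+ 2 *ℤ d -ℤ + 1)
  lem = solve-∀

σ-pred : ∀ u → σ (u -ℤ + 1) ≡ - σ u
σ-pred u = trans (sym (ℤ.neg-involutive _)) (cong -_ (trans (sym (σ-suc (u -ℤ + 1))) (cong σ (lem u))))
  where
  lem : ∀ u → u -ℤ + 1 +ℤ + 1 ≡ u
  lem = solve-∀

σ-yes : ∀ {u} → + 2 ∣ℤ u → σ u ≡ + 1
σ-yes d = cong (λ x → + 2 *ℤ x -ℤ + 1) (δ-yes d)

σ-no : ∀ {u} → ¬ (+ 2 ∣ℤ u) → σ u ≡ - + 1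
σ-no ¬d = cong (λ x → + 2 *ℤ x -ℤ + 1) (δ-no ¬d)

σ-+even : ∀ u {v} → + 2 ∣ℤ v → σ (u +ℤ v) ≡ σ u
σ-+even u {v} d = cong (λ x → + 2 *ℤ x -ℤ + 1) (δ-cong {2} {2} {u +ℤ v} {u} (λ e → ∣m+n∣n⇒∣m {m = u} e d) (λ e → ∣m∣n⇒∣m+n e d))

2∣-suc : ∀ u → ¬ (+ 2 ∣ℤ u) → + 2 ∣ℤ u +ℤ + 1
2∣-suc u ¬d with + 2 ∣ℤ? (u +ℤ + 1)
... | yes d  = d
... | no ¬d′ with () ← trans (sym (δ-no ¬d′)) (trans (δ₂-suc u) (cong (λ x → + 1 -ℤ x) (δ-no ¬d)))

σ-* : ∀ u v → σ (u +ℤ v) ≡ σ u *ℤ σ v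
σ-* u v with + 2 ∣ℤ? v
... | yes d = begin
  σ (u +ℤ v)      ≡⟨ σ-+even u d ⟩
  σ u             ≡⟨ ℤ.*-identityʳ (σ u) ⟨
  σ u *ℤ + 1      ≡⟨ cong (σ u *ℤ_) (σ-yes d) ⟨
  σ u *ℤ σ v      ∎
... | no ¬d = begin
  σ (u +ℤ v)               ≡⟨ ℤ.neg-involutive _ ⟨
  - - σ (u +ℤ v)           ≡⟨ cong -_ (σ-suc (u +ℤ v)) ⟨
  - σ (u +ℤ v +ℤ + 1)      ≡⟨ cong (-_ ∘ σ) (ℤ.+-assoc u v (+ 1)) ⟩
  - σ (u +ℤ (v +ℤ + 1))    ≡⟨ cong -_ (σ-+even u (2∣-suc v ¬d)) ⟩
  - σ u                    ≡⟨ lem (σ u) ⟩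
  σ u *ℤ (- + 1)           ≡⟨ cong (σ u *ℤ_) (σ-no ¬d) ⟨
  σ u *ℤ σ v               ∎
  where
  lem : ∀ s → - s ≡ s *ℤ (- + 1)
  lem = solve-∀

σ-even : ∀ u → σ (- u) ≡ σ u
σ-even u = cong (λ x → + 2 *ℤ x -ℤ + 1) (δ-even 2 u)

σ-periodic : ∀ {m} → + 2 ∣ℤ + m → Periodic m σ
σ-periodic d u = σ-+even u d

-- Doubling is invertible modulo 1 + 2n, with inverse w.
splitting-odd : ∀ n → Splitting (1 + (n + n)) 1 n (λ _ _ → + 1)
splitting-odd n = record
  { foldable   = foldable-odd n
  ; E-periodic = λ _ _ → refl
  ; E′         = λ _ _ → + 2
  -- The step from `u - w` to `u + w` has length `2 w = m + 1`. The shift by `w - 1` makes it the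
  -- step from `u - 1` to `u + m`, so that `ρ-step` applies.
  ; κ          = λ v → ρ m (v +ℤ (w -ℤ + 1))
  ; ν          = λ _ → + 1
  ; w          = w
  ; h          = + m
  ; h≢0        = λ ()
  ; κ-periodic = periodic-∘+ (ρ-periodic m) (w -ℤ + 1)
  ; κ-diff     = λ u → trans
      (cong₂ _-ℤ_ (cong (ρ m) (e₁ u w)) (trans (cong (ρ m) (e₂ u (+ n))) (ρ-periodic m u)))
      (ρ-step m u)
  ; E-ν        = λ _ _ → refl
  }
  where
  m = 1 + (n + n)
  w = + suc n
  e₁ : ∀ u w → u -ℤ w +ℤ (w -ℤ + 1) ≡ u -ℤ + 1
  e₁ = solve-∀
  e₂ : ∀ u n → u +ℤ (+ 1 +ℤ n) +ℤ ((+ 1 +ℤ n) -ℤ + 1) ≡ u +ℤ (+ 1 +ℤ (n +ℤ n))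
  e₂ = solve-∀

evenCharacters : Fin 2 → ℤ → ℤ
evenCharacters fzero    = const (+ 1)
evenCharacters (fsuc _) = σ

2∣2+n+n : ∀ n → + 2 ∣ℤ + (2 + (n + n))
2∣2+n+n n = divides (+ suc n) (lem (+ n))
  where
  lem : ∀ n → + 2 +ℤ (n +ℤ n) ≡ (+ 1 +ℤ n) *ℤ + 2
  lem = solve-∀

-- Multiplication with 1 - σ extracts the odd residues, on which steps by 2 act transitively.
splitting-even : ∀ n → Splitting (2 + (n + n)) 2 n evenCharacters
splitting-even n = record
  { foldable   = foldable-even n
  ; E-periodic = λ { fzero _ → refl ; (fsuc _) → σ-periodic (2∣2+n+n n) }
  -- The factor 4 comes from `ν (u - v) + ν (u + v) = 4 (1 + σ u σ v)`, as `σ` is multiplicative and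
  -- even.
  ; E′         = λ r u → + 4 *ℤ evenCharacters r u
  ; κ          = λ u → (+ 1 -ℤ σ u) *ℤ ρ m u
  ; ν          = λ u → + 2 *ℤ (+ 1 +ℤ σ u)
  ; w          = + 1
  ; h          = + 2 *ℤ + m
  ; h≢0        = λ ()
  ; κ-periodic = λ u → cong₂ (λ s t → (+ 1 -ℤ s) *ℤ t) (σ-periodic (2∣2+n+n n) u) (ρ-periodic m u)
  ; κ-diff     = κ-diff
  ; E-ν        = λ u v → sym (trans
      (cong₂ (λ s t → + 2 *ℤ (+ 1 +ℤ s) +ℤ + 2 *ℤ (+ 1 +ℤ t)) (trans (σ-* u (- v)) (cong (σ u *ℤ_) (σ-even v))) (σ-* u v))
      (expand (σ u) (σ v)))
  }
  where
  m = 2 + (n + n)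
  expand : ∀ a b → + 2 *ℤ (+ 1 +ℤ a *ℤ b) +ℤ + 2 *ℤ (+ 1 +ℤ a *ℤ b) ≡ + 4 *ℤ + 1 *ℤ + 1 +ℤ (+ 4 *ℤ a *ℤ b +ℤ + 0)
  expand = solve-∀
  -- As `m` is even, `δ m` lives on even integers. In `κ-diff` this doubles the term with `δ m u`,
  -- and it removes the one with `δ m (u + 1)`, whose coefficient `1 + σ u` is 0 for odd `u`.
  σ-δ : ∀ u → σ u *ℤ δ m u ≡ δ m u
  σ-δ u with + m ∣ℤ? u
  ... | yes d = trans (cong (_*ℤ δ m u) (σ-yes (∣-trans (2∣2+n+n n) d))) (ℤ.*-identityˡ (δ m u))
  ... | no ¬d = trans (cong (σ u *ℤ_) (δ-no ¬d)) (trans (ℤ.*-zeroʳ (σ u)) (sym (δ-no ¬d)))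
  κ-diff : ∀ u → (+ 1 -ℤ σ (u -ℤ + 1)) *ℤ ρ m (u -ℤ + 1) -ℤ (+ 1 -ℤ σ (u +ℤ + 1)) *ℤ ρ m (u +ℤ + 1) ≡
    + 2 *ℤ + m *ℤ δ m u -ℤ + 2 *ℤ (+ 1 +ℤ σ u)
  κ-diff u = begin
    (+ 1 -ℤ σ (u -ℤ + 1)) *ℤ ρ m (u -ℤ + 1) -ℤ (+ 1 -ℤ σ (u +ℤ + 1)) *ℤ ρ m (u +ℤ + 1)
      ≡⟨ cong₂ (λ s t → (+ 1 -ℤ s) *ℤ ρ m (u -ℤ + 1) -ℤ (+ 1 -ℤ t) *ℤ ρ m (u +ℤ + 1)) (σ-pred u) (σ-suc u) ⟩
    (+ 1 -ℤ - σ u) *ℤ ρ m (u -ℤ + 1) -ℤ (+ 1 -ℤ - σ u) *ℤ ρ m (u +ℤ + 1)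
      ≡⟨ telescope (σ u) (ρ m (u -ℤ + 1)) (ρ m u) (ρ m (u +ℤ + 1)) ⟩
    (+ 1 +ℤ σ u) *ℤ ((ρ m (u -ℤ + 1) -ℤ ρ m u) +ℤ (ρ m u -ℤ ρ m (u +ℤ + 1)))
      ≡⟨ cong₂ (λ s t → (+ 1 +ℤ σ u) *ℤ (s +ℤ t)) (ρ-step m u) (trans (cong (λ t → ρ m t -ℤ ρ m (u +ℤ + 1)) (pred-suc u)) (ρ-step m (u +ℤ + 1))) ⟩
    (+ 1 +ℤ σ u) *ℤ ((+ m *ℤ δ m u -ℤ + 1) +ℤ (+ m *ℤ δ m (u +ℤ + 1) -ℤ + 1))
      ≡⟨ separate (σ u) (+ m) (δ m u) (δ m (u +ℤ + 1)) ⟩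
    + m *ℤ (δ m u +ℤ σ u *ℤ δ m u) +ℤ + m *ℤ (δ m (u +ℤ + 1) -ℤ - σ u *ℤ δ m (u +ℤ + 1)) -ℤ + 2 *ℤ (+ 1 +ℤ σ u)
      ≡⟨ cong₂ (λ s t → + m *ℤ (δ m u +ℤ s) +ℤ + m *ℤ (δ m (u +ℤ + 1) -ℤ t) -ℤ + 2 *ℤ (+ 1 +ℤ σ u)) (σ-δ u)
           (trans (cong (_*ℤ δ m (u +ℤ + 1)) (sym (σ-suc u))) (σ-δ (u +ℤ + 1))) ⟩
    + m *ℤ (δ m u +ℤ δ m u) +ℤ + m *ℤ (δ m (u +ℤ + 1) -ℤ δ m (u +ℤ + 1)) -ℤ + 2 *ℤ (+ 1 +ℤ σ u)
      ≡⟨ cancel (+ m) (δ m u) (δ m (u +ℤ + 1)) (σ u) ⟩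
    + 2 *ℤ + m *ℤ δ m u -ℤ + 2 *ℤ (+ 1 +ℤ σ u) ∎
    where
    pred-suc : ∀ u → u ≡ u +ℤ + 1 -ℤ + 1
    pred-suc = solve-∀
    telescope : ∀ s a b c → (+ 1 -ℤ - s) *ℤ a -ℤ (+ 1 -ℤ - s) *ℤ c ≡ (+ 1 +ℤ s) *ℤ ((a -ℤ b) +ℤ (b -ℤ c))
    telescope = solve-∀
    separate : ∀ s m d d′ → (+ 1 +ℤ s) *ℤ ((m *ℤ d -ℤ + 1) +ℤ (m *ℤ d′ -ℤ + 1)) ≡
      m *ℤ (d +ℤ s *ℤ d) +ℤ m *ℤ (d′ -ℤ - s *ℤ d′) -ℤ + 2 *ℤ (+ 1 +ℤ s)
    separate = solve-∀
    cancel : ∀ m d d′ s → m *ℤ (d +ℤ d) +ℤ m *ℤ (d′ -ℤ d′) -ℤ + 2 *ℤ (+ 1 +ℤ s) ≡ + 2 *ℤ m *ℤ d -ℤ + 2 *ℤ (+ 1 +ℤ s)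
    cancel = solve-∀

-- Determinants of even circulants up to a square

character-eigen : ∀ m {E c : ℤ → ℤ} → Periodic m E → Periodic m c → (∀ u v → E (u +ℤ v) ≡ E u *ℤ E v) → ∀ v →
  cycSum m (λ u → E u *ℤ c (u -ℤ v)) ≡ cycSum m (λ u → E u *ℤ c u) *ℤ E v
character-eigen m {E} {c} perE perc hom v = begin
  cycSum m (λ u → E u *ℤ c (u -ℤ v))               ≡⟨ cycSum-shift m (periodic-* {F = E} {λ u → c (u -ℤ v)} perE (periodic-∘+ perc (- v))) v ⟨
  cycSum m (λ u → E (u +ℤ v) *ℤ c (u +ℤ v -ℤ v))   ≡⟨ cycSum-cong m (λ u → trans (cong₂ _*ℤ_ (hom u v) (cong c (cancel u v))) (swap (E u) (E v) (c u))) ⟩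
  cycSum m (λ u → E u *ℤ c u *ℤ E v)               ≡⟨ sumFin-* {m} (λ i → E (+ toℕ i) *ℤ c (+ toℕ i)) (E v) ⟨
  cycSum m (λ u → E u *ℤ c u) *ℤ E v               ∎
  where
  cancel : ∀ u v → u +ℤ v -ℤ v ≡ u
  cancel = solve-∀
  swap : ∀ a b c → a *ℤ b *ℤ c ≡ a *ℤ c *ℤ b
  swap = solve-∀

-- An enumeration of ℤ/m in arbitrary order. The residues are listed by size and not as powers of a
-- generator; with this notion the rows and columns never have to be rearranged.
record CyclicIndex (m : ℕ) {L} (x : Fin L → ℤ) : Set where
  field
    sum-x : ∀ F → Periodic m F → sumFin L (λ i → F (x i)) ≡ cycSum m F
    δ-x   : ∀ i j → δ m (x i -ℤ x j) ≡ I i j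

det-odd : ∀ n {L m} {x : Fin L → ℤ} {c} → L ≡ m → m ≡ 1 + (n + n) → CyclicIndex m x →
  Periodic m c → (∀ u → c (- u) ≡ c u) →
  Σ ℤ λ u → det L (λ i j → c (x i -ℤ x j)) ≡ cycSum m c *ℤ (u *ℤ u)
det-odd n {_} {m} {x} {c} refl refl index c-periodic c-even = det n (oddBlock c n) , trans
  (det-evenCirculant (splitting-odd n) {c} c-periodic c-even (const (cycSum m (λ u → + 1 *ℤ c u)))
    (λ _ → character-eigen m {const (+ 1)} {c} (λ _ → refl) c-periodic (λ _ _ → refl)) x sum-x δ-x)
  (cong (_*ℤ (det n (oddBlock c n) *ℤ det n (oddBlock c n))) (trans (lem _) (cycSum-cong m (λ u → ℤ.*-identityˡ (c u)))))
  where
  open CyclicIndex index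
  lem : ∀ a → + 1 *ℤ (a *ℤ + 1) *ℤ + 1 +ℤ + 0 ≡ a
  lem = solve-∀

det-even : ∀ n {L m} {x : Fin L → ℤ} {c} → L ≡ m → m ≡ 2 + (n + n) → CyclicIndex m x →
  Periodic m c → (∀ u → c (- u) ≡ c u) →
  Σ ℤ λ u → det L (λ i j → c (x i -ℤ x j)) ≡ cycSum m c *ℤ cycSum m (λ u → σ u *ℤ c u) *ℤ (u *ℤ u)
det-even n {_} {m} {x} {c} refl refl index c-periodic c-even = det n (oddBlock c n) , trans
  (det-evenCirculant (splitting-even n) {c} c-periodic c-even (λ r → cycSum m (λ u → evenCharacters r u *ℤ c u))
    (λ { fzero → character-eigen m {const (+ 1)} {c} (λ _ → refl) c-periodic (λ _ _ → refl)
       ; (fsuc _) → character-eigen m {σ} {c} (σ-periodic (2∣2+n+n n)) c-periodic σ-* }) x sum-x δ-x)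
  (cong (_*ℤ (det n (oddBlock c n) *ℤ det n (oddBlock c n)))
    (trans (lem (cycSum m (λ u → + 1 *ℤ c u)) (cycSum m (λ u → σ u *ℤ c u))) (cong (_*ℤ cycSum m (λ u → σ u *ℤ c u)) (cycSum-cong m (λ u → ℤ.*-identityˡ (c u))))))
  where
  open CyclicIndex index
  -- The definition of `det` unfolded for the diagonal matrix with entries `a` and `b`.
  lem : ∀ a b → + 1 *ℤ (a *ℤ + 1) *ℤ (+ 1 *ℤ (b *ℤ + 1) *ℤ + 1 +ℤ + 0) +ℤ
    (- + 1 *ℤ + 1 *ℤ (a *ℤ + 0) *ℤ (+ 1 *ℤ (b *ℤ + 0) *ℤ + 1 +ℤ + 0) +ℤ + 0) ≡ a *ℤ b
  lem = solve-∀

-- Primitive roots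

∣∧<⇒≡0 : ∀ {d n} → d ∣ n → n < d → n ≡ 0
∣∧<⇒≡0 {n = zero}  d∣n n<d = refl
∣∧<⇒≡0 {n = suc n} d∣n n<d = contradiction d∣n (ℕ∣.>⇒∤ n<d)

coprime-* : ∀ {a b n} → Coprime a n → Coprime b n → Coprime (a * b) n
coprime-* ca cb (d∣ab , d∣n) = cb (coprime-divisor (λ (e∣d , e∣a) → ca (e∣a , ℕ∣.∣-trans e∣d d∣n)) d∣ab , d∣n)

coprime-^ : ∀ {a n} k → Coprime a n → Coprime (a ^ k) n
coprime-^ zero    c = Coprime.1-coprimeTo _
coprime-^ (suc k) c = coprime-* c (coprime-^ k c)

prime∤⇒coprime : ∀ {q n} → Prime q → ¬ (q ∣ n) → Coprime q n
prime∤⇒coprime pr q∤n (d∣q , d∣n) with prime⇒irreducible pr d∣q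
... | inj₁ d≡1  = d≡1
... | inj₂ refl = contradiction d∣n q∤n

coprime-∣-* : ∀ {a b n} → Coprime a b → a ∣ n → b ∣ n → a * b ∣ n
coprime-∣-* {a} {b} c a∣n (ℕ∣.divides q refl) =
  ℕ∣.*-monoˡ-∣ b (coprime-divisor c (subst (a ∣_) (ℕ.*-comm q b) a∣n))

primeDivisor : ∀ n → .{{NonZero n}} → n ≢ 1 → Σ ℕ λ q → Prime q × q ∣ n
primeDivisor n n≢1 with factorise n
... | record { factors = []     ; isFactorisation = n≡1 } = contradiction n≡1 n≢1
... | record { factors = q ∷ qs ; isFactorisation = refl ; factorsPrime = pr ∷ _ } = q , pr , ℕ∣.m∣m*n _

removeFactors : ∀ q → Prime q → ∀ s → .{{NonZero s}} → Σ ℕ λ f → Σ ℕ λ r → s ≡ q ^ f * r × ¬ (q ∣ r)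
removeFactors q pr s {{s≢0}} = <-rec P step s (ℕB.>-nonZero⁻¹ s)
  where
  instance
    _ = prime⇒nonTrivial pr
    _ = prime⇒nonZero pr
  P : ℕ → Set
  P s = 0 < s → Σ ℕ λ f → Σ ℕ λ r → s ≡ q ^ f * r × ¬ (q ∣ r)
  step : ∀ s → (∀ {t} → t < s → P t) → P s
  step s rec s>0 with q ℕ∣.∣? s
  ... | no q∤s = 0 , s , sym (ℕ.*-identityˡ s) , q∤s
  ... | yes (ℕ∣.divides t refl) with rec (ℕ.m<m*n t q {{t≢0}} (ℕB.nonTrivial⇒n>1 q)) (ℕB.>-nonZero⁻¹ t {{t≢0}})
    where t≢0 = ℕ.m*n≢0⇒m≢0 t {{ℕB.>-nonZero s>0}}
  ...   | f , r , refl , q∤r = suc f , r , trans (ℕ.*-comm (q ^ f * r) q) (sym (ℕ.*-assoc q (q ^ f) r)) , q∤r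

-- A prime whose exponent in `t` exceeds its exponent `f` in `s`.
record HigherPrimePower (s t : ℕ) : Set where
  field
    q f r t′ : ℕ
    q-prime  : Prime q
    s≡       : s ≡ q ^ f * r
    q∤r      : ¬ (q ∣ r)
    t≡       : t ≡ t′ * q ^ suc f

-- Let `d` be the gcd and `q` a prime divisor of `t / d`, which is not 1 because `t` does not divide
-- `s`. Then `q` does not divide `s / d`, so the whole power `q ^ f` in `s` divides `d`, and `t` has
-- one more factor `q`.
higherPrimePower : ∀ s t → .{{NonZero s}} → .{{NonZero t}} → ¬ (t ∣ s) → HigherPrimePower s t
higherPrimePower s t {{s≢0}} {{t≢0}} t∤s = build (primeDivisor t/d t/d≢1)
  where
  d = gcd s t
  instance
    d≢0 : NonZero d
    d≢0 = ℕB.≢-nonZero (gcd[m,n]≢0 s t (inj₁ (ℕB.≢-nonZero⁻¹ s)))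
  s/d = s / d
  t/d = t / d
  s/d*d≡s : s/d * d ≡ s
  s/d*d≡s = ℕ÷.m/n*n≡m (gcd[m,n]∣m s t)
  t/d*d≡t : t/d * d ≡ t
  t/d*d≡t = ℕ÷.m/n*n≡m (gcd[m,n]∣n s t)
  instance
    t/d≢0 : NonZero t/d
    t/d≢0 = ℕ.m*n≢0⇒m≢0 t/d {{subst NonZero (sym t/d*d≡t) t≢0}}
  t/d≢1 : t/d ≢ 1
  t/d≢1 eq = t∤s (subst (_∣ s) (trans (sym (ℕ.*-identityˡ d)) (trans (cong (_* d) (sym eq)) t/d*d≡t)) (gcd[m,n]∣m s t))
  build : (Σ ℕ λ q → Prime q × q ∣ t/d) → HigherPrimePower s t
  build (q , pr , q∣t/d) = finish (removeFactors q pr s)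
    where
    q∤s/d : ¬ (q ∣ s/d)
    q∤s/d q∣s/d = ¬prime[1] (subst Prime (coprime-/gcd s t (q∣s/d , q∣t/d)) pr)
    finish : (Σ ℕ λ f → Σ ℕ λ r → s ≡ q ^ f * r × ¬ (q ∣ r)) → HigherPrimePower s t
    finish (f , r , s≡ , q∤r) = record
      { q = q ; f = f ; r = r ; q-prime = pr ; s≡ = s≡ ; q∤r = q∤r
      ; t′ = ℕ∣.quotient qᶠ⁺¹∣t ; t≡ = ℕ∣._∣_.equality qᶠ⁺¹∣t }
      where
      qᶠ∣d : q ^ f ∣ d
      qᶠ∣d = coprime-divisor (coprime-^ f (prime∤⇒coprime pr q∤s/d)) (subst (q ^ f ∣_) (sym (trans s/d*d≡s s≡)) (ℕ∣.m∣m*n r))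
      qᶠ⁺¹∣t : q ^ suc f ∣ t
      qᶠ⁺¹∣t = subst (q ^ suc f ∣_) t/d*d≡t (ℕ∣.*-pres-∣ q∣t/d qᶠ∣d)

infix 4 _≈_[mod_]
-- A record, so that `x` and `y` can be read off from the type; the difference `+ x -ℤ + y` alone
-- does not determine them.
record _≈_[mod_] (x y p : ℕ) : Set where
  constructor congruent
  field difference : + p ∣ℤ + x -ℤ + y

-- Monic polynomials, given by their lower coefficients with the constant term first

eval : ∀ {n} → Vec ℤ n → ℤ → ℤ
eval []       x = + 1
eval (a ∷ as) x = a +ℤ x *ℤ eval as x

-- Horner's scheme: the coefficients of the quotient are the values at `b` of the successive tails
-- of `f`.
divideByRoot : ∀ {n} (f : Vec ℤ (suc n)) b →
  Σ (Vec ℤ n) λ g → ∀ x → eval f x -ℤ eval f b ≡ (x -ℤ b) *ℤ eval g x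
divideByRoot (a ∷ []) b = [] , λ x → linear a x b
  where
  linear : ∀ a x b → (a +ℤ x *ℤ + 1) -ℤ (a +ℤ b *ℤ + 1) ≡ (x -ℤ b) *ℤ + 1
  linear = solve-∀
divideByRoot (a ∷ f@(_ ∷ _)) b with divideByRoot f b
... | g , factor = (eval f b ∷ g) , λ x → begin
  (a +ℤ x *ℤ eval f x) -ℤ (a +ℤ b *ℤ eval f b)           ≡⟨ regroup a x b (eval f x) (eval f b) ⟩
  x *ℤ (eval f x -ℤ eval f b) +ℤ (x -ℤ b) *ℤ eval f b    ≡⟨ cong (λ t → x *ℤ t +ℤ (x -ℤ b) *ℤ eval f b) (factor x) ⟩
  x *ℤ ((x -ℤ b) *ℤ eval g x) +ℤ (x -ℤ b) *ℤ eval f b    ≡⟨ collect x (x -ℤ b) (eval g x) (eval f b) ⟩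
  (x -ℤ b) *ℤ (eval f b +ℤ x *ℤ eval g x)                ∎
  where
  regroup : ∀ a x b s t → (a +ℤ x *ℤ s) -ℤ (a +ℤ b *ℤ t) ≡ x *ℤ (s -ℤ t) +ℤ (x -ℤ b) *ℤ t
  regroup = solve-∀
  collect : ∀ x d g t → x *ℤ (d *ℤ g) +ℤ d *ℤ t ≡ d *ℤ (t +ℤ x *ℤ g)
  collect = solve-∀

eval-replicate-0 : ∀ n x → eval (replicate n (+ 0)) x ≡ x ^ℤ n
eval-replicate-0 zero    x = refl
eval-replicate-0 (suc n) x = trans (ℤ.+-identityˡ _) (cong (x *ℤ_) (eval-replicate-0 n x))

pos-^ : ∀ x n → + (x ^ n) ≡ (+ x) ^ℤ n
pos-^ x zero    = refl
pos-^ x (suc n) = trans (ℤ.pos-* x (x ^ n)) (cong (+ x *ℤ_) (pos-^ x n))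

-- Calculation with congruences

module _ {p : ℕ} .{{_ : NonZero p}} where

  infix 4 _≈_
  _≈_ : ℕ → ℕ → Set
  x ≈ y = x ≈ y [mod p ]

  ≈-reflexive : ∀ {x y} → x ≡ y → x ≈ y
  ≈-reflexive {x} refl = congruent (subst (+ p ∣ℤ_) (sym (ℤ.+-inverseʳ (+ x))) (∣ᵤ⇒∣ (p ℕ∣.∣0)))

  ≈-sym : ∀ {x y} → x ≈ y → y ≈ x
  ≈-sym {x} {y} (congruent d) = congruent (∣-resp (flip (+ x) (+ y)) (∣m⇒∣-m d))
    where
    flip : ∀ x y → - (x -ℤ y) ≡ y -ℤ x
    flip = solve-∀

  ≈-trans : ∀ {x y z} → x ≈ y → y ≈ z → x ≈ z
  ≈-trans {x} {y} {z} (congruent d) (congruent e) = congruent (∣-resp (telescope (+ x) (+ y) (+ z)) (∣m∣n⇒∣m+n d e))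
    where
    telescope : ∀ x y z → (x -ℤ y) +ℤ (y -ℤ z) ≡ x -ℤ z
    telescope = solve-∀

  ≈-+ : ∀ {x x′ y y′} → x ≈ x′ → y ≈ y′ → x + y ≈ x′ + y′
  ≈-+ {x} {x′} {y} {y′} (congruent d) (congruent e) = congruent (∣-resp (regroup (+ x) (+ x′) (+ y) (+ y′)) (∣m∣n⇒∣m+n d e))
    where
    regroup : ∀ x x′ y y′ → (x -ℤ x′) +ℤ (y -ℤ y′) ≡ (x +ℤ y) -ℤ (x′ +ℤ y′)
    regroup = solve-∀

  ≈-* : ∀ {x x′ y y′} → x ≈ x′ → y ≈ y′ → x * y ≈ x′ * y′
  ≈-* {x} {x′} {y} {y′} (congruent d) (congruent e) = congruent (∣-resp
    (trans (regroup (+ x) (+ x′) (+ y) (+ y′)) (sym (cong₂ _-ℤ_ (ℤ.pos-* x y) (ℤ.pos-* x′ y′))))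
    (∣m∣n⇒∣m+n (∣n⇒∣m*n (+ x) e) (∣m⇒∣m*n (+ y′) d)))
    where
    regroup : ∀ x x′ y y′ → x *ℤ (y -ℤ y′) +ℤ (x -ℤ x′) *ℤ y′ ≡ x *ℤ y -ℤ x′ *ℤ y′
    regroup = solve-∀

  ≈-^ : ∀ {x y} n → x ≈ y → x ^ n ≈ y ^ n
  ≈-^ zero    e = ≈-reflexive refl
  ≈-^ (suc n) e = ≈-* e (≈-^ n e)

  ≈⇒%≡ : ∀ {x y} → x ≈ y → x % p ≡ y % p
  ≈⇒%≡ {x} {y} (congruent d) = residue-cong (+ x) (+ y) d

  %-≈ : ∀ x → x % p ≈ x
  %-≈ x = ≈-sym (congruent (∣-residue p (+ x)))

  %≡⇒≈ : ∀ {x y} → x % p ≡ y % p → x ≈ y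
  %≡⇒≈ {x} {y} eq = ≈-trans (≈-sym (%-≈ x)) (≈-trans (≈-reflexive eq) (%-≈ y))

  _≈?_ : ∀ x y → Dec (x ≈ y)
  x ≈? y = Dec.map (mk⇔ congruent _≈_[mod_].difference) (+ p ∣ℤ? (+ x -ℤ + y))

  <⇒≈-unique : ∀ {x y} → x < p → y < p → x ≈ y → x ≡ y
  <⇒≈-unique {x} {y} x<p y<p (congruent d) = <⇒residue-unique x y x<p y<p d

  1≈^ : ∀ {x} n → x ≈ 1 → x ^ n ≈ 1
  1≈^ n e = ≈-trans (≈-^ n e) (≈-reflexive (ℕ.^-zeroˡ n))

-- Modulo a prime: roots of polynomials, orders, existence of a primitive root

module _ {p : ℕ} (pr : Prime p) where
  private
    instance
      _ = prime⇒nonZero pr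
      _ = prime⇒nonTrivial pr

  1<p : 1 < p
  1<p = ℕB.nonTrivial⇒n>1 p

  euclidℤ : ∀ a b → + p ∣ℤ a *ℤ b → + p ∣ℤ a ⊎ + p ∣ℤ b
  euclidℤ a b d with euclidsLemma ∣ a ∣ ∣ b ∣ pr (subst (p ∣_) (ℤ.abs-* a b) (∣⇒∣ᵤ d))
  ... | inj₁ e = inj₁ (∣ᵤ⇒∣ e)
  ... | inj₂ e = inj₂ (∣ᵤ⇒∣ e)

  1≉0 : ¬ (1 ≈ 0 [mod p ])
  1≉0 e with () ← <⇒≈-unique 1<p (ℕ.<-trans z<s 1<p) e

  <⇒≉0 : ∀ {x} → 0 < x → x < p → ¬ (x ≈ 0 [mod p ])
  <⇒≉0 0<x x<p e = ℕ.<⇒≢ 0<x (sym (<⇒≈-unique x<p (ℕ.<-trans z<s 1<p) e))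

  ≈-*-cancelˡ : ∀ {a x y} → ¬ (a ≈ 0 [mod p ]) → a * x ≈ a * y [mod p ] → x ≈ y [mod p ]
  ≈-*-cancelˡ {a} {x} {y} a≉0 (congruent d) with euclidℤ (+ a) (+ x -ℤ + y) (∣-resp
    (trans (cong₂ _-ℤ_ (ℤ.pos-* a x) (ℤ.pos-* a y)) (factor (+ a) (+ x) (+ y))) d)
    where
    factor : ∀ a x y → a *ℤ x -ℤ a *ℤ y ≡ a *ℤ (x -ℤ y)
    factor = solve-∀
  ... | inj₁ e = contradiction (congruent (∣-resp (sym (ℤ.+-identityʳ (+ a))) e)) a≉0
  ... | inj₂ e = congruent e

  ≉0-* : ∀ {x y} → ¬ (x ≈ 0 [mod p ]) → ¬ (y ≈ 0 [mod p ]) → ¬ (x * y ≈ 0 [mod p ])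
  ≉0-* {x} x≉0 y≉0 e = y≉0 (≈-*-cancelˡ x≉0 (≈-trans e (≈-reflexive (sym (ℕ.*-zeroʳ x)))))

  ≉0-^ : ∀ {x} n → ¬ (x ≈ 0 [mod p ]) → ¬ (x ^ n ≈ 0 [mod p ])
  ≉0-^ zero    x≉0 = 1≉0
  ≉0-^ (suc n) x≉0 = ≉0-* x≉0 (≉0-^ n x≉0)

  -- Lagrange's bound for the roots 1 to `n + 1`. The largest is split off as a linear factor; the
  -- others differ from it modulo `p`, so they are roots of the quotient.
  rootBound : ∀ n (f : Vec ℤ n) → suc n < p → ¬ (∀ i → i ≤ n → + p ∣ℤ eval f (+ suc i))
  rootBound zero    []  n<p roots = 1≉0 (congruent (roots 0 z≤n))
  rootBound (suc n) f   n<p roots with divideByRoot f (+ suc (suc n))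
  ... | g , factor = rootBound n g (ℕ.<-trans (ℕ.n<1+n _) n<p) λ i i≤n →
    [ (λ d → contradiction (ℕ.suc-injective (<⇒residue-unique (suc i) (suc (suc n)) (ℕ.≤-<-trans (s≤s (ℕ.m≤n⇒m≤1+n i≤n)) n<p) n<p d)) (ℕ.<⇒≢ (s≤s i≤n)))
    , (λ d → d) ]′
      (euclidℤ (+ suc i -ℤ + suc (suc n)) (eval g (+ suc i))
        (∣-resp (factor (+ suc i)) (∣m∣n⇒∣m-n (roots i (ℕ.m≤n⇒m≤1+n i≤n)) (roots (suc n) ℕ.≤-refl))))

  -- Otherwise the monic polynomial with value `x ^ n - 1` would have the roots 1 to `n + 1`,
  -- against `rootBound`.
  exponentBound : ∀ n → .{{NonZero n}} → (∀ x → 0 < x → x < p → x ^ n ≈ 1 [mod p ]) → p ≤ suc n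
  exponentBound n@(suc n′) roots with p ≤? suc n
  ... | yes p≤1+n = p≤1+n
  ... | no p≰1+n  = contradiction (λ i i≤n → ∣-resp (sym (xⁿ-1 (suc i)))
      (_≈_[mod_].difference (roots (suc i) z<s (ℕ.≤-<-trans (s≤s i≤n) 1+n<p)))) (rootBound n (- + 1 ∷ replicate n′ (+ 0)) 1+n<p)
    where
    1+n<p = ℕ.≰⇒> p≰1+n
    xⁿ-1 : ∀ x → eval (- + 1 ∷ replicate n′ (+ 0)) (+ x) ≡ + (x ^ n) -ℤ + 1
    xⁿ-1 x = begin
      - + 1 +ℤ + x *ℤ eval (replicate n′ (+ 0)) (+ x) ≡⟨ ℤ.+-comm (- + 1) (+ x *ℤ eval (replicate n′ (+ 0)) (+ x)) ⟩
      + x *ℤ eval (replicate n′ (+ 0)) (+ x) -ℤ + 1   ≡⟨ cong (λ t → + x *ℤ t -ℤ + 1) (eval-replicate-0 n′ (+ x)) ⟩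
      (+ x) ^ℤ n -ℤ + 1                               ≡⟨ cong (_-ℤ + 1) (pos-^ x n) ⟨
      + (x ^ n) -ℤ + 1                                ∎

  record Order (g s : ℕ) : Set where
    field
      positive : 0 < s
      annihilates : g ^ s ≈ 1 [mod p ]
      divides-exponents : ∀ j → g ^ j ≈ 1 [mod p ] → s ∣ j

  open Order

  ^-* : ∀ g a b → g ^ a ≈ 1 [mod p ] → g ^ (a * b) ≈ 1 [mod p ]
  ^-* g a b e = ≈-trans (≈-reflexive (sym (ℕ.^-*-assoc g a b))) (1≈^ b e)

  order-≤ : ∀ {g} s → 0 < s → g ^ s ≈ 1 [mod p ] → Σ ℕ (Order g)
  order-≤ {g} = <-rec _ step
    where
    step : ∀ s → (∀ {t} → t < s → 0 < t → g ^ t ≈ 1 [mod p ] → Σ ℕ (Order g)) → 0 < s → g ^ s ≈ 1 [mod p ] → Σ ℕ (Order g)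
    step s rec s>0 gˢ≈1 with ℕ.anyUpTo? (λ t → (0 ℕB.<? t) ×-dec (_≈?_ {p} (g ^ t) 1)) s
    ... | yes (t , t<s , t>0 , gᵗ≈1) = rec t<s t>0 gᵗ≈1
    ... | no minimal = s , record { positive = s>0 ; annihilates = gˢ≈1 ; divides-exponents = s∣ }
      where
      instance _ = ℕB.>-nonZero s>0
      s∣ : ∀ j → g ^ j ≈ 1 [mod p ] → s ∣ j
      s∣ j gʲ≈1 with j % s in eq
      ... | zero  = ℕ∣.m%n≡0⇒n∣m j s eq
      ... | suc r = contradiction (suc r , subst (_< s) eq (ℕ÷.m%n<n j s) , z<s , ≈-trans (≈-sym reduce) gʲ≈1) minimal
        where
        reduce : g ^ j ≈ g ^ suc r [mod p ]
        reduce = ≈-trans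
          (≈-reflexive (trans (cong (g ^_) (trans (ℕ÷.m≡m%n+[m/n]*n j s) (cong₂ _+_ eq (ℕ.*-comm (j / s) s)))) (ℕ.^-distribˡ-+-* g (suc r) (s * (j / s)))))
          (≈-trans (≈-* (≈-reflexive {x = g ^ suc r} refl) (^-* g s (j / s) gˢ≈1)) (≈-reflexive (ℕ.*-identityʳ _)))

  ^-cancel : ∀ {g} i d → ¬ (g ≈ 0 [mod p ]) → g ^ i ≈ g ^ (i + d) [mod p ] → g ^ d ≈ 1 [mod p ]
  ^-cancel {g} i d g≉0 e = ≈-sym (≈-*-cancelˡ (≉0-^ i g≉0)
    (≈-trans (≈-reflexive (ℕ.*-identityʳ _)) (≈-trans e (≈-reflexive (ℕ.^-distribˡ-+-* g i d)))))

  -- Among the `p + 1` powers with exponents 0 to `p` two agree modulo `p`; the difference of their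
  -- exponents is a first exponent to minimise.
  order : ∀ g → ¬ (g ≈ 0 [mod p ]) → Σ ℕ (Order g)
  order g g≉0 with Fin.pigeonhole (ℕ.n<1+n p) (λ i → fromℕ< (ℕ÷.m%n<n (g ^ toℕ i) p))
  ... | i , j , i<j , eq = order-≤ (toℕ j ∸ toℕ i) (ℕ.m<n⇒0<n∸m i<j) (^-cancel (toℕ i) (toℕ j ∸ toℕ i) g≉0
    (%≡⇒≈ (trans (Fin.fromℕ<-injective _ _ _ _ eq) (cong (λ e → g ^ e % p) (sym (ℕ.m+[n∸m]≡n (ℕ.<⇒≤ i<j)))))))

  order-injective-≤ : ∀ {g s} → Order g s → ¬ (g ≈ 0 [mod p ]) → ∀ {i j} → i ≤ j → j < s → g ^ i ≈ g ^ j [mod p ] → i ≡ j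
  order-injective-≤ {g} {s} o g≉0 {i} {j} i≤j j<s e = ℕ.≤-antisym i≤j (ℕ.m∸n≡0⇒m≤n (∣∧<⇒≡0 s∣j∸i (ℕ.≤-<-trans (ℕ.m∸n≤m j i) j<s)))
    where
    s∣j∸i : s ∣ j ∸ i
    s∣j∸i = divides-exponents o (j ∸ i) (^-cancel i (j ∸ i) g≉0 (≈-trans e (≈-reflexive (cong (g ^_) (sym (ℕ.m+[n∸m]≡n i≤j))))))

  order-injective : ∀ {g s} → Order g s → ¬ (g ≈ 0 [mod p ]) → ∀ {i j} → i < s → j < s → g ^ i ≈ g ^ j [mod p ] → i ≡ j
  order-injective o g≉0 {i} {j} i<s j<s e with ℕ.≤-total i j
  ... | inj₁ i≤j = order-injective-≤ o g≉0 i≤j j<s e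
  ... | inj₂ j≤i = sym (order-injective-≤ o g≉0 j≤i i<s (≈-sym e))

  -- Together with 0, the `s` distinct powers of `g` are `s + 1` residues.
  order-<p : ∀ {g s} → Order g s → ¬ (g ≈ 0 [mod p ]) → s < p
  order-<p {g} {s} o g≉0 = Fin.injective⇒≤ {f = f} f-injective
    where
    residue : ℕ → Fin p
    residue x = fromℕ< (ℕ÷.m%n<n x p)
    residue-injective : ∀ {x y} → residue x ≡ residue y → x ≈ y [mod p ]
    residue-injective eq = %≡⇒≈ (Fin.fromℕ<-injective _ _ _ _ eq)
    f : Fin (suc s) → Fin p
    f fzero    = residue 0
    f (fsuc i) = residue (g ^ toℕ i)
    f-injective : ∀ {i j} → f i ≡ f j → i ≡ j
    f-injective {fzero}  {fzero}  eq = refl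
    f-injective {fzero}  {fsuc j} eq = contradiction (≈-sym (residue-injective eq)) (≉0-^ (toℕ j) g≉0)
    f-injective {fsuc i} {fzero}  eq = contradiction (residue-injective eq) (≉0-^ (toℕ i) g≉0)
    f-injective {fsuc i} {fsuc j} eq = cong fsuc (Fin.toℕ-injective
      (order-injective o g≉0 (Fin.toℕ<n i) (Fin.toℕ<n j) (residue-injective eq)))

  order-^ : ∀ {g} d s → Order g (d * s) → Order (g ^ d) s
  order-^ {g} d s o = record
    { positive = ℕB.>-nonZero⁻¹ s {{ℕ.m*n≢0⇒n≢0 d}}
    ; annihilates = ≈-trans (≈-reflexive (ℕ.^-*-assoc g d s)) (annihilates o)
    ; divides-exponents = λ j e → ℕ∣.*-cancelˡ-∣ d {{ℕ.m*n≢0⇒m≢0 d}}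
        (divides-exponents o (d * j) (≈-trans (≈-reflexive (sym (ℕ.^-*-assoc g d j))) e))
    }
    where instance _ = ℕB.>-nonZero (positive o)

  order-* : ∀ {a b s t} → Order a s → Order b t → Coprime s t → Order (a * b) (s * t)
  order-* {a} {b} {s} {t} oa ob coprime = record
    { positive = ℕ.*-mono-< (positive oa) (positive ob)
    ; annihilates = ≈-trans (≈-reflexive (^-distrib a b (s * t)))
        (≈-* (^-* a s t (annihilates oa)) (≈-trans (≈-reflexive (cong (b ^_) (ℕ.*-comm s t))) (^-* b t s (annihilates ob))))
    ; divides-exponents = λ j e → coprime-∣-* coprime
        (half (Coprime.sym coprime) ob oa (≈-trans (≈-reflexive (cong (_^ j) (ℕ.*-comm b a))) e))
        (half coprime oa ob e)
    }
    where
    ^-distrib : ∀ a b n → (a * b) ^ n ≡ a ^ n * b ^ n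
    ^-distrib a b zero    = refl
    ^-distrib a b (suc n) = trans (cong (a * b *_) (^-distrib a b n)) (ℕ.[m*n]*[o*p]≡[m*o]*[n*p] a b (a ^ n) (b ^ n))
    -- Raising to the power `s` removes `a`: then `b ^ (s * j)` is 1, so `t` divides `s * j` and, by
    -- coprimality, `j`.
    half : ∀ {a b s t j} → Coprime s t → Order a s → Order b t → (a * b) ^ j ≈ 1 [mod p ] → t ∣ j
    half {a} {b} {s} {t} {j} c oa ob e = coprime-divisor (Coprime.sym c) (divides-exponents ob (s * j)
      (≈-trans (≈-sym (≈-trans (≈-* (^-* a s j (annihilates oa)) (≈-reflexive {x = b ^ (s * j)} refl)) (≈-reflexive (ℕ.*-identityˡ _))))
        (≈-trans (≈-reflexive (trans (sym (^-distrib a b (s * j))) (cong ((a * b) ^_) (ℕ.*-comm s j)))) (^-* (a * b) j s e))))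

  -- The order `t` of `b` does not divide `s`, so some prime `q` has a higher power in `t`. With
  -- `s = q ^ f * r`, the elements `g ^ (q ^ f)` and `b ^ t′` have the coprime orders `r` and
  -- `q ^ suc f`; the order of their product is `q * s`.
  raiseOrder : ∀ {g s b} → Order g s → ¬ (g ≈ 0 [mod p ]) → ¬ (b ≈ 0 [mod p ]) → ¬ (b ^ s ≈ 1 [mod p ]) →
    Σ ℕ λ g′ → Σ ℕ λ s′ → Order g′ s′ × ¬ (g′ ≈ 0 [mod p ]) × s < s′
  raiseOrder {g} {s} {b} og g≉0 b≉0 bˢ≉1 = combine (order b b≉0)
    where
    -- The q-part of the order of g is traded for that of b.
    trade : ∀ {t} → Order b t → HigherPrimePower s t →
      Σ ℕ λ g′ → Σ ℕ λ s′ → Order g′ s′ × ¬ (g′ ≈ 0 [mod p ]) × s < s′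
    trade ob h = g ^ (q ^ f) * b ^ t′ , r * q ^ suc f ,
      order-* (order-^ (q ^ f) r (subst (Order g) s≡ og)) (order-^ t′ (q ^ suc f) (subst (Order b) t≡ ob))
        (Coprime.sym (coprime-^ (suc f) (prime∤⇒coprime q-prime q∤r))) ,
      ≉0-* (≉0-^ (q ^ f) g≉0) (≉0-^ t′ b≉0) ,
      subst (_< r * q ^ suc f) (sym s≡rqᶠ) (ℕ.*-monoʳ-< r (ℕ.^-monoʳ-< q (ℕB.nonTrivial⇒n>1 q) (ℕ.n<1+n f)))
      where
      open HigherPrimePower h
      s≡rqᶠ = trans s≡ (ℕ.*-comm (q ^ f) r)
      instance
        _ = prime⇒nonTrivial q-prime
        r≢0 : NonZero r
        r≢0 = ℕ.m*n≢0⇒m≢0 r {{subst NonZero s≡rqᶠ (ℕB.>-nonZero (positive og))}}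
    combine : Σ ℕ (Order b) → Σ ℕ λ g′ → Σ ℕ λ s′ → Order g′ s′ × ¬ (g′ ≈ 0 [mod p ]) × s < s′
    combine (t , ob) = trade ob (higherPrimePower s t {{ℕB.>-nonZero (positive og)}} {{ℕB.>-nonZero (positive ob)}}
      (λ { (ℕ∣.divides c refl) → bˢ≉1 (≈-trans (≈-reflexive (cong (b ^_) (ℕ.*-comm c t))) (^-* b t c (annihilates ob))) }))

  private
    PrimitiveRoot : Set
    PrimitiveRoot = Σ ℕ λ g → ¬ (g ≈ 0 [mod p ]) × Σ ℕ λ s → Order g s × p ≡ suc s

    NonRoot : ℕ → ℕ → Set
    NonRoot s b = 0 < b × ¬ (b ^ s ≈ 1 [mod p ])

    nonRoot? : ∀ s b → Dec (NonRoot s b)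
    nonRoot? s b = (0 ℕB.<? b) ×-dec ¬? ((b ^ s) ≈? 1)

    -- The order grows in each round and stays below `p`, so `p` rounds suffice. When no `b` is
    -- left, all nonzero residues satisfy `x ^ s ≈ 1`, and `exponentBound` and `order-<p` squeeze
    -- `s` to `p - 1`.
    search : ∀ fuel {g s} → ¬ (g ≈ 0 [mod p ]) → Order g s → p ≤ fuel + s →
      Dec (∃ λ b → b < p × NonRoot s b) → PrimitiveRoot
    search fuel {g} {s} g≉0 o enough (no none) = g , g≉0 , s , o , ℕ.≤-antisym
      (exponentBound s {{ℕB.>-nonZero (positive o)}} (λ x 0<x x<p → decidable-stable ((x ^ s) ≈? 1) (λ ne → none (x , x<p , 0<x , ne))))
      (order-<p o g≉0)
    search zero       g≉0 o enough (yes _) = contradiction enough (ℕ.<⇒≱ (order-<p o g≉0))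
    search (suc fuel) {s = s} g≉0 o enough (yes (b , b<p , 0<b , bˢ≉1)) = continue (raiseOrder o g≉0 (<⇒≉0 0<b b<p) bˢ≉1)
      where
      continue : (Σ ℕ λ g′ → Σ ℕ λ s′ → Order g′ s′ × ¬ (g′ ≈ 0 [mod p ]) × s < s′) → PrimitiveRoot
      continue (g′ , s′ , o′ , g′≉0 , s<s′) = search fuel g′≉0 o′
        (ℕ.≤-trans enough (subst (_≤ fuel + s′) (ℕ.+-suc fuel s) (ℕ.+-monoʳ-≤ fuel s<s′)))
        (ℕ.anyUpTo? (nonRoot? s′) p)

  primitiveRoot : Σ ℕ λ g → ¬ (g ≈ 0 [mod p ]) × Σ ℕ λ s → Order g s × p ≡ suc s
  primitiveRoot = search p 1≉0
    (record { positive = z<s ; annihilates = ≈-reflexive refl ; divides-exponents = λ j _ → ℕ∣.1∣ j }) (ℕ.m≤m+n p 1)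
    (ℕ.anyUpTo? (nonRoot? 1) p)

-- Booleans, lists and permutations

≡⇒≡ᵇ : ∀ {m n} → m ≡ n → (m ≡ᵇ n) ≡ true
≡⇒≡ᵇ {m} {n} eq = dec-true (m ≟ n) eq

≢⇒≡ᵇ : ∀ {m n} → m ≢ n → (m ≡ᵇ n) ≡ false
≢⇒≡ᵇ {m} {n} ne = dec-false (m ≟ n) ne

≡ᵇ⇒≡ : ∀ {m n} → (m ≡ᵇ n) ≡ true → m ≡ n
≡ᵇ⇒≡ {m} {n} eq = ℕ.≡ᵇ⇒≡ m n (Equivalence.from T-≡ eq)

anyBelow⁺ : ∀ n f {x} → x < n → f x ≡ true → anyBelow n f ≡ true
anyBelow⁺ (suc n) f x<1+n fx with ℕ.m≤n⇒m<n∨m≡n (s≤s⁻¹ x<1+n)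
... | inj₁ x<n  = trans (cong (f n ∨_) (anyBelow⁺ n f x<n fx)) (∨-zeroʳ (f n))
... | inj₂ refl = cong (_∨ anyBelow n f) fx

anyBelow⁻ : ∀ n f → anyBelow n f ≡ true → Σ ℕ λ x → x < n × f x ≡ true
anyBelow⁻ (suc n) f any with f n in eq
... | true  = n , ℕ.n<1+n n , eq
... | false with anyBelow⁻ n f any
...   | x , x<n , fx = x , ℕ.m≤n⇒m≤1+n x<n , fx

sum-applyUpTo : ∀ n (F : ℕ → ℕ) (h : ℕ → ℕ) → + sum (map F (applyUpTo h n)) ≡ sumFin n (λ i → + F (h (toℕ i)))
sum-applyUpTo zero    F h = refl
sum-applyUpTo (suc n) F h = cong (+ F (h 0) +ℤ_) (sum-applyUpTo n F (h ∘ suc))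

lookup-injective : ∀ {xs : List ℕ} → Unique xs → ∀ i j → lookup xs i ≡ lookup xs j → i ≡ j
lookup-injective (_ ∷ _)    fzero    fzero    eq = refl
lookup-injective (x∉xs ∷ _) fzero    (fsuc j) eq = contradiction eq (All.lookup x∉xs (∈-lookup j))
lookup-injective (x∉xs ∷ _) (fsuc i) fzero    eq = contradiction (sym eq) (All.lookup x∉xs (∈-lookup i))
lookup-injective (_ ∷ u)    (fsuc i) (fsuc j) eq = cong fsuc (lookup-injective u i j eq)

injective⇒surjective : ∀ {n} (f : Fin n → Fin n) → (∀ {i j} → f i ≡ f j → i ≡ j) → ∀ y → Σ (Fin n) λ i → f i ≡ y
injective⇒surjective {suc n} f inj y with Fin.any? (λ i → f i Fin.≟ y)
... | yes hit = hit
... | no miss = contradiction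
  (Fin.injective⇒≤ {f = λ i → punchOut (y≢f i)} (λ {i} {j} eq → inj (Fin.punchOut-injective (y≢f i) (y≢f j) eq))) (ℕ.<⇒≱ (ℕ.n<1+n n))
  where
  y≢f : ∀ i → y ≢ f i
  y≢f i eq = miss (i , sym eq)

injective⇒permutation : ∀ {n} (f : Fin n → Fin n) → (∀ {i j} → f i ≡ f j → i ≡ j) →
  Σ (Permutation n n) λ π → ∀ i → π ⟨$⟩ʳ i ≡ f i
injective⇒permutation f inj = permutation f (proj₁ ∘ surj) (proj₂ ∘ surj) (λ i → inj (proj₂ (surj (f i)))) , λ _ → refl
  where surj = injective⇒surjective f inj

I-≢ : ∀ {n} {i j : Fin n} → i ≢ j → I i j ≡ + 0
I-≢ {i = fzero}  {fzero}  i≢j = contradiction refl i≢j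
I-≢ {i = fzero}  {fsuc j} i≢j = refl
I-≢ {i = fsuc i} {fzero}  i≢j = refl
I-≢ {i = fsuc i} {fsuc j} i≢j = I-≢ (i≢j ∘ cong fsuc)

permutation-cyclicIndex : ∀ {L m} (π : Permutation L m) → CyclicIndex m (λ i → + toℕ (π ⟨$⟩ʳ i))
permutation-cyclicIndex {L} {m} π = record
  { sum-x = λ F _ → sumFin-permute (λ t → F (+ toℕ t)) π
  ; δ-x   = λ i j → compare i j (i Fin.≟ j)
  }
  where
  π-injective : ∀ {i j} → π ⟨$⟩ʳ i ≡ π ⟨$⟩ʳ j → i ≡ j
  π-injective {i} {j} eq = trans (sym (inverseˡ π)) (trans (cong (π ⟨$⟩ˡ_) eq) (inverseˡ π))
  compare : ∀ i j → Dec (i ≡ j) → δ m (+ toℕ (π ⟨$⟩ʳ i) -ℤ + toℕ (π ⟨$⟩ʳ j)) ≡ I i j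
  compare i .i (yes refl) = trans (δ-yes {m} (∣-resp (sym (ℤ.+-inverseʳ (+ toℕ (π ⟨$⟩ʳ i)))) (∣ᵤ⇒∣ (m ℕ∣.∣0)))) (sym (I-refl i))
  compare i j (no i≢j) = trans
    (δ-no {m} (λ d → i≢j (π-injective (Fin.toℕ-injective (<⇒residue-unique _ _ (Fin.toℕ<n (π ⟨$⟩ʳ i)) (Fin.toℕ<n (π ⟨$⟩ʳ j)) d)))))
    (sym (I-≢ i≢j))

sumFin-periods : ∀ a {m} {F : ℤ → ℤ} → Periodic m F → sumFin (a * m) (λ i → F (+ toℕ i)) ≡ + a *ℤ cycSum m F
sumFin-periods zero    per = refl
sumFin-periods (suc a) {m} {F} per = begin
  sumFin (m + a * m) (λ i → F (+ toℕ i))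
    ≡⟨ sumFin-split m (λ i → F (+ toℕ i)) ⟩
  sumFin m (λ i → F (+ toℕ (i ↑ˡ (a * m)))) +ℤ sumFin (a * m) (λ j → F (+ toℕ (m ↑ʳ j)))
    ≡⟨ cong₂ _+ℤ_ (sumFin-cong {m} (λ i → cong (F ∘ +_) (Fin.toℕ-↑ˡ i (a * m))))
         (trans (sumFin-cong {a * m} (λ j → trans (cong (F ∘ +_) (trans (Fin.toℕ-↑ʳ m j) (ℕ.+-comm m (toℕ j)))) (per (+ toℕ j)))) (sumFin-periods a per)) ⟩
  cycSum m F +ℤ + a *ℤ cycSum m F
    ≡⟨ lem (+ a) (cycSum m F) ⟩
  + suc a *ℤ cycSum m F ∎
  where
  lem : ∀ a s → s +ℤ a *ℤ s ≡ (+ 1 +ℤ a) *ℤ s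
  lem = solve-∀

-- Legendre symbols, power residues and point counts as they are computed

legendre-cong : ∀ {p} .{{_ : NonZero p}} {x y} → x ≈ y [mod p ] → legendre p x ≡ legendre p y
legendre-cong {p} e = cong (λ r → if r ≡ᵇ 0 then + 0 else if anyBelow p (λ z → (z ^ 2) % p ≡ᵇ r) then + 1 else - (+ 1)) (≈⇒%≡ e)

isPowRes⁺ : ∀ {p} .{{_ : NonZero p}} k {a} y → y ^ k ≈ a [mod p ] → isPowRes p k a ≡ true
isPowRes⁺ {p} k {a} y e = anyBelow⁺ p (λ x → (x ^ k) % p ≡ᵇ a % p) (ℕ÷.m%n<n y p)
  (≡⇒≡ᵇ (≈⇒%≡ (≈-trans (≈-^ k (%-≈ y)) e)))

isPowRes⁻ : ∀ {p} .{{_ : NonZero p}} k {a} → isPowRes p k a ≡ true → Σ ℕ λ y → y ^ k ≈ a [mod p ]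
isPowRes⁻ {p} k {a} eq with anyBelow⁻ p (λ x → (x ^ k) % p ≡ᵇ a % p) eq
... | y , _ , e = y , %≡⇒≈ (≡ᵇ⇒≡ e)

legendre-square : ∀ p .{{_ : NonZero p}} x → ¬ (x ≈ 0 [mod p ]) → (Σ ℕ λ y → y ^ 2 ≈ x [mod p ]) → legendre p x ≡ + 1
legendre-square p x x≉0 (y , y²≈x) = cong₂ (λ b b′ → if b then + 0 else if b′ then + 1 else - (+ 1))
  (≢⇒≡ᵇ (λ x%p≡0 → x≉0 (%≡⇒≈ (trans x%p≡0 (sym (ℕ∣.n∣m⇒m%n≡0 0 p (p ℕ∣.∣0))))))) (isPowRes⁺ 2 y y²≈x)

legendre-nonsquare : ∀ p .{{_ : NonZero p}} x → ¬ (x ≈ 0 [mod p ]) → ¬ (Σ ℕ λ y → y ^ 2 ≈ x [mod p ]) → legendre p x ≡ - (+ 1)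
legendre-nonsquare p x x≉0 nonsquare = cong₂ (λ b b′ → if b then + 0 else if b′ then + 1 else - (+ 1))
  (≢⇒≡ᵇ (λ x%p≡0 → x≉0 (%≡⇒≈ (trans x%p≡0 (sym (ℕ∣.n∣m⇒m%n≡0 0 p (p ℕ∣.∣0)))))))
  (¬-not (λ eq → nonsquare (isPowRes⁻ 2 eq)))

-- The summand of `countPts`, with `v` in place of `f x`.
hit : ∀ p .{{_ : NonZero p}} → ℕ → ℕ → ℤ
hit p y v = + (if (y * y) % p ≡ᵇ v % p then 1 else 0)

hit-yes : ∀ p .{{_ : NonZero p}} y v → y * y ≈ v [mod p ] → hit p y v ≡ + 1
hit-yes p y v e = cong (λ b → + (if b then 1 else 0)) (≡⇒≡ᵇ (≈⇒%≡ e))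

hit-no : ∀ p .{{_ : NonZero p}} y v → ¬ (y * y ≈ v [mod p ]) → hit p y v ≡ + 0
hit-no p y v ne = cong (λ b → + (if b then 1 else 0)) (≢⇒≡ᵇ (λ eq → ne (%≡⇒≈ eq)))

hit-cong : ∀ p .{{_ : NonZero p}} v {x y} → x ≈ y [mod p ] → hit p x v ≡ hit p y v
hit-cong p v e = cong (λ r → + (if r ≡ᵇ v % p then 1 else 0)) (≈⇒%≡ (≈-* e e))

sumFin-1 : ∀ n → sumFin n (λ _ → + 1) ≡ + n
sumFin-1 zero    = refl
sumFin-1 (suc n) = cong (+ 1 +ℤ_) (sumFin-1 n)

kthResidues⁻ : ∀ p .{{_ : NonZero p}} k {x} → x ∈ kthResidues p k → 0 < x × x < p × isPowRes p k x ≡ true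
kthResidues⁻ (suc N) k x∈ with ∈-filter⁻ (T? ∘ isPowRes (suc N) k) {xs = map suc (upTo N)} x∈
... | x∈map , isRes with ∈-map⁻ suc x∈map
...   | y , y∈ , refl = z<s , s≤s (∈-upTo⁻ y∈) , Equivalence.to T-≡ isRes

kthResidues⁺ : ∀ p .{{_ : NonZero p}} k {x} → 0 < x → x < p → isPowRes p k x ≡ true → x ∈ kthResidues p k
kthResidues⁺ (suc N) k {suc y} 0<x x<p isRes =
  ∈-filter⁺ (T? ∘ isPowRes (suc N) k) (∈-map⁺ suc (∈-upTo⁺ (s≤s⁻¹ x<p))) (Equivalence.from T-≡ isRes)

kthResidues-unique : ∀ p .{{_ : NonZero p}} k → Unique (kthResidues p k)
kthResidues-unique p k = Unique.filter⁺ (T? ∘ isPowRes p k) (Unique.map⁺ ℕ.suc-injective (Unique.upTo⁺ (p ∸ 1)))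

0^ : ∀ k → .{{NonZero k}} → 0 ^ k ≡ 0
0^ (suc k) = refl

^-swap : ∀ g a k → (g ^ a) ^ k ≡ (g ^ k) ^ a
^-swap g a k = trans (ℕ.^-*-assoc g a k) (trans (cong (g ^_) (ℕ.*-comm a k)) (sym (ℕ.^-*-assoc g k a)))

order-cong : ∀ {p} (pr : Prime p) {h s} .{{_ : NonZero s}} → Order pr h s → ∀ {i j} → + s ∣ℤ + i -ℤ + j → h ^ i ≈ h ^ j [mod p ]
order-cong {p} pr {h} {s} o {i} {j} d = ≈-trans (reduce i) (≈-trans (≈-reflexive (cong (h ^_) (residue-cong (+ i) (+ j) d))) (≈-sym (reduce j)))
  where
  instance _ = prime⇒nonZero pr
  reduce : ∀ i → h ^ i ≈ h ^ (i % s) [mod p ]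
  reduce i = ≈-trans
    (≈-reflexive (trans (cong (h ^_) (trans (ℕ÷.m≡m%n+[m/n]*n i s) (cong (λ t → i % s + t) (ℕ.*-comm (i / s) s)))) (ℕ.^-distribˡ-+-* h (i % s) (s * (i / s)))))
    (≈-trans (≈-* (≈-reflexive {x = h ^ (i % s)} refl) (^-* pr h s (i / s) (Order.annihilates o))) (≈-reflexive (ℕ.*-identityʳ _)))

order-cong⁻ : ∀ {p} (pr : Prime p) {h s} .{{_ : NonZero s}} → Order pr h s → ¬ (h ≈ 0 [mod p ]) →
  ∀ {i j} → h ^ i ≈ h ^ j [mod p ] → + s ∣ℤ + i -ℤ + j
order-cong⁻ {p} pr {h} {s} o h≉0 {i} {j} e = ∣-resp (telescope (+ i) (+ j) (+ (i % s)))
  (∣m∣n⇒∣m-n (∣-residue s (+ i)) (subst (λ r → + s ∣ℤ + j -ℤ + r) (sym i%s≡j%s) (∣-residue s (+ j))))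
  where
  instance _ = prime⇒nonZero pr
  telescope : ∀ i j r → (i -ℤ r) -ℤ (j -ℤ r) ≡ i -ℤ j
  telescope = solve-∀
  reduce : ∀ i → h ^ (i % s) ≈ h ^ i [mod p ]
  reduce i = order-cong pr o {i % s} {i} (∣-resp (flip (+ i) (+ (i % s))) (∣m⇒∣-m (∣-residue s (+ i))))
    where
    flip : ∀ i r → - (i -ℤ r) ≡ r -ℤ i
    flip = solve-∀
  i%s≡j%s : i % s ≡ j % s
  i%s≡j%s = order-injective pr o h≉0 (ℕ÷.m%n<n i s) (ℕ÷.m%n<n j s) (≈-trans (reduce i) (≈-trans e (≈-sym (reduce j))))

-- The quadratic character in terms of a primitive root

module _ {N : ℕ} (pr : Prime (suc N)) {g : ℕ} (g≉0 : ¬ (g ≈ 0 [mod suc N ])) (g-order : Order pr g N) where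
  private
    p = suc N
    instance
      N≢0 : NonZero N
      N≢0 = ℕB.>-nonZero (Order.positive g-order)

    residue : ∀ x → ¬ (x ≈ 0 [mod p ]) → Σ (Fin N) λ i → suc (toℕ i) ≈ x [mod p ]
    residue x x≉0 = locate (x % p) refl
      where
      locate : ∀ r → x % p ≡ r → Σ (Fin N) λ i → suc (toℕ i) ≈ x [mod p ]
      locate zero    eq = contradiction (%≡⇒≈ eq) x≉0
      locate (suc r) eq = fromℕ< r<N , ≈-trans (≈-reflexive (trans (cong suc (Fin.toℕ-fromℕ< r<N)) (sym eq))) (%-≈ x)
        where
        r<N : r < N
        r<N = s≤s⁻¹ (subst (_< p) eq (ℕ÷.m%n<n x p))

    -- The exponentiation by `g`, with the nonzero residues written as `suc (toℕ j)`. An injective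
    -- map from `Fin N` to itself is a permutation: surjectivity gives `discreteLog`, and the
    -- reordering gives `sum-units`.
    unit : Fin N → Fin N
    unit i = proj₁ (residue (g ^ toℕ i) (≉0-^ pr (toℕ i) g≉0))

    suc-unit : ∀ i → suc (toℕ (unit i)) ≈ g ^ toℕ i [mod p ]
    suc-unit i = proj₂ (residue (g ^ toℕ i) (≉0-^ pr (toℕ i) g≉0))

    unit-injective : ∀ {i j} → unit i ≡ unit j → i ≡ j
    unit-injective {i} {j} eq = Fin.toℕ-injective (order-injective pr g-order g≉0 (Fin.toℕ<n i) (Fin.toℕ<n j)
      (≈-trans (≈-sym (suc-unit i)) (≈-trans (≈-reflexive (cong (suc ∘ toℕ) eq)) (suc-unit j))))

  discreteLog : ∀ x → ¬ (x ≈ 0 [mod p ]) → Σ ℕ λ i → x ≈ g ^ i [mod p ]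
  discreteLog x x≉0 = log (residue x x≉0)
    where
    log : (Σ (Fin N) λ y → suc (toℕ y) ≈ x [mod p ]) → Σ ℕ λ i → x ≈ g ^ i [mod p ]
    log (y , y≈x) with injective⇒surjective unit unit-injective y
    ... | i , refl = toℕ i , ≈-trans (≈-sym y≈x) (suc-unit i)

  sum-units : ∀ (F : ℕ → ℤ) → (∀ {x y} → x ≈ y [mod p ] → F x ≡ F y) →
    sumFin p (λ i → F (toℕ i)) ≡ F 0 +ℤ sumFin N (λ i → F (g ^ toℕ i))
  sum-units F F-cong = cong (F 0 +ℤ_) (begin
    sumFin N (λ i → F (suc (toℕ i)))           ≡⟨ sumFin-permute (λ i → F (suc (toℕ i))) (proj₁ perm) ⟨
    sumFin N (λ i → F (suc (toℕ (proj₁ perm ⟨$⟩ʳ i))))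
                                               ≡⟨ sumFin-cong {N} (λ i → trans (cong (λ j → F (suc (toℕ j))) (proj₂ perm i)) (F-cong (suc-unit i))) ⟩
    sumFin N (λ i → F (g ^ toℕ i))             ∎)
    where
    perm : Σ (Permutation N N) λ π → ∀ i → π ⟨$⟩ʳ i ≡ unit i
    perm = injective⇒permutation unit unit-injective

  module _ (2∣N : + 2 ∣ℤ + N) where

    legendre-0 : ∀ {x} → x ≈ 0 [mod p ] → legendre p x ≡ + 0
    legendre-0 e = legendre-cong e

    -- With `y ≈ g ^ a`, the exponents `2 a` and `i` agree modulo the order `N`, which is even.
    square⇒even : ∀ {x} i → x ≈ g ^ i [mod p ] → (Σ ℕ λ y → y ^ 2 ≈ x [mod p ]) → + 2 ∣ℤ + i
    square⇒even {x} i x≈gⁱ (y , y²≈x) = fromLog (discreteLog y y≉0)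
      where
      y≉0 : ¬ (y ≈ 0 [mod p ])
      y≉0 y≈0 = ≉0-^ pr i g≉0 (≈-trans (≈-sym x≈gⁱ) (≈-trans (≈-sym y²≈x) (≈-^ 2 y≈0)))
      cancel : ∀ a b → a -ℤ (a -ℤ b) ≡ b
      cancel = solve-∀
      fromLog : (Σ ℕ λ a → y ≈ g ^ a [mod p ]) → + 2 ∣ℤ + i
      fromLog (a , y≈gᵃ) = ∣-resp (cancel (+ (a * 2)) (+ i)) (∣m∣n⇒∣m-n (divides (+ a) (ℤ.pos-* a 2))
        (∣-trans 2∣N (order-cong⁻ pr g-order g≉0 {a * 2} {i}
          (≈-trans (≈-reflexive (sym (ℕ.^-*-assoc g a 2))) (≈-trans (≈-^ 2 (≈-sym y≈gᵃ)) (≈-trans y²≈x x≈gⁱ))))))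

    even⇒square : ∀ {x} i → x ≈ g ^ i [mod p ] → 2 ∣ i → Σ ℕ λ y → y ^ 2 ≈ x [mod p ]
    even⇒square i x≈gⁱ (ℕ∣.divides q refl) = g ^ q , ≈-trans (≈-reflexive (ℕ.^-*-assoc g q 2)) (≈-sym x≈gⁱ)

    legendre-^ : ∀ {x} i → x ≈ g ^ i [mod p ] → legendre p x ≡ σ (+ i)
    legendre-^ {x} i x≈gⁱ = parity (+ 2 ∣ℤ? + i)
      where
      x≉0 : ¬ (x ≈ 0 [mod p ])
      x≉0 x≈0 = ≉0-^ pr i g≉0 (≈-trans (≈-sym x≈gⁱ) x≈0)
      parity : Dec (+ 2 ∣ℤ + i) → legendre p x ≡ σ (+ i)
      parity (yes d) = trans (legendre-square p x x≉0 (even⇒square i x≈gⁱ (∣⇒∣ᵤ d))) (sym (σ-yes d))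
      parity (no ¬d) = trans (legendre-nonsquare p x x≉0 (¬d ∘ square⇒even i x≈gⁱ)) (sym (σ-no ¬d))

    -- Only one factor is given by its exponent, since `z` may be 0 modulo `p`; some `G ^ r + 1` is
    -- when `m` is even.
    legendre-^* : ∀ i z → legendre p (g ^ i * z) ≡ σ (+ i) *ℤ legendre p z
    legendre-^* i z with z ≈? 0
    ... | yes z≈0 = begin
      legendre p (g ^ i * z)      ≡⟨ legendre-0 (≈-trans (≈-* (≈-reflexive {x = g ^ i} refl) z≈0) (≈-reflexive (ℕ.*-zeroʳ (g ^ i)))) ⟩
      + 0                         ≡⟨ ℤ.*-zeroʳ (σ (+ i)) ⟨
      σ (+ i) *ℤ + 0              ≡⟨ cong (σ (+ i) *ℤ_) (legendre-0 z≈0) ⟨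
      σ (+ i) *ℤ legendre p z     ∎
    ... | no z≉0 = viaLog (discreteLog z z≉0)
      where
      viaLog : (Σ ℕ λ j → z ≈ g ^ j [mod p ]) → legendre p (g ^ i * z) ≡ σ (+ i) *ℤ legendre p z
      viaLog (j , z≈gʲ) = begin
        legendre p (g ^ i * z)    ≡⟨ legendre-^ (i + j) (≈-trans (≈-* (≈-reflexive {x = g ^ i} refl) z≈gʲ) (≈-reflexive (sym (ℕ.^-distribˡ-+-* g i j)))) ⟩
        σ (+ i +ℤ + j)            ≡⟨ σ-* (+ i) (+ j) ⟩
        σ (+ i) *ℤ σ (+ j)        ≡⟨ cong (σ (+ i) *ℤ_) (legendre-^ j z≈gʲ) ⟨
        σ (+ i) *ℤ legendre p z   ∎

    module _ {h} (N≡2h : N ≡ 2 * h) where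
      private
        instance
          h≢0 : NonZero h
          h≢0 = ℕ.m*n≢0⇒n≢0 2 {{subst NonZero N≡2h N≢0}}

      -- The squares of `g ^ i` and `g ^ q` agree exactly when the order `2 h` of `g` divides
      -- `2 (i - q)`.
      hit-δ : ∀ {v} q i → v ≈ g ^ (q * 2) [mod p ] → hit p (g ^ i) v ≡ δ h (+ i -ℤ + q)
      hit-δ {v} q i v≈ = compare (+ h ∣ℤ? (+ i -ℤ + q))
        where
        double : ∀ i q → + 2 *ℤ (i -ℤ q) ≡ (i +ℤ i) -ℤ q *ℤ + 2
        double = solve-∀
        N≡ : + N ≡ + 2 *ℤ + h
        N≡ = trans (cong +_ N≡2h) (ℤ.pos-* 2 h)
        eq : + 2 *ℤ (+ i -ℤ + q) ≡ + (i + i) -ℤ + (q * 2)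
        eq = trans (double (+ i) (+ q)) (cong (λ t → + (i + i) -ℤ t) (sym (ℤ.pos-* q 2)))
        compare : Dec (+ h ∣ℤ + i -ℤ + q) → hit p (g ^ i) v ≡ δ h (+ i -ℤ + q)
        compare (yes d) = trans (hit-yes p (g ^ i) v (≈-trans (≈-reflexive (sym (ℕ.^-distribˡ-+-* g i i)))
          (≈-trans (order-cong pr g-order {i + i} {q * 2} (subst (_∣ℤ + (i + i) -ℤ + (q * 2)) (sym N≡) (∣-resp′ eq (*-monoʳ-∣ (+ 2) d)))) (≈-sym v≈)))) (sym (δ-yes d))
          where
          ∣-resp′ : ∀ {a b c} → b ≡ c → a ∣ℤ b → a ∣ℤ c
          ∣-resp′ refl d = d
        compare (no ¬d) = trans (hit-no p (g ^ i) v (λ e → ¬d (*-cancelˡ-∣ (+ 2) (subst (_∣ℤ + 2 *ℤ (+ i -ℤ + q)) N≡ (∣-resp (sym eq)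
          (order-cong⁻ pr g-order g≉0 {i + i} {q * 2} (≈-trans (≈-reflexive (ℕ.^-distribˡ-+-* g i i)) (≈-trans e v≈)))))))) (sym (δ-no ¬d))

      -- The exponents below `N` make up two periods of length `h`, with one solution in each.
      sum-hits : ∀ {v} q → v ≈ g ^ (q * 2) [mod p ] → sumFin N (λ i → hit p (g ^ toℕ i) v) ≡ + 2
      sum-hits {v} q v≈ = begin
        sumFin N (λ i → hit p (g ^ toℕ i) v)                  ≡⟨ sumFin-cong {N} (λ i → hit-δ q (toℕ i) v≈) ⟩
        sumFin N (λ i → δ h (+ toℕ i -ℤ + q))                 ≡⟨ cong (λ n → sumFin n (λ i → δ h (+ toℕ i -ℤ + q))) N≡2h ⟩
        sumFin (2 * h) (λ i → δ h (+ toℕ i -ℤ + q))           ≡⟨ sumFin-periods 2 {h} {λ u → δ h (u -ℤ + q)} (periodic-∘+ (δ-periodic h) (- + q)) ⟩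
        + 2 *ℤ cycSum h (λ u → δ h (u -ℤ + q))                ≡⟨ cong (+ 2 *ℤ_) (cycSum-cong h (λ u → ℤ.*-identityˡ (δ h (u -ℤ + q)))) ⟨
        + 2 *ℤ cycSum h (λ u → + 1 *ℤ δ h (u -ℤ + q))         ≡⟨ cong (+ 2 *ℤ_) (cycSum-δ h {const (+ 1)} (λ _ → refl) (+ q)) ⟩
        + 2                                                   ∎

    hits≡1+legendre : ∀ v → sumFin p (λ y → hit p (toℕ y) v) ≡ + 1 +ℤ legendre p v
    hits≡1+legendre v = trans (sum-units (λ y → hit p y v) (hit-cong p v)) (byCases (v ≈? 0))
      where
      all-miss : (∀ i → ¬ (g ^ i * g ^ i ≈ v [mod p ])) → sumFin N (λ i → hit p (g ^ toℕ i) v) ≡ + 0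
      all-miss miss = trans (sumFin-cong {N} (λ i → hit-no p (g ^ toℕ i) v (miss (toℕ i)))) (sumFin-zero N)
      nonzero : ¬ (v ≈ 0 [mod p ]) → (Σ ℕ λ j → v ≈ g ^ j [mod p ]) →
        hit p 0 v +ℤ sumFin N (λ i → hit p (g ^ toℕ i) v) ≡ + 1 +ℤ legendre p v
      nonzero v≉0 (j , v≈gʲ) = parity (+ 2 ∣ℤ? + j)
        where
        _⟨≡⟩_ : ∀ {a b c : ℤ} → a ≡ b → b ≡ c → a ≡ c
        _⟨≡⟩_ = trans
        0-miss : hit p 0 v ≡ + 0
        0-miss = hit-no p 0 v (λ e → v≉0 (≈-sym e))
        parity : Dec (+ 2 ∣ℤ + j) → hit p 0 v +ℤ sumFin N (λ i → hit p (g ^ toℕ i) v) ≡ + 1 +ℤ legendre p v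
        parity (no ¬d) = cong₂ _+ℤ_ 0-miss (all-miss (λ i e → ¬d (square⇒even j v≈gʲ (g ^ i ,
            ≈-trans (≈-reflexive (cong (g ^ i *_) (ℕ.*-identityʳ (g ^ i)))) e))))
          ⟨≡⟩ cong (+ 1 +ℤ_) (sym (trans (legendre-^ j v≈gʲ) (σ-no ¬d)))
        parity (yes d) = cong₂ _+ℤ_ 0-miss (half (∣⇒∣ᵤ 2∣N) (∣⇒∣ᵤ d))
          ⟨≡⟩ cong (+ 1 +ℤ_) (sym (trans (legendre-^ j v≈gʲ) (σ-yes d)))
          where
          half : 2 ∣ N → 2 ∣ j → sumFin N (λ i → hit p (g ^ toℕ i) v) ≡ + 2
          half (ℕ∣.divides h N≡h2) (ℕ∣.divides q refl) = sum-hits {h} (trans N≡h2 (ℕ.*-comm h 2)) q v≈gʲ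
      byCases : Dec (v ≈ 0 [mod p ]) → hit p 0 v +ℤ sumFin N (λ i → hit p (g ^ toℕ i) v) ≡ + 1 +ℤ legendre p v
      byCases (yes v≈0) = trans
        (cong₂ _+ℤ_ (hit-yes p 0 v (≈-sym v≈0)) (all-miss (λ i e → ≉0-* pr (≉0-^ pr i g≉0) (≉0-^ pr i g≉0) (≈-trans e v≈0))))
        (cong (+ 1 +ℤ_) (sym (legendre-0 v≈0)))
      byCases (no v≉0) = nonzero v≉0 (discreteLog v v≉0)

    countPts-legendre : ∀ f → + countPts p f ≡ + p +ℤ sumFin p (λ x → legendre p (f (toℕ x)))
    countPts-legendre f = begin
      + countPts p f
        ≡⟨ sum-applyUpTo p (λ x → sum (map (λ y → if (y * y) % p ≡ᵇ f x % p then 1 else 0) (upTo p))) (λ x → x) ⟩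
      sumFin p (λ x → + sum (map (λ y → if (y * y) % p ≡ᵇ f (toℕ x) % p then 1 else 0) (upTo p)))
        ≡⟨ sumFin-cong {p} (λ x → trans (sum-applyUpTo p (λ y → if (y * y) % p ≡ᵇ f (toℕ x) % p then 1 else 0) (λ y → y)) (hits≡1+legendre (f (toℕ x)))) ⟩
      sumFin p (λ x → + 1 +ℤ legendre p (f (toℕ x)))
        ≡⟨ sumFin-+ {p} (λ _ → + 1) (λ x → legendre p (f (toℕ x))) ⟩
      sumFin p (λ _ → + 1) +ℤ sumFin p (λ x → legendre p (f (toℕ x)))
        ≡⟨ cong (_+ℤ sumFin p (λ x → legendre p (f (toℕ x)))) (sumFin-1 p) ⟩
      + p +ℤ sumFin p (λ x → legendre p (f (toℕ x))) ∎

    -- The matrix W_p(k) as a circulant, and its character sums as point counts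

    module _ (k m : ℕ) (N≡km : N ≡ k * m) (2∣k : 2 ∣ k) where
      private
        instance
          k≢0 : NonZero k
          k≢0 = ℕ.m*n≢0⇒m≢0 k {{subst NonZero N≡km N≢0}}
          m≢0 : NonZero m
          m≢0 = ℕ.m*n≢0⇒n≢0 k {{subst NonZero N≡km N≢0}}

        G : ℕ
        G = g ^ k

        G≉0 : ¬ (G ≈ 0 [mod p ])
        G≉0 = ≉0-^ pr k g≉0

        G-order : Order pr G m
        G-order = order-^ pr k m (subst (Order pr g) N≡km g-order)

        -- Exponents of `G` have to be natural numbers, hence the reduction of `u` modulo the order
        -- `m` of `G`.
        c : ℤ → ℤ
        c u = legendre p (G ^ (u %ℕ m) + 1)

        c-≡ : ∀ {u} a → + m ∣ℤ u -ℤ + a → c u ≡ legendre p (G ^ a + 1)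
        c-≡ {u} a d = legendre-cong (≈-+ (order-cong pr G-order {u %ℕ m} {a}
          (∣-resp (telescope u (+ a) (+ (u %ℕ m))) (∣m∣n⇒∣m-n d (∣-residue m u)))) (≈-reflexive {x = 1} refl))
          where
          telescope : ∀ u a r → (u -ℤ a) -ℤ (u -ℤ r) ≡ r -ℤ a
          telescope = solve-∀

        c-cong : ∀ u v → + m ∣ℤ u -ℤ v → c u ≡ c v
        c-cong u v d = cong (λ r → legendre p (G ^ r + 1)) (residue-cong u v d)

        c-periodic : Periodic m c
        c-periodic u = c-cong (u +ℤ + m) u (∣-resp (cancel u (+ m)) ∣-refl)
          where
          cancel : ∀ u m → m ≡ u +ℤ m -ℤ u
          cancel = solve-∀

        c-+ : ∀ a → c (+ a) ≡ legendre p (G ^ a + 1)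
        c-+ a = c-≡ {+ a} a (∣-resp (sym (ℤ.+-inverseʳ (+ a))) (∣ᵤ⇒∣ (m ℕ∣.∣0)))

        legendre-G^* : ∀ r z → legendre p (G ^ r * z) ≡ legendre p z
        legendre-G^* r z = begin
          legendre p (G ^ r * z)               ≡⟨ cong (λ t → legendre p (t * z)) (ℕ.^-*-assoc g k r) ⟩
          legendre p (g ^ (k * r) * z)         ≡⟨ legendre-^* (k * r) z ⟩
          σ (+ (k * r)) *ℤ legendre p z        ≡⟨ cong (_*ℤ legendre p z) (σ-yes {+ (k * r)} (∣ᵤ⇒∣ (ℕ∣.∣m⇒∣m*n r 2∣k))) ⟩
          + 1 *ℤ legendre p z                  ≡⟨ ℤ.*-identityˡ (legendre p z) ⟩
          legendre p z                         ∎

        -- Modulo `p` the sum is `G ^ b * (G ^ r + 1)` with `r` the residue of `a - b`, and `G ^ b`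
        -- is a square. So the entry depends on the difference of the exponents although it is built
        -- from a sum of residues.
        legendre-+ : ∀ {x y} a b → x ≈ G ^ a [mod p ] → y ≈ G ^ b [mod p ] → legendre p (x + y) ≡ c (+ a -ℤ + b)
        legendre-+ {x} {y} a b x≈ y≈ = trans (legendre-cong x+y≈) (legendre-G^* b (G ^ r + 1))
          where
          r = (+ a -ℤ + b) %ℕ m
          telescope : ∀ a b r → (a -ℤ b) -ℤ r ≡ a -ℤ (b +ℤ r)
          telescope = solve-∀
          x+y≈ : x + y ≈ G ^ b * (G ^ r + 1) [mod p ]
          x+y≈ = ≈-trans (≈-+ (≈-trans x≈ (order-cong pr G-order {a} {b + r}
              (∣-resp (telescope (+ a) (+ b) (+ r)) (∣-residue m (+ a -ℤ + b))))) y≈)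
            (≈-reflexive (trans (cong₂ _+_ (ℕ.^-distribˡ-+-* G b r) (sym (ℕ.*-identityʳ (G ^ b)))) (sym (ℕ.*-distribˡ-+ (G ^ b) (G ^ r) 1))))

        -- Evenness is the commutativity of addition: `legendre-+` with exponents 0 and `r`
        -- evaluates the symbol of `1 + G ^ r` as `c` at `- r`.
        c-even : ∀ u → c (- u) ≡ c u
        c-even u = begin
          c (- u)                     ≡⟨ c-cong (- u) (+ 0 -ℤ + r) (∣-resp (neg u (+ r)) (∣m⇒∣-m (∣-residue m u))) ⟩
          c (+ 0 -ℤ + r)              ≡⟨ legendre-+ 0 r (≈-reflexive {x = 1} refl) (≈-reflexive {x = G ^ r} refl) ⟨
          legendre p (1 + G ^ r)      ≡⟨ cong (legendre p) (ℕ.+-comm 1 (G ^ r)) ⟩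
          legendre p (G ^ r + 1)      ∎
          where
          r = u %ℕ m
          neg : ∀ u r → - (u -ℤ r) ≡ - u -ℤ (+ 0 -ℤ r)
          neg = solve-∀

        L = length (kthResidues p k)

        residueLog : ∀ i → Σ (Fin m) λ t → lookup (kthResidues p k) i ≈ G ^ toℕ t [mod p ]
        residueLog i = fromMembership (kthResidues⁻ p k (∈-lookup i))
          where
          x = lookup (kthResidues p k) i
          fromMembership : 0 < x × x < p × isPowRes p k x ≡ true → Σ (Fin m) λ t → x ≈ G ^ toℕ t [mod p ]
          fromMembership (0<x , x<p , isRes) = fromRoot (isPowRes⁻ k isRes)
            where
            fromRoot : (Σ ℕ λ y → y ^ k ≈ x [mod p ]) → Σ (Fin m) λ t → x ≈ G ^ toℕ t [mod p ]
            fromRoot (y , yᵏ≈x) = fromLog (discreteLog y y≉0)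
              where
              y≉0 : ¬ (y ≈ 0 [mod p ])
              y≉0 y≈0 = <⇒≉0 pr 0<x x<p (≈-trans (≈-sym yᵏ≈x) (≈-trans (≈-^ k y≈0) (≈-reflexive (0^ k))))
              fromLog : (Σ ℕ λ a → y ≈ g ^ a [mod p ]) → Σ (Fin m) λ t → x ≈ G ^ toℕ t [mod p ]
              fromLog (a , y≈gᵃ) = fromℕ< (ℕ÷.m%n<n a m) , ≈-trans (≈-sym yᵏ≈x) (≈-trans (≈-^ k y≈gᵃ) (≈-trans (≈-reflexive (^-swap g a k))
                (≈-trans (order-cong pr G-order {a} {a % m} (∣-residue m (+ a))) (≈-reflexive (cong (G ^_) (sym (Fin.toℕ-fromℕ< (ℕ÷.m%n<n a m))))))))

        residueIndex : ∀ (t : Fin m) → Σ (Fin L) λ i → lookup (kthResidues p k) i ≡ G ^ toℕ t % p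
        residueIndex t = Any.index member , sym (lookup-index member)
          where
          member : G ^ toℕ t % p ∈ kthResidues p k
          member = kthResidues⁺ p k (ℕ.n≢0⇒n>0 (λ eq → ≉0-^ pr (toℕ t) G≉0 (%≡⇒≈ eq))) (ℕ÷.m%n<n (G ^ toℕ t) p)
            (isPowRes⁺ k (g ^ toℕ t) (≈-trans (≈-reflexive (^-swap g (toℕ t) k)) (≈-sym (%-≈ (G ^ toℕ t)))))

        -- The exponents of the residues, in the order of the list. This bijection also shows that
        -- there are `m` residues, by `↔⇒≡ π`.
        π : Permutation L m
        π = permutation (proj₁ ∘ residueLog) (proj₁ ∘ residueIndex)
          (λ t → Fin.toℕ-injective (order-injective pr G-order G≉0 (Fin.toℕ<n _) (Fin.toℕ<n t)
            (≈-trans (≈-sym (proj₂ (residueLog (proj₁ (residueIndex t))))) (≈-trans (≈-reflexive (proj₂ (residueIndex t))) (%-≈ (G ^ toℕ t))))))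
          (λ i → lookup-injective (kthResidues-unique p k) _ i
            (<⇒≈-unique (lookup<p _) (lookup<p i)
              (≈-trans (≈-reflexive (proj₂ (residueIndex (proj₁ (residueLog i))))) (≈-trans (%-≈ (G ^ toℕ (proj₁ (residueLog i)))) (≈-sym (proj₂ (residueLog i)))))))
          where
          lookup<p : ∀ i → lookup (kthResidues p k) i < p
          lookup<p i = proj₁ (proj₂ (kthResidues⁻ p k (∈-lookup i)))

        x : Fin L → ℤ
        x i = + toℕ (π ⟨$⟩ʳ i)

        index : CyclicIndex m x
        index = permutation-cyclicIndex π

        det-W : det L (W p k) ≡ det L (λ i j → c (x i -ℤ x j))
        det-W = det-cong (λ i j → legendre-+ (toℕ (π ⟨$⟩ʳ i)) (toℕ (π ⟨$⟩ʳ j)) (proj₂ (residueLog i)) (proj₂ (residueLog j)))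

        sum-over-powers : ∀ {F} → Periodic m F → sumFin N (λ i → F (+ toℕ i)) ≡ + k *ℤ cycSum m F
        sum-over-powers {F} per = trans (cong (λ n → sumFin n (λ i → F (+ toℕ i))) N≡km) (sumFin-periods k per)

        gⁱ^k+1 : ∀ i → legendre p ((g ^ i) ^ k + 1) ≡ c (+ i)
        gⁱ^k+1 i = trans (cong (λ t → legendre p (t + 1)) (^-swap g i k)) (sym (c-+ i))

        -- The point `x = 0` contributes the symbol of 1, which is the 1 in `aP p k +ℤ + 1`. All
        -- other `x` are powers `g ^ i` with `x ^ k ≈ G ^ i`, and `i` runs through `k` periods of
        -- `c`.
        aP-sum : aP p k +ℤ + 1 ≡ - (+ k *ℤ cycSum m c)
        aP-sum = begin
          + p -ℤ + countPts p (λ x → x ^ k + 1) +ℤ + 1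
            ≡⟨ cong (λ t → + p -ℤ t +ℤ + 1) (countPts-legendre (λ x → x ^ k + 1)) ⟩
          + p -ℤ (+ p +ℤ sumFin p (λ x → legendre p (toℕ x ^ k + 1))) +ℤ + 1
            ≡⟨ cong (λ t → + p -ℤ (+ p +ℤ t) +ℤ + 1) (sum-units (λ x → legendre p (x ^ k + 1)) (λ e → legendre-cong (≈-+ (≈-^ k e) (≈-reflexive {x = 1} refl)))) ⟩
          + p -ℤ (+ p +ℤ (legendre p (0 ^ k + 1) +ℤ sumFin N (λ i → legendre p ((g ^ toℕ i) ^ k + 1)))) +ℤ + 1
            ≡⟨ cong₂ (λ s t → + p -ℤ (+ p +ℤ (s +ℤ t)) +ℤ + 1)
                 (trans (legendre-^ 0 (≈-reflexive (cong (_+ 1) (0^ k)))) (σ-yes {+ 0} (∣ᵤ⇒∣ (2 ℕ∣.∣0))))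
                 (trans (sumFin-cong {N} (λ i → gⁱ^k+1 (toℕ i))) (sum-over-powers c-periodic)) ⟩
          + p -ℤ (+ p +ℤ (+ 1 +ℤ + k *ℤ cycSum m c)) +ℤ + 1
            ≡⟨ lem (+ p) (+ k *ℤ cycSum m c) ⟩
          - (+ k *ℤ cycSum m c) ∎
          where
          lem : ∀ p s → p -ℤ (p +ℤ (+ 1 +ℤ s)) +ℤ + 1 ≡ - s
          lem = solve-∀

        -- Now `x = 0` contributes 0, and the factor `x = g ^ i` contributes `σ i`. The evenness of
        -- `m` makes `σ` periodic modulo `m`, so that the sum again breaks up into `k` periods.
        bP-sum : + 2 ∣ℤ + m → bP p k ≡ - (+ k *ℤ cycSum m (λ u → σ u *ℤ c u))
        bP-sum 2∣m = begin
          + p -ℤ + countPts p (λ x → x * (x ^ k + 1))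
            ≡⟨ cong (λ t → + p -ℤ t) (countPts-legendre (λ x → x * (x ^ k + 1))) ⟩
          + p -ℤ (+ p +ℤ sumFin p (λ x → legendre p (toℕ x * (toℕ x ^ k + 1))))
            ≡⟨ cong (λ t → + p -ℤ (+ p +ℤ t)) (sum-units (λ x → legendre p (x * (x ^ k + 1))) (λ e → legendre-cong (≈-* e (≈-+ (≈-^ k e) (≈-reflexive {x = 1} refl))))) ⟩
          + p -ℤ (+ p +ℤ (legendre p 0 +ℤ sumFin N (λ i → legendre p (g ^ toℕ i * ((g ^ toℕ i) ^ k + 1)))))
            ≡⟨ cong₂ (λ s t → + p -ℤ (+ p +ℤ (s +ℤ t))) (legendre-0 (≈-reflexive {x = 0} refl))
                 (trans (sumFin-cong {N} (λ i → trans (legendre-^* (toℕ i) ((g ^ toℕ i) ^ k + 1)) (cong (σ (+ toℕ i) *ℤ_) (gⁱ^k+1 (toℕ i)))))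
                   (sum-over-powers {λ u → σ u *ℤ c u} (periodic-* {F = σ} {c} (σ-periodic 2∣m) c-periodic))) ⟩
          + p -ℤ (+ p +ℤ (+ 0 +ℤ + k *ℤ cycSum m (λ u → σ u *ℤ c u)))
            ≡⟨ lem (+ p) (+ k *ℤ cycSum m (λ u → σ u *ℤ c u)) ⟩
          - (+ k *ℤ cycSum m (λ u → σ u *ℤ c u)) ∎
          where
          lem : ∀ p s → p -ℤ (p +ℤ (+ 0 +ℤ s)) ≡ - s
          lem = solve-∀

      det-W-odd : ∀ n → m ≡ 1 + (n + n) → Σ ℤ λ u → + k *ℤ det L (W p k) ≡ - ((aP p k +ℤ + 1) *ℤ (u *ℤ u))
      det-W-odd n m≡1+2n = finish (det-odd n {x = x} {c} (↔⇒≡ π) m≡1+2n index c-periodic c-even)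
        where
        finish : (Σ ℤ λ u → det L (λ i j → c (x i -ℤ x j)) ≡ cycSum m c *ℤ (u *ℤ u)) →
          Σ ℤ λ u → + k *ℤ det L (W p k) ≡ - ((aP p k +ℤ + 1) *ℤ (u *ℤ u))
        finish (u , eq) = u , (begin
          + k *ℤ det L (W p k)                          ≡⟨ cong (+ k *ℤ_) (trans det-W eq) ⟩
          + k *ℤ (cycSum m c *ℤ (u *ℤ u))               ≡⟨ lem (+ k) (cycSum m c) (u *ℤ u) ⟩
          - (- (+ k *ℤ cycSum m c) *ℤ (u *ℤ u))         ≡⟨ cong (λ t → - (t *ℤ (u *ℤ u))) aP-sum ⟨
          - ((aP p k +ℤ + 1) *ℤ (u *ℤ u))               ∎)
          where
          lem : ∀ k s u → k *ℤ (s *ℤ u) ≡ - (- (k *ℤ s) *ℤ u)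
          lem = solve-∀

      det-W-even : ∀ n → m ≡ 2 + (n + n) →
        Σ ℤ λ v → (+ k *ℤ + k) *ℤ det L (W p k) ≡ (aP p k +ℤ + 1) *ℤ bP p k *ℤ (v *ℤ v)
      det-W-even n m≡2+2n = finish (det-even n {x = x} {c} (↔⇒≡ π) m≡2+2n index c-periodic c-even)
        where
        finish : (Σ ℤ λ v → det L (λ i j → c (x i -ℤ x j)) ≡ cycSum m c *ℤ cycSum m (λ u → σ u *ℤ c u) *ℤ (v *ℤ v)) →
          Σ ℤ λ v → (+ k *ℤ + k) *ℤ det L (W p k) ≡ (aP p k +ℤ + 1) *ℤ bP p k *ℤ (v *ℤ v)
        finish (v , eq) = v , (begin
          (+ k *ℤ + k) *ℤ det L (W p k)                                    ≡⟨ cong ((+ k *ℤ + k) *ℤ_) (trans det-W eq) ⟩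
          (+ k *ℤ + k) *ℤ (cycSum m c *ℤ S *ℤ (v *ℤ v))                    ≡⟨ lem (+ k) (cycSum m c) S (v *ℤ v) ⟩
          - (+ k *ℤ cycSum m c) *ℤ - (+ k *ℤ S) *ℤ (v *ℤ v)                ≡⟨ cong₂ (λ s t → s *ℤ t *ℤ (v *ℤ v)) aP-sum (bP-sum (subst (λ m → + 2 ∣ℤ + m) (sym m≡2+2n) (2∣2+n+n n))) ⟨
          (aP p k +ℤ + 1) *ℤ bP p k *ℤ (v *ℤ v)                            ∎)
          where
          S = cycSum m (λ u → σ u *ℤ c u)
          lem : ∀ k s t v → (k *ℤ k) *ℤ (s *ℤ t *ℤ v) ≡ - (k *ℤ s) *ℤ - (k *ℤ t) *ℤ v
          lem = solve-∀

-- The two parities of m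

halve : ∀ m → (Σ ℕ λ n → m ≡ n + n) ⊎ (Σ ℕ λ n → m ≡ 1 + (n + n))
halve zero    = inj₁ (0 , refl)
halve (suc m) with halve m
... | inj₁ (n , refl) = inj₂ (n , refl)
... | inj₂ (n , refl) = inj₁ (suc n , cong suc (sym (ℕ.+-suc n n)))

theorem1p1 : (p k m : ℕ) → .{{_ : NonZero p}} → Prime p → p ≢ 2 →
    2 ≤ k → 2 ∣ k → p ≡ k * m + 1 →
    ((¬ (2 ∣ m)) →
    Σ ℤ (λ u → (+ k) *ℤ det (length (kthResidues p k)) (W p k)
    ≡ - ((aP p k +ℤ + 1) *ℤ (u *ℤ u))))
    × ((2 ∣ m) →
    Σ ℤ (λ v → ((+ k) *ℤ (+ k)) *ℤ det (length (kthResidues p k)) (W p k)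
    ≡ (aP p k +ℤ + 1) *ℤ bP p k *ℤ (v *ℤ v)))
theorem1p1 p k m pr _ _ 2∣k p≡km+1 = withRoot (primitiveRoot pr)
  where
  Claim : Set
  Claim = ((¬ (2 ∣ m)) → Σ ℤ (λ u → (+ k) *ℤ det (length (kthResidues p k)) (W p k) ≡ - ((aP p k +ℤ + 1) *ℤ (u *ℤ u))))
    × ((2 ∣ m) → Σ ℤ (λ v → ((+ k) *ℤ (+ k)) *ℤ det (length (kthResidues p k)) (W p k) ≡ (aP p k +ℤ + 1) *ℤ bP p k *ℤ (v *ℤ v)))
  withRoot : (Σ ℕ λ g → ¬ (g ≈ 0 [mod p ]) × Σ ℕ λ s → Order pr g s × p ≡ suc s) → Claim
  withRoot (g , g≉0 , N , g-order , refl) = oddCase (halve m) , evenCase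
    where
    *2 : ∀ n → n * 2 ≡ n + n
    *2 n = trans (ℕ.*-comm n 2) (cong (λ t → n + t) (ℕ.+-identityʳ n))
    N≡km : N ≡ k * m
    N≡km = ℕ.suc-injective (trans p≡km+1 (ℕ.+-comm (k * m) 1))
    2∣N : + 2 ∣ℤ + N
    2∣N = ∣ᵤ⇒∣ (subst (2 ∣_) (sym N≡km) (ℕ∣.∣m⇒∣m*n m 2∣k))
    oddCase : (Σ ℕ λ n → m ≡ n + n) ⊎ (Σ ℕ λ n → m ≡ 1 + (n + n)) → ¬ (2 ∣ m) → _
    oddCase (inj₁ (n , m≡2n)) 2∤m = contradiction (ℕ∣.divides n (trans m≡2n (sym (*2 n)))) 2∤m
    oddCase (inj₂ (n , m≡1+2n)) 2∤m = det-W-odd pr g≉0 g-order 2∣N k m N≡km 2∣k n m≡1+2n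
    evenCase : 2 ∣ m → _
    -- An even `m` is needed in the form `2 + (n + n)`, with `n` the number of pairs in
    -- `foldable-even`; `m = 0` would give `p = 1`.
    evenCase (ℕ∣.divides zero m≡0) = contradiction (trans N≡km (trans (cong (k *_) m≡0) (ℕ.*-zeroʳ k))) (ℕ.<⇒≢ (Order.positive g-order) ∘ sym)
    evenCase (ℕ∣.divides (suc n) m≡2+2n) = det-W-even pr g≉0 g-order 2∣N k m N≡km 2∣k n
      (trans m≡2+2n (cong (λ t → 2 + t) (*2 n)))
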